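{- Let $\Delta\subset\mathcal M$ be a double coset. Then $\mathcal B_\Delta\subset\mathcal A_\Delta$, and for $\xi\in\mathcal B_\Delta$: (a) there exists $\beta(\xi)\in\mathbb Q$ such that $\langle\xi,K\rangle=\beta(\xi)$ for all right cosets $K\in\Delta/\Gamma$; (b) $\beta(\xi)=-\alpha(\xi)$. Moreover, the map $\beta:\mathcal B_\Delta\to\mathbb Q$ is surjective.
   Context: Let $\Gamma=\mathrm{PSL}_2(\mathbb Z)$, $S=\pm\begin{pmatrix}0&-1\\1&0\end{pmatrix}$, $U=\pm\begin{pmatrix}1&-1\\1&0\end{pmatrix}$, $T=US=\pm\begin{pmatrix}1&1\\0&1\end{pmatrix}$. Let $\mathcal M$ be the set of $2\times2$ integer matrices of positive determinant modulo $\{\pm1\}$, $\mathcal R=\mathbb Q[\mathcal M]$ the $\mathbb Q$-algebra of formal finite linear combinations with multiplication extending matrix multiplication ($1$ = identity). For $\xi=\sum c_MM$ and $\mathcal S\subset\mathcal M$, $\langle\xi,\mathcal S\rangle=\sum_{M\in\mathcal S}c_M$. Put $\pi_S=(1+S)/2$, $\pi_U=(1+U+U^2)/3$, $\mathcal I=\pi_S\mathcal R+\pi_U\mathcal R$, $\mathcal A=\{\xi\in\mathcal R:\xi\pi_S\in\mathcal I,\ \xi\pi_U\in\mathcal I\}$, $\mathcal B=\{\xi\in\mathcal R:\xi\pi_S\in\pi_U\mathcal R,\ \xi\pi_U\in\pi_S\mathcal R\}$. For a double coset $\Delta=\Gamma\delta\Gamma$ let $\mathcal R_\Delta=\mathbb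 Q[\Delta]$, $\mathcal A_\Delta=\mathcal A\cap\mathcal R_\Delta$, $\mathcal B_\Delta=\mathcal B\cap\mathcal R_\Delta$. Let $T_\Delta^\infty=\sum_{M\in\mathcal M^\infty_\Delta}M$ with $\mathcal M_\Delta^\infty$ a set of representatives of $\Gamma\backslash\Delta$ with lower-left entry $0$. For $\xi\in\mathcal A_\Delta$, $\alpha(\xi)\in\mathbb Q$ denotes the unique number with $(1-S)\xi-\alpha(\xi)T_\Delta^\infty(1-S)\in(1-T)\mathcal R_\Delta$ (such a unique number exists for every $\xi\in\mathcal A_\Delta$). -}

module Defs where

open import Data.Bool using (Bool; true; false; _∧_; _∨_; if_then_else_)
open import Data.Integer as ℤ using (ℤ; +_; +[1+_]; -[1+_]; 0ℤ; 1ℤ)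
import Data.Integer.Properties as ℤP
open import Data.Integer.Tactic.RingSolver using (solve-∀)
open import Data.Rational as ℚ using (ℚ; 0ℚ; 1ℚ; ½)
open import Data.List using (List; []; _∷_; _++_; map; concatMap)
open import Data.List.Relation.Unary.All using (All)
open import Data.List.Relation.Unary.Any using (Any)
open import Data.List.Relation.Unary.AllPairs using (AllPairs)
open import Data.Product using (Σ; _×_; _,_; ∃)
open import Data.Sum using (_⊎_)
open import Relation.Nullary using (¬_)
open import Relation.Nullary.Decidable using (⌊_⌋)
open import Relation.Binary.PropositionalEquality using (_≡_; _≢_; refl; subst)

-- 2×2 integer matrices of positive determinant (the set 𝓜 before
-- identifying M with -M; that identification is built into coefficients,
-- cosets, etc. below).

det' : ℤ → ℤ → ℤ → ℤ → ℤ
det' a b c d = a ℤ.* d ℤ.- b ℤ.* c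

record Mat : Set where
  constructor mat
  field
    a b c d : ℤ
    detPos : ℤ.Positive (det' a b c d)
open Mat public

pos* : ∀ x y → ℤ.Positive x → ℤ.Positive y → ℤ.Positive (x ℤ.* y)
pos* +[1+ m ] +[1+ n ] _ _ = _

det-mult : ∀ a b c d a' b' c' d' →
  (a ℤ.* a' ℤ.+ b ℤ.* c') ℤ.* (c ℤ.* b' ℤ.+ d ℤ.* d')
    ℤ.- (a ℤ.* b' ℤ.+ b ℤ.* d') ℤ.* (c ℤ.* a' ℤ.+ d ℤ.* c')
  ≡ (a ℤ.* d ℤ.- b ℤ.* c) ℤ.* (a' ℤ.* d' ℤ.- b' ℤ.* c')
det-mult = solve-∀

_·_ : Mat → Mat → Mat
M · N = record
  { a = Mat.a M ℤ.* Mat.a N ℤ.+ Mat.b M ℤ.* Mat.c N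
  ; b = Mat.a M ℤ.* Mat.b N ℤ.+ Mat.b M ℤ.* Mat.d N
  ; c = Mat.c M ℤ.* Mat.a N ℤ.+ Mat.d M ℤ.* Mat.c N
  ; d = Mat.c M ℤ.* Mat.b N ℤ.+ Mat.d M ℤ.* Mat.d N
  ; detPos = subst ℤ.Positive
      (Relation.Binary.PropositionalEquality.sym
        (det-mult (Mat.a M) (Mat.b M) (Mat.c M) (Mat.d M)
                  (Mat.a N) (Mat.b N) (Mat.c N) (Mat.d N)))
      (pos* _ _ (Mat.detPos M) (Mat.detPos N)) }
  where import Relation.Binary.PropositionalEquality

SameEntries : Mat → Mat → Set
SameEntries M N = (a M ≡ a N) × (b M ≡ b N) × (c M ≡ c N) × (d M ≡ d N)

NegEntries : Mat → Mat → Set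
NegEntries M N =
  (a M ≡ ℤ.- a N) × (b M ≡ ℤ.- b N) × (c M ≡ ℤ.- c N) × (d M ≡ ℤ.- d N)

_~±_ : Mat → Mat → Set
M ~± N = SameEntries M N ⊎ NegEntries M N

sameB : Mat → Mat → Bool
sameB M N = ⌊ a M ℤP.≟ a N ⌋ ∧ ⌊ b M ℤP.≟ b N ⌋ ∧ ⌊ c M ℤP.≟ c N ⌋ ∧ ⌊ d M ℤP.≟ d N ⌋

negB : Mat → Mat → Bool
negB M N = ⌊ a M ℤP.≟ ℤ.- a N ⌋ ∧ ⌊ b M ℤP.≟ ℤ.- b N ⌋
         ∧ ⌊ c M ℤP.≟ ℤ.- c N ⌋ ∧ ⌊ d M ℤP.≟ ℤ.- d N ⌋

_≟±_ : Mat → Mat → Bool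
M ≟± N = sameB M N ∨ negB M N

-- The algebra 𝓡 = ℚ[𝓜] : formal finite ℚ-linear combinations,
-- represented by lists of (coefficient, matrix); two lists represent the
-- same element iff all coefficients (with M and -M identified) agree.

R : Set
R = List (ℚ × Mat)

coeff : R → Mat → ℚ
coeff [] M = 0ℚ
coeff ((q , N) ∷ ξ) M = (if N ≟± M then q else 0ℚ) ℚ.+ coeff ξ M

_≈_ : R → R → Set
ξ ≈ η = ∀ M → coeff ξ M ≡ coeff η M

infix 4 _≈_ _~±_
infixl 6 _+_ _-_
infixl 7 _*_ _⋆_

_+_ : R → R → R
ξ + η = ξ ++ η

_⋆_ : ℚ → R → R
q ⋆ ξ = map (λ { (p , M) → (q ℚ.* p , M) }) ξ

_-_ : R → R → R
ξ - η = ξ + (ℚ.- 1ℚ) ⋆ η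

_*_ : R → R → R
ξ * η = concatMap (λ { (p , M) → map (λ { (q , N) → (p ℚ.* q , M · N) }) η }) ξ

[_] : Mat → R
[ M ] = (1ℚ , M) ∷ []

Imat Smat Umat Tmat : Mat
Imat = mat 1ℤ 0ℤ 0ℤ 1ℤ _
Smat = mat 0ℤ (ℤ.- 1ℤ) 1ℤ 0ℤ _
Umat = mat 1ℤ (ℤ.- 1ℤ) 1ℤ 0ℤ _
Tmat = mat 1ℤ 1ℤ 0ℤ 1ℤ _

one : R
one = [ Imat ]

⅓ : ℚ
⅓ = (+ 1) ℚ./ 3

πS πU : R
πS = ½ ⋆ (one + [ Smat ])
πU = ⅓ ⋆ (one + [ Umat ] + [ Umat · Umat ])

InπU𝓡 InπS𝓡 : R → Set
InπU𝓡 ξ = Σ R λ η → ξ ≈ πU * η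
InπS𝓡 ξ = Σ R λ η → ξ ≈ πS * η

In𝓘 : R → Set
In𝓘 ξ = Σ R λ η₁ → Σ R λ η₂ → ξ ≈ πS * η₁ + πU * η₂

In𝓐 : R → Set
In𝓐 ξ = In𝓘 (ξ * πS) × In𝓘 (ξ * πU)

In𝓑 : R → Set
In𝓑 ξ = InπU𝓡 (ξ * πS) × InπS𝓡 (ξ * πU)

InΓ : Mat → Set
InΓ g = det' (a g) (b g) (c g) (d g) ≡ 1ℤ

InΔ : Mat → Mat → Set
InΔ δ M = Σ Mat λ g → Σ Mat λ h → InΓ g × InΓ h × (M ~± ((g · δ) · h))

In𝓡Δ : Mat → R → Set
In𝓡Δ δ ξ = ∀ M → coeff ξ M ≢ 0ℚ → InΔ δ M

InRightCoset : Mat → Mat → Set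
InRightCoset M N = Σ Mat λ g → InΓ g × (N ~± (M · g))

InLeftCoset : Mat → Mat → Set
InLeftCoset M N = Σ Mat λ g → InΓ g × (N ~± (g · M))

data Pairing (M : Mat) : R → ℚ → Set where
  nil  : Pairing M [] 0ℚ
  consIn  : ∀ {q N ξ s} → InRightCoset M N → Pairing M ξ s →
            Pairing M ((q , N) ∷ ξ) (q ℚ.+ s)
  consOut : ∀ {q N ξ s} → ¬ InRightCoset M N → Pairing M ξ s →
            Pairing M ((q , N) ∷ ξ) s

IsRepsInfty : Mat → List Mat → Set
IsRepsInfty δ L =
  All (λ N → InΔ δ N × c N ≡ 0ℤ) L
  × AllPairs (λ N N' → ¬ InLeftCoset N N') L
  × (∀ M → InΔ δ M → Any (λ N → InLeftCoset N M) L)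

Tinf : List Mat → R
Tinf L = map (λ N → (1ℚ , N)) L

In1-T𝓡Δ : Mat → R → Set
In1-T𝓡Δ δ ζ = Σ R λ η → In𝓡Δ δ η × ζ ≈ (one - [ Tmat ]) * η

IsAlpha : Mat → List Mat → R → ℚ → Set
IsAlpha δ L ξ α =
  In1-T𝓡Δ δ ((one - [ Smat ]) * ξ - α ⋆ (Tinf L * (one - [ Smat ])))

{-# OPTIONS --safe #-}
module Submission where

open import Defs
open import Data.Bool using (true; false; if_then_else_)
open import Data.Empty using (⊥; ⊥-elim)
open import Data.Fin as Fin using (Fin; combine; fromℕ<; toℕ)
import Data.Fin.Properties as FinP
open import Data.Integer as ℤ using (ℤ; +_; +[1+_]; -[1+_]; 0ℤ; 1ℤ; ∣_∣)
import Data.Integer.DivMod as ℤDM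
open import Data.Integer.Divisibility.Signed using (_∣_; divides; _∣?_)
import Data.Integer.Properties as ℤP
import Data.Integer.Tactic.RingSolver as ℤSolver
open import Data.List using (List; []; _∷_; _++_; map; filter; length; lookup)
open import Data.List.Membership.Propositional.Properties using (∈-lookup)
import Data.List.Properties as ListP
open import Data.List.Relation.Unary.All using (All; []; _∷_)
import Data.List.Relation.Unary.All as All
import Data.List.Relation.Unary.All.Properties as AllP
open import Data.List.Relation.Unary.AllPairs using (AllPairs; []; _∷_)
open import Data.List.Relation.Unary.Any using (Any; here; there; any?)
import Data.List.Relation.Unary.Any as Any
open import Data.Maybe using (Maybe; just; nothing)
open import Data.Nat as ℕ using (ℕ; zero; suc)
import Data.Nat.Properties as ℕP
open import Data.Product using (Σ; _×_; _,_; proj₁; proj₂)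
open import Data.Rational as ℚ using (ℚ; 0ℚ; 1ℚ; ½; -_)
import Data.Rational.Properties as ℚP
open import Data.Sum using (_⊎_; inj₁; inj₂)
open import Data.Unit using (⊤; tt)
open import Function using (_∘_)
open import Level using (0ℓ)
open import Relation.Binary.Definitions using (tri<; tri≈; tri>)
open import Relation.Binary.PropositionalEquality
  using (_≡_; _≢_; refl; sym; trans; cong; cong₂; subst; module ≡-Reasoning)
open import Relation.Nullary using (Dec; yes; no; ¬_; does; _because_; Reflects; ofʸ; ofⁿ)
open import Relation.Nullary.Decidable using (⌊_⌋; _×-dec_; _⊎-dec_; ¬?; map′)
open import Relation.Nullary.Reflects using (_×-reflects_; _⊎-reflects_)
open import Tactic.RingSolver using (solve-∀)
open import Tactic.RingSolver.Core.AlmostCommutativeRing using (AlmostCommutativeRing; fromCommutativeRing)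

-- Pair ξ with functions h on matrices.  For ξ ∈ 𝓑, pairing with a function that is
-- right S-invariant (resp. right U-invariant) is unchanged by left translation by U
-- (resp. S); applied to indicators of right cosets, which are invariant under both,
-- this gives (a).
--
-- For (b), (1 − S)ξ − αT^∞(1 − S) lies in (1 − T)𝓡_Δ iff its sums over the orbits
-- ⟨T⟩M vanish.  On the coset M_kΓ with M_k = TᵏM, let hS and hU indicate that
-- M_k⁻¹N maps i, resp. the fixed point ρ of U, to the right of the imaginary axis.
-- They are right S-, resp. U-invariant, and differ exactly at N = ±M_k, since only
-- one edge of the Farey tree meets the axis.  Hence the coefficient of (1 − S)ξ at
-- M_k telescopes in k, and the orbit sum is a difference of limits at k → ±∞,
-- namely −β, β or 0 according as c = 0, d = 0 or neither.
--
-- For surjectivity let Y be the sum of representatives of Δ/Γ.  An element ξ with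
-- ξπ_S = π_U Y π_S and ξπ_U = π_S Y π_U exists because (g − 1)π_S, for g ∈ Γ, has
-- the form xπ_S with xπ_U = 0, and likewise with S and U exchanged.

-- In a list representing an element of 𝓡, matrices may repeat, cancel or occur with either sign, so
-- neither equality nor support is visible on the list. The argument is therefore dual: pairings
-- with functions invariant under M ↦ -M detect equality, and a right factor π_S or π_U becomes an
-- averaging of the function. The way back, from vanishing sums to an explicit element, is always
-- `Collapse`: a list whose sums over the classes of an equivalence relation vanish is a combination
-- of differences of equivalent matrices. It is applied to signs, to ⟨T⟩-orbits and to right cosets.
-- The value α = -β comes from a coincidence of orbit sums. Those of T^∞(1 - S) are [c = 0] -
-- [d = 0]. The limits for (1 - S)ξ concern M_k⁻¹N(i) = M⁻¹T⁻ᵏN(i), which tends to M⁻¹(∞) = -d/c at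
-- both ends; the two ends can lie on different sides of the imaginary axis only if -d/c is an
-- endpoint 0 or ∞ of the axis, and this gives a multiple of the same function of M. As ξ is a
-- finite sum, one bound on k serves for all its matrices N.

ringℚ : AlmostCommutativeRing 0ℓ 0ℓ
ringℚ = fromCommutativeRing ℚP.+-*-commutativeRing zero?
  where
  zero? : ∀ x → Maybe (0ℚ ≡ x)
  zero? x with 0ℚ ℚP.≟ x
  ... | yes p = just p
  ... | no _  = nothing

-- Indicators

𝟙 : ∀ {P : Set} → Dec P → ℚ
𝟙 p = if does p then 1ℚ else 0ℚ

𝟙-yes : ∀ {P : Set} (p : Dec P) → P → 𝟙 p ≡ 1ℚ
𝟙-yes (yes _) _ = refl
𝟙-yes (no ¬x) x = ⊥-elim (¬x x)

𝟙-no : ∀ {P : Set} (p : Dec P) → ¬ P → 𝟙 p ≡ 0ℚ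
𝟙-no (yes x) ¬x = ⊥-elim (¬x x)
𝟙-no (no _)  _  = refl

𝟙-cong : ∀ {P Q : Set} (p : Dec P) (q : Dec Q) → (P → Q) → (Q → P) → 𝟙 p ≡ 𝟙 q
𝟙-cong p (yes y) _ g = 𝟙-yes p (g y)
𝟙-cong p (no ¬y) f _ = 𝟙-no p (¬y ∘ f)

-- The pairing of ξ with a function on matrices

ev : (Mat → ℚ) → R → ℚ
ev h []            = 0ℚ
ev h ((q , N) ∷ ξ) = q ℚ.* h N ℚ.+ ev h ξ

ev-cong : ∀ {h k} → (∀ M → h M ≡ k M) → ∀ ξ → ev h ξ ≡ ev k ξ
ev-cong e []            = refl
ev-cong e ((q , N) ∷ ξ) = cong₂ (λ x y → q ℚ.* x ℚ.+ y) (e N) (ev-cong e ξ)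

ev-congAll : ∀ {P : Mat → Set} {h k} → (∀ M → P M → h M ≡ k M) →
             ∀ ξ → All (P ∘ proj₂) ξ → ev h ξ ≡ ev k ξ
ev-congAll e []            []       = refl
ev-congAll e ((q , N) ∷ ξ) (p ∷ ps) =
  cong₂ (λ x y → q ℚ.* x ℚ.+ y) (e N p) (ev-congAll e ξ ps)

ev-++ : ∀ h ξ η → ev h (ξ + η) ≡ ev h ξ ℚ.+ ev h η
ev-++ h []            η = sym (ℚP.+-identityˡ _)
ev-++ h ((q , N) ∷ ξ) η =
  trans (cong (q ℚ.* h N ℚ.+_) (ev-++ h ξ η)) (sym (ℚP.+-assoc (q ℚ.* h N) (ev h ξ) (ev h η)))

ev-⋆ : ∀ h q ξ → ev h (q ⋆ ξ) ≡ q ℚ.* ev h ξ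
ev-⋆ h q []            = sym (ℚP.*-zeroʳ q)
ev-⋆ h q ((p , N) ∷ ξ) =
  trans (cong ((q ℚ.* p) ℚ.* h N ℚ.+_) (ev-⋆ h q ξ)) (lem q p (h N) (ev h ξ))
  where
  lem : ∀ q p x y → (q ℚ.* p) ℚ.* x ℚ.+ q ℚ.* y ≡ q ℚ.* (p ℚ.* x ℚ.+ y)
  lem = solve-∀ ringℚ

ev-- : ∀ h ξ η → ev h (ξ - η) ≡ ev h ξ ℚ.- ev h η
ev-- h ξ η = trans (ev-++ h ξ ((ℚ.- 1ℚ) ⋆ η))
  (cong (ev h ξ ℚ.+_) (trans (ev-⋆ h (ℚ.- 1ℚ) η) (lem (ev h η))))
  where
  lem : ∀ x → (ℚ.- 1ℚ) ℚ.* x ≡ ℚ.- x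
  lem = solve-∀ ringℚ

ev-* : ∀ h ξ η → ev h (ξ * η) ≡ ev (λ M → ev (λ N → h (M · N)) η) ξ
ev-* h []            η = refl
ev-* h ((p , M) ∷ ξ) η =
  trans (split _ (λ _ _ → refl)) (cong (p ℚ.* ev (λ N → h (M · N)) η ℚ.+_) (ev-* h ξ η))
  where
  lem : ∀ p q x y → (p ℚ.* q) ℚ.* x ℚ.+ p ℚ.* y ≡ p ℚ.* (q ℚ.* x ℚ.+ y)
  lem = solve-∀ ringℚ
  -- The inner map of `_*_` is an anonymous pattern-matching lambda, so it is handled as an
  -- arbitrary `f` with its pointwise equation.
  row : ∀ f → (∀ q N → f (q , N) ≡ (p ℚ.* q , M · N)) → ∀ η →
        ev h (map f η) ≡ p ℚ.* ev (λ N → h (M · N)) η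
  row f f≡ []            = sym (ℚP.*-zeroʳ p)
  row f f≡ ((q , N) ∷ η) rewrite f≡ q N =
    trans (cong ((p ℚ.* q) ℚ.* h (M · N) ℚ.+_) (row f f≡ η)) (lem p q _ _)
  split : ∀ f → (∀ q N → f (q , N) ≡ (p ℚ.* q , M · N)) →
          ev h (map f η ++ (ξ * η)) ≡ p ℚ.* ev (λ N → h (M · N)) η ℚ.+ ev h (ξ * η)
  split f f≡ = trans (ev-++ h (map f η) (ξ * η)) (cong (ℚ._+ ev h (ξ * η)) (row f f≡ η))

ev-[] : ∀ h M → ev h [ M ] ≡ h M
ev-[] h M = lem (h M)
  where
  lem : ∀ x → 1ℚ ℚ.* x ℚ.+ 0ℚ ≡ x
  lem = solve-∀ ringℚ

ev-0 : ∀ ξ → ev (λ _ → 0ℚ) ξ ≡ 0ℚ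
ev-0 []            = refl
ev-0 ((q , N) ∷ ξ) = trans (cong₂ ℚ._+_ (ℚP.*-zeroʳ q) (ev-0 ξ)) refl

ev-+h : ∀ h k ξ → ev (λ M → h M ℚ.+ k M) ξ ≡ ev h ξ ℚ.+ ev k ξ
ev-+h h k []            = refl
ev-+h h k ((q , N) ∷ ξ) =
  trans (cong (q ℚ.* (h N ℚ.+ k N) ℚ.+_) (ev-+h h k ξ)) (lem q (h N) (k N) (ev h ξ) (ev k ξ))
  where
  lem : ∀ q x y a b → q ℚ.* (x ℚ.+ y) ℚ.+ (a ℚ.+ b) ≡ (q ℚ.* x ℚ.+ a) ℚ.+ (q ℚ.* y ℚ.+ b)
  lem = solve-∀ ringℚ

ev-⋆h : ∀ c h ξ → ev (λ M → c ℚ.* h M) ξ ≡ c ℚ.* ev h ξ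
ev-⋆h c h []            = sym (ℚP.*-zeroʳ c)
ev-⋆h c h ((q , N) ∷ ξ) =
  trans (cong (q ℚ.* (c ℚ.* h N) ℚ.+_) (ev-⋆h c h ξ)) (lem q c (h N) (ev h ξ))
  where
  lem : ∀ q c x y → q ℚ.* (c ℚ.* x) ℚ.+ c ℚ.* y ≡ c ℚ.* (q ℚ.* x ℚ.+ y)
  lem = solve-∀ ringℚ

-- Collapsing classes of an equivalence relation

module Collapse
  (_∼_ : Mat → Mat → Set) (_∼?_ : ∀ M N → Dec (M ∼ N))
  (∼-refl : ∀ M → M ∼ M)
  (∼-sym : ∀ {M N} → M ∼ N → N ∼ M)
  (∼-trans : ∀ {M N P} → M ∼ N → N ∼ P → M ∼ P)
  (D : Mat → Set)
  (J : R → Set)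
  (J-resp : ∀ {ξ η} → (∀ h → ev h ξ ≡ ev h η) → J ξ → J η)
  (J-0 : J [])
  (J-+ : ∀ {ξ η} → J ξ → J η → J (ξ + η))
  (J-gen : ∀ q {M N} → D M → D N → M ∼ N → J (q ⋆ ([ N ] - [ M ])))
  where

  χ : Mat → Mat → ℚ
  χ M N = 𝟙 (M ∼? N)

  private
    in? : ∀ M (t : ℚ × Mat) → Dec (M ∼ proj₂ t)
    in? M t = M ∼? proj₂ t

    out? : ∀ M (t : ℚ × Mat) → Dec (¬ (M ∼ proj₂ t))
    out? M t = ¬? (M ∼? proj₂ t)

    inside outside : Mat → R → R
    inside  M = filter (in? M)
    outside M = filter (out? M)

    split : ∀ M h ξ → ev h ξ ≡ ev h (inside M ξ) ℚ.+ ev h (outside M ξ)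
    split M h []            = refl
    split M h ((q , N) ∷ ξ) with M ∼? N
    ... | yes _ = trans (cong (q ℚ.* h N ℚ.+_) (split M h ξ))
                    (sym (ℚP.+-assoc (q ℚ.* h N) (ev h (inside M ξ)) (ev h (outside M ξ))))
    ... | no _  = trans (cong (q ℚ.* h N ℚ.+_) (split M h ξ))
                    (lem (q ℚ.* h N) (ev h (inside M ξ)) (ev h (outside M ξ)))
      where
      lem : ∀ x y z → x ℚ.+ (y ℚ.+ z) ≡ y ℚ.+ (x ℚ.+ z)
      lem = solve-∀ ringℚ

    ev-inside : ∀ {M N} ξ → All (λ t → M ∼ proj₂ t) ξ → M ∼ N →
                ev (χ N) ξ ≡ ev (λ _ → 1ℚ) ξ
    ev-inside {M} {N} ξ ps M∼N = ev-congAll {M ∼_}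
      (λ P M∼P → 𝟙-yes (N ∼? P) (∼-trans (∼-sym M∼N) M∼P)) ξ ps

    -- Within one class each term q[N] is q[M] plus the generator q([N] - [M]), so only the total
    -- weight, placed at M, remains modulo `J`.
    gather : ∀ {M} ξ → D M → All (λ t → D (proj₂ t)) ξ → All (λ t → M ∼ proj₂ t) ξ →
             J (ξ - (ev (λ _ → 1ℚ) ξ) ⋆ [ M ])
    gather {M} []            _ _        _        = J-resp (λ h → lem (h M)) J-0
      where
      lem : ∀ x → 0ℚ ≡ ((ℚ.- 1ℚ) ℚ.* (0ℚ ℚ.* 1ℚ)) ℚ.* x ℚ.+ 0ℚ
      lem = solve-∀ ringℚ
    gather {M} ((q , N) ∷ ξ) d (d' ∷ ds) (r ∷ rs) =
      J-resp (λ h → begin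
          ev h (q ⋆ ([ N ] - [ M ]) + (ξ - s ⋆ [ M ]))
            ≡⟨ ev-++ h (q ⋆ ([ N ] - [ M ])) (ξ - s ⋆ [ M ]) ⟩
          ev h (q ⋆ ([ N ] - [ M ])) ℚ.+ ev h (ξ - s ⋆ [ M ])
            ≡⟨ cong (ev h (q ⋆ ([ N ] - [ M ])) ℚ.+_) (ev-++ h ξ ((ℚ.- 1ℚ) ⋆ (s ⋆ [ M ]))) ⟩
          ev h (q ⋆ ([ N ] - [ M ])) ℚ.+ (ev h ξ ℚ.+ ev h ((ℚ.- 1ℚ) ⋆ (s ⋆ [ M ])))
            ≡⟨ lem q (h N) (h M) (ev h ξ) s ⟩
          q ℚ.* h N ℚ.+ (ev h ξ ℚ.+ ev h ((ℚ.- 1ℚ) ⋆ ((q ℚ.* 1ℚ ℚ.+ s) ⋆ [ M ])))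
            ≡⟨ cong (q ℚ.* h N ℚ.+_) (sym (ev-++ h ξ ((ℚ.- 1ℚ) ⋆ ((q ℚ.* 1ℚ ℚ.+ s) ⋆ [ M ])))) ⟩
          ev h (((q , N) ∷ ξ) - (q ℚ.* 1ℚ ℚ.+ s) ⋆ [ M ]) ∎)
        (J-+ (J-gen q d d' r) (gather ξ d ds rs))
      where
      open ≡-Reasoning
      s = ev (λ _ → 1ℚ) ξ
      lem : ∀ q x y z s →
        ((q ℚ.* 1ℚ) ℚ.* x ℚ.+ ((q ℚ.* ((ℚ.- 1ℚ) ℚ.* 1ℚ)) ℚ.* y ℚ.+ 0ℚ))
          ℚ.+ (z ℚ.+ (((ℚ.- 1ℚ) ℚ.* (s ℚ.* 1ℚ)) ℚ.* y ℚ.+ 0ℚ))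
        ≡ q ℚ.* x ℚ.+ (z ℚ.+ (((ℚ.- 1ℚ) ℚ.* ((q ℚ.* 1ℚ ℚ.+ s) ℚ.* 1ℚ)) ℚ.* y ℚ.+ 0ℚ))
      lem = solve-∀ ringℚ

    -- The class of the first matrix has total weight zero, so `gather` puts it in `J`; the other
    -- classes keep their sums. What remains is a filtered list, hence the recursion on a bound `n`
    -- for the length.
    step : ∀ n ξ → length ξ ℕ.≤ n → All (D ∘ proj₂) ξ →
           (∀ M → D M → ev (χ M) ξ ≡ 0ℚ) → J ξ
    step n       []                 _         _          _ = J-0
    step (suc n) ξ@((q , N) ∷ ξ₀) (ℕ.s≤s l) (d ∷ ds) z =
      J-resp recombine
        (J-+ (gather (inside N ξ) d (AllP.filter⁺ (in? N) (d ∷ ds)) (AllP.all-filter (in? N) ξ))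
             (step n (outside N ξ) shorter (AllP.filter⁺ (out? N) (d ∷ ds)) outside-zero))
      where
      open ≡-Reasoning
      shorter : length (outside N ξ) ℕ.≤ n
      shorter with N ∼? N
      ... | yes _ = ℕP.≤-trans (ListP.length-filter (out? N) ξ₀) l
      ... | no ¬r = ⊥-elim (¬r (∼-refl N))

      outside-0 : ∀ {M} → N ∼ M → ev (χ M) (outside N ξ) ≡ 0ℚ
      outside-0 {M} N∼M = trans
        (ev-congAll {λ P → ¬ (N ∼ P)}
          (λ P N≁P → 𝟙-no (M ∼? P) (λ M∼P → N≁P (∼-trans N∼M M∼P)))
          (outside N ξ) (AllP.all-filter (out? N) ξ))
        (ev-0 (outside N ξ))

      inside-0 : ∀ {M} → ¬ (N ∼ M) → ev (χ M) (inside N ξ) ≡ 0ℚ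
      inside-0 {M} N≁M = trans
        (ev-congAll {N ∼_}
          (λ P N∼P → 𝟙-no (M ∼? P) (λ M∼P → N≁M (∼-trans N∼P (∼-sym M∼P))))
          (inside N ξ) (AllP.all-filter (in? N) ξ))
        (ev-0 (inside N ξ))

      outside-zero : ∀ M → D M → ev (χ M) (outside N ξ) ≡ 0ℚ
      outside-zero M dM with N ∼? M
      ... | yes N∼M = outside-0 N∼M
      ... | no  N≁M = begin
        ev (χ M) (outside N ξ)                              ≡⟨ sym (ℚP.+-identityˡ _) ⟩
        0ℚ ℚ.+ ev (χ M) (outside N ξ)                       ≡⟨ cong (ℚ._+ ev (χ M) (outside N ξ)) (sym (inside-0 N≁M)) ⟩
        ev (χ M) (inside N ξ) ℚ.+ ev (χ M) (outside N ξ)    ≡⟨ sym (split N (χ M) ξ) ⟩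
        ev (χ M) ξ                                          ≡⟨ z M dM ⟩
        0ℚ                                                  ∎

      total : ev (λ _ → 1ℚ) (inside N ξ) ≡ 0ℚ
      total = begin
        ev (λ _ → 1ℚ) (inside N ξ)                          ≡⟨ sym (ev-inside (inside N ξ) (AllP.all-filter (in? N) ξ) (∼-refl N)) ⟩
        ev (χ N) (inside N ξ)                               ≡⟨ sym (ℚP.+-identityʳ _) ⟩
        ev (χ N) (inside N ξ) ℚ.+ 0ℚ                        ≡⟨ cong (ev (χ N) (inside N ξ) ℚ.+_) (sym (outside-0 (∼-refl N))) ⟩
        ev (χ N) (inside N ξ) ℚ.+ ev (χ N) (outside N ξ)    ≡⟨ sym (split N (χ N) ξ) ⟩
        ev (χ N) ξ                                          ≡⟨ z N d ⟩
        0ℚ                                                  ∎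

      recombine : ∀ h →
        ev h ((inside N ξ - (ev (λ _ → 1ℚ) (inside N ξ)) ⋆ [ N ]) + outside N ξ) ≡ ev h ξ
      recombine h = begin
        ev h ((inside N ξ - s ⋆ [ N ]) + outside N ξ)
          ≡⟨ ev-++ h (inside N ξ - s ⋆ [ N ]) _ ⟩
        ev h (inside N ξ - s ⋆ [ N ]) ℚ.+ ev h (outside N ξ)
          ≡⟨ cong (ℚ._+ ev h (outside N ξ)) (trans (ev-++ h (inside N ξ) ((ℚ.- 1ℚ) ⋆ (s ⋆ [ N ])))
               (trans (cong (λ x → ev h (inside N ξ) ℚ.+ (((ℚ.- 1ℚ) ℚ.* (x ℚ.* 1ℚ)) ℚ.* h N ℚ.+ 0ℚ)) total)
                      (lem (ev h (inside N ξ)) (h N)))) ⟩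
        ev h (inside N ξ) ℚ.+ ev h (outside N ξ)
          ≡⟨ sym (split N h ξ) ⟩
        ev h ξ ∎
        where
        s = ev (λ _ → 1ℚ) (inside N ξ)
        lem : ∀ x y → x ℚ.+ (((ℚ.- 1ℚ) ℚ.* (0ℚ ℚ.* 1ℚ)) ℚ.* y ℚ.+ 0ℚ) ≡ x
        lem = solve-∀ ringℚ

  -- Three instances follow: signs, with `J` the vanishing of a pairing; ⟨T⟩-orbits, with `J`
  -- membership in (1 - T)𝓡_Δ; right cosets, with `J` the existence of a correction used for
  -- surjectivity.
  collapse : ∀ ξ → All (D ∘ proj₂) ξ → (∀ M → D M → ev (χ M) ξ ≡ 0ℚ) → J ξ
  collapse ξ = step (length ξ) ξ ℕP.≤-refl

-- Matrices up to sign

⌊⌋-reflects : ∀ {P : Set} (p : Dec P) → Reflects P ⌊ p ⌋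
⌊⌋-reflects (yes x) = ofʸ x
⌊⌋-reflects (no ¬x) = ofⁿ ¬x

-- Assembled so that its Boolean is `M ≟± N` itself, the test on which `coeff` branches; `coeff-ev`
-- relies on this conversion.
_~±?_ : ∀ M N → Dec (M ~± N)
M ~±? N = (M ≟± N) because
  (entries (a N) (b N) (c N) (d N) ⊎-reflects
   entries (ℤ.- a N) (ℤ.- b N) (ℤ.- c N) (ℤ.- d N))
  where
  entries : ∀ x y z w → _
  entries x y z w =
    ⌊⌋-reflects (a M ℤP.≟ x) ×-reflects ⌊⌋-reflects (b M ℤP.≟ y) ×-reflects
    ⌊⌋-reflects (c M ℤP.≟ z) ×-reflects ⌊⌋-reflects (d M ℤP.≟ w)

infix 4 _≃_

-- A record around `_~±_`, because the latter unfolds to equations between entries, from which `M`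
-- and `N` could not be inferred. `Γ∋`, `Δ∋` and `RC` are wrapped likewise.
record _≃_ (M N : Mat) : Set where
  constructor up-to-sign
  field entries : M ~± N
open _≃_

≃-refl : ∀ {M} → M ≃ M
≃-refl = up-to-sign (inj₁ (refl , refl , refl , refl))

≃-sym : ∀ {M N} → M ≃ N → N ≃ M
≃-sym (up-to-sign (inj₁ (p , q , r , s))) = up-to-sign (inj₁ (sym p , sym q , sym r , sym s))
≃-sym (up-to-sign (inj₂ (p , q , r , s))) = up-to-sign (inj₂ (flip p , flip q , flip r , flip s))
  where
  flip : ∀ {x y} → x ≡ ℤ.- y → y ≡ ℤ.- x
  flip {y = y} refl = sym (ℤP.neg-involutive y)

≃-trans : ∀ {M N P} → M ≃ N → N ≃ P → M ≃ P
≃-trans (up-to-sign (inj₁ (p , q , r , s))) (up-to-sign (inj₁ (p' , q' , r' , s'))) =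
  up-to-sign (inj₁ (trans p p' , trans q q' , trans r r' , trans s s'))
≃-trans (up-to-sign (inj₁ (p , q , r , s))) (up-to-sign (inj₂ (p' , q' , r' , s'))) =
  up-to-sign (inj₂ (trans p p' , trans q q' , trans r r' , trans s s'))
≃-trans (up-to-sign (inj₂ (p , q , r , s))) (up-to-sign (inj₁ (p' , q' , r' , s'))) =
  up-to-sign (inj₂ (t p p' , t q q' , t r r' , t s s'))
  where
  t : ∀ {x y z} → x ≡ ℤ.- y → y ≡ z → x ≡ ℤ.- z
  t refl refl = refl
≃-trans (up-to-sign (inj₂ (p , q , r , s))) (up-to-sign (inj₂ (p' , q' , r' , s'))) =
  up-to-sign (inj₁ (t p p' , t q q' , t r r' , t s s'))
  where
  t : ∀ {x y z} → x ≡ ℤ.- y → y ≡ ℤ.- z → x ≡ z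
  t {z = z} refl refl = ℤP.neg-involutive z

private
  neg-combˡ : ∀ x y u v → (ℤ.- x) ℤ.* u ℤ.+ (ℤ.- y) ℤ.* v ≡ ℤ.- (x ℤ.* u ℤ.+ y ℤ.* v)
  neg-combˡ = ℤSolver.solve-∀

  neg-combʳ : ∀ x y u v → x ℤ.* (ℤ.- u) ℤ.+ y ℤ.* (ℤ.- v) ≡ ℤ.- (x ℤ.* u ℤ.+ y ℤ.* v)
  neg-combʳ = ℤSolver.solve-∀

det : Mat → ℤ
det M = det' (a M) (b M) (c M) (d M)

infix 20 _∙_

-- Products and adjugates are kept opaque: Mat has η, and unfolding them
-- entrywise during unification is prohibitively expensive.
opaque
  _∙_ : Mat → Mat → Mat
  M ∙ N = M · N

  adj : Mat → Mat
  adj M = mat (d M) (ℤ.- b M) (ℤ.- c M) (a M)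
    (subst ℤ.Positive (lem (a M) (b M) (c M) (d M)) (detPos M))
    where
    lem : ∀ x y z w → x ℤ.* w ℤ.- y ℤ.* z ≡ w ℤ.* x ℤ.- (ℤ.- y) ℤ.* (ℤ.- z)
    lem = ℤSolver.solve-∀

unit-mat : ∀ x y z w → det' x y z w ≡ 1ℤ → Mat
unit-mat x y z w e = mat x y z w (subst ℤ.Positive (sym e) _)

record Γ∋ (g : Mat) : Set where
  constructor unimodular
  field det≡1 : InΓ g
open Γ∋

opaque
  unfolding _∙_ adj

  ∙-congˡ : ∀ M {N N'} → N ≃ N' → M ∙ N ≃ M ∙ N'
  ∙-congˡ M {mat _ _ _ _ _} {mat _ _ _ _ _} (up-to-sign (inj₁ (refl , refl , refl , refl))) =
    up-to-sign (inj₁ (refl , refl , refl , refl))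
  ∙-congˡ (mat x y z w _) {mat _ _ _ _ _} {mat e f g h _} (up-to-sign (inj₂ (refl , refl , refl , refl))) =
    up-to-sign (inj₂ (neg-combʳ x y e g , neg-combʳ x y f h , neg-combʳ z w e g , neg-combʳ z w f h))

  ∙-congʳ : ∀ {M M'} N → M ≃ M' → M ∙ N ≃ M' ∙ N
  ∙-congʳ {mat _ _ _ _ _} {mat _ _ _ _ _} N (up-to-sign (inj₁ (refl , refl , refl , refl))) =
    up-to-sign (inj₁ (refl , refl , refl , refl))
  ∙-congʳ {mat _ _ _ _ _} {mat x y z w _} (mat e f g h _) (up-to-sign (inj₂ (refl , refl , refl , refl))) =
    up-to-sign (inj₂ (neg-combˡ x y e g , neg-combˡ x y f h , neg-combˡ z w e g , neg-combˡ z w f h))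

  ∙-assoc : ∀ A B C → (A ∙ B) ∙ C ≃ A ∙ (B ∙ C)
  ∙-assoc (mat x y z w _) (mat x' y' z' w' _) (mat e f g h _) = up-to-sign (inj₁
    (lem x y x' y' z' w' e g , lem x y x' y' z' w' f h ,
     lem z w x' y' z' w' e g , lem z w x' y' z' w' f h))
    where
    lem : ∀ x y a b c d u v →
      (x ℤ.* a ℤ.+ y ℤ.* c) ℤ.* u ℤ.+ (x ℤ.* b ℤ.+ y ℤ.* d) ℤ.* v
      ≡ x ℤ.* (a ℤ.* u ℤ.+ b ℤ.* v) ℤ.+ y ℤ.* (c ℤ.* u ℤ.+ d ℤ.* v)
    lem = ℤSolver.solve-∀

  ∙-identityˡ : ∀ M → Imat ∙ M ≃ M
  ∙-identityˡ (mat e f g h _) = up-to-sign (inj₁ (p e g , p f h , q e g , q f h))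
    where
    p : ∀ x y → 1ℤ ℤ.* x ℤ.+ 0ℤ ℤ.* y ≡ x
    p = ℤSolver.solve-∀
    q : ∀ x y → 0ℤ ℤ.* x ℤ.+ 1ℤ ℤ.* y ≡ y
    q = ℤSolver.solve-∀

  ∙-identityʳ : ∀ M → M ∙ Imat ≃ M
  ∙-identityʳ (mat e f g h _) = up-to-sign (inj₁ (p e f , q e f , p g h , q g h))
    where
    p : ∀ x y → x ℤ.* 1ℤ ℤ.+ y ℤ.* 0ℤ ≡ x
    p = ℤSolver.solve-∀
    q : ∀ x y → x ℤ.* 0ℤ ℤ.+ y ℤ.* 1ℤ ≡ y
    q = ℤSolver.solve-∀

  det-∙ : ∀ M N → det (M ∙ N) ≡ det M ℤ.* det N
  det-∙ (mat x y z w _) (mat e f g h _) = det-mult x y z w e f g h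

  det-resp : ∀ {M N} → M ≃ N → det M ≡ det N
  det-resp {mat _ _ _ _ _} {mat _ _ _ _ _} (up-to-sign (inj₁ (refl , refl , refl , refl))) = refl
  det-resp {mat _ _ _ _ _} {mat x y z w _} (up-to-sign (inj₂ (refl , refl , refl , refl))) = lem x y z w
    where
    lem : ∀ x y z w → (ℤ.- x) ℤ.* (ℤ.- w) ℤ.- (ℤ.- y) ℤ.* (ℤ.- z) ≡ x ℤ.* w ℤ.- y ℤ.* z
    lem = ℤSolver.solve-∀

  det≢0 : ∀ M → det M ≢ 0ℤ
  det≢0 M e = subst ℤ.Positive e (detPos M) .ℤ.Positive.pos

  Γ-∙ : ∀ {g h} → Γ∋ g → Γ∋ h → Γ∋ (g ∙ h)
  Γ-∙ {g} {h} (unimodular p) (unimodular q) = unimodular (trans (det-∙ g h) (cong₂ ℤ._*_ p q))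

  det-adj : ∀ M → det (adj M) ≡ det M
  det-adj (mat x y z w _) = lem x y z w
    where
    lem : ∀ x y z w → w ℤ.* x ℤ.- (ℤ.- y) ℤ.* (ℤ.- z) ≡ x ℤ.* w ℤ.- y ℤ.* z
    lem = ℤSolver.solve-∀

  Γ-adj : ∀ {g} → Γ∋ g → Γ∋ (adj g)
  Γ-adj {g} (unimodular p) = unimodular (trans (det-adj g) p)

  adj-inverseˡ : ∀ {g} → Γ∋ g → adj g ∙ g ≃ Imat
  adj-inverseˡ {mat x y z w _} (unimodular p) = up-to-sign (inj₁
    (trans (e₁ x y z w) p , e₂ y w , e₃ x z , trans (e₄ x y z w) p))
    where
    e₁ : ∀ x y z w → w ℤ.* x ℤ.+ (ℤ.- y) ℤ.* z ≡ x ℤ.* w ℤ.- y ℤ.* z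
    e₁ = ℤSolver.solve-∀
    e₂ : ∀ y w → w ℤ.* y ℤ.+ (ℤ.- y) ℤ.* w ≡ 0ℤ
    e₂ = ℤSolver.solve-∀
    e₃ : ∀ x z → (ℤ.- z) ℤ.* x ℤ.+ x ℤ.* z ≡ 0ℤ
    e₃ = ℤSolver.solve-∀
    e₄ : ∀ x y z w → (ℤ.- z) ℤ.* y ℤ.+ x ℤ.* w ≡ x ℤ.* w ℤ.- y ℤ.* z
    e₄ = ℤSolver.solve-∀

  adj-inverseʳ : ∀ {g} → Γ∋ g → g ∙ adj g ≃ Imat
  adj-inverseʳ {mat x y z w _} (unimodular p) = up-to-sign (inj₁
    (trans (e₁ x y z w) p , e₂ x y , e₃ z w , trans (e₄ x y z w) p))
    where
    e₁ : ∀ x y z w → x ℤ.* w ℤ.+ y ℤ.* (ℤ.- z) ≡ x ℤ.* w ℤ.- y ℤ.* z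
    e₁ = ℤSolver.solve-∀
    e₂ : ∀ x y → x ℤ.* (ℤ.- y) ℤ.+ y ℤ.* x ≡ 0ℤ
    e₂ = ℤSolver.solve-∀
    e₃ : ∀ z w → z ℤ.* w ℤ.+ w ℤ.* (ℤ.- z) ≡ 0ℤ
    e₃ = ℤSolver.solve-∀
    e₄ : ∀ x y z w → z ℤ.* (ℤ.- y) ℤ.+ w ℤ.* x ≡ x ℤ.* w ℤ.- y ℤ.* z
    e₄ = ℤSolver.solve-∀

cancelˡ : ∀ {g} M → Γ∋ g → adj g ∙ (g ∙ M) ≃ M
cancelˡ {g} M p = ≃-trans (≃-sym (∙-assoc (adj g) g M))
  (≃-trans (∙-congʳ M (adj-inverseˡ p)) (∙-identityˡ M))

cancelʳ : ∀ {g} M → Γ∋ g → (M ∙ g) ∙ adj g ≃ M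
cancelʳ {g} M p = ≃-trans (∙-assoc M g (adj g))
  (≃-trans (∙-congˡ M (adj-inverseʳ p)) (∙-identityʳ M))

-- Double cosets and right cosets

record Δ∋ (δ M : Mat) : Set where
  constructor double
  field
    left right : Mat
    leftΓ      : Γ∋ left
    rightΓ     : Γ∋ right
    factors    : M ≃ (left ∙ δ) ∙ right

opaque
  unfolding _∙_

  to-Δ : ∀ {δ M} → InΔ δ M → Δ∋ δ M
  to-Δ (g , h , p , q , r) = double g h (unimodular p) (unimodular q) (up-to-sign r)

  from-Δ : ∀ {δ M} → Δ∋ δ M → InΔ δ M
  from-Δ (double g h (unimodular p) (unimodular q) (up-to-sign r)) = g , h , p , q , r

Δ-resp : ∀ {δ M N} → M ≃ N → Δ∋ δ N → Δ∋ δ M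
Δ-resp r (double g h p q s) = double g h p q (≃-trans r s)

Γ-I : Γ∋ Imat
Γ-I = unimodular refl

Δ-self : ∀ δ → Δ∋ δ δ
Δ-self δ = double Imat Imat Γ-I Γ-I
  (≃-sym (≃-trans (∙-identityʳ (Imat ∙ δ)) (∙-identityˡ δ)))

Δ-∙ˡ : ∀ {δ M k} → Γ∋ k → Δ∋ δ M → Δ∋ δ (k ∙ M)
Δ-∙ˡ {δ} {M} {k} kΓ (double g h p q s) = double (k ∙ g) h (Γ-∙ kΓ p) q
  (≃-trans (∙-congˡ k s) (≃-trans (≃-sym (∙-assoc k (g ∙ δ) h))
    (∙-congʳ h (≃-sym (∙-assoc k g δ)))))

Δ-∙ʳ : ∀ {δ M k} → Γ∋ k → Δ∋ δ M → Δ∋ δ (M ∙ k)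
Δ-∙ʳ {δ} {M} {k} kΓ (double g h p q s) = double g (h ∙ k) p (Γ-∙ q kΓ)
  (≃-trans (∙-congʳ k s) (∙-assoc (g ∙ δ) h k))

record RC (M N : Mat) : Set where
  constructor coset
  field
    unit  : Mat
    unitΓ : Γ∋ unit
    moves : N ≃ M ∙ unit

opaque
  unfolding _∙_

  to-RC : ∀ {M N} → InRightCoset M N → RC M N
  to-RC (g , p , r) = coset g (unimodular p) (up-to-sign r)

  from-RC : ∀ {M N} → RC M N → InRightCoset M N
  from-RC (coset g (unimodular p) (up-to-sign r)) = g , p , r

RC-resp : ∀ {M M' N N'} → M ≃ M' → N ≃ N' → RC M N → RC M' N'
RC-resp r s (coset g p t) = coset g p (≃-trans (≃-sym s) (≃-trans t (∙-congʳ g r)))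

RC-refl : ∀ M → RC M M
RC-refl M = coset Imat Γ-I (≃-sym (∙-identityʳ M))

RC-sym : ∀ {M N} → RC M N → RC N M
RC-sym {M} {N} (coset g p r) = coset (adj g) (Γ-adj p)
  (≃-trans (≃-sym (cancelʳ M p)) (∙-congʳ (adj g) (≃-sym r)))

RC-trans : ∀ {M N P} → RC M N → RC N P → RC M P
RC-trans {M} (coset g p r) (coset h q s) = coset (g ∙ h) (Γ-∙ p q)
  (≃-trans s (≃-trans (∙-congʳ h r) (∙-assoc M g h)))

RC-∙ʳ : ∀ M {g} → Γ∋ g → RC M (M ∙ g)
RC-∙ʳ M {g} p = coset g p ≃-refl

RC-∙ˡ : ∀ A {M N} → RC M N → RC (A ∙ M) (A ∙ N)
RC-∙ˡ A {M} (coset g p r) = coset g p (≃-trans (∙-congˡ A r) (≃-sym (∙-assoc A M g)))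

RC-cancelˡ : ∀ {A M N} → Γ∋ A → RC (A ∙ M) (A ∙ N) → RC M N
RC-cancelˡ {A} {M} {N} p r = RC-resp (cancelˡ M p) (cancelˡ N p) (RC-∙ˡ (adj A) r)

RC-det : ∀ {M N} → RC M N → det N ≡ det M
RC-det {M} (coset g (unimodular p) r) = trans (det-resp r)
  (trans (det-∙ M g) (trans (cong (det M ℤ.*_) p) (ℤP.*-identityʳ (det M))))

cancel-* : ∀ n {i j} → n ≢ 0ℤ → n ℤ.* i ≡ n ℤ.* j → i ≡ j
cancel-* n {i} {j} n≢0 = ℤP.*-cancelˡ-≡ n i j {{ℤ.≢-nonZero n≢0}}

-- The premises say adj(M) (u, v) = n (p, q) for column vectors; applying M gives n (u, v) = n M (p,
-- q), and n cancels.
cramer : ∀ n → n ≢ 0ℤ → ∀ x y z w {u v p q} → x ℤ.* w ℤ.- y ℤ.* z ≡ n →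
  w ℤ.* u ℤ.+ (ℤ.- y) ℤ.* v ≡ p ℤ.* n → (ℤ.- z) ℤ.* u ℤ.+ x ℤ.* v ≡ q ℤ.* n →
  (u ≡ x ℤ.* p ℤ.+ y ℤ.* q) × (v ≡ z ℤ.* p ℤ.+ w ℤ.* q)
cramer n n≢0 x y z w {u} {v} {p} {q} e e₁ e₂ =
  cancel-* n n≢0 (trans (cong (ℤ._* u) (sym e)) (trans (top x y z w u v)
    (trans (cong₂ (λ s t → x ℤ.* s ℤ.+ y ℤ.* t) e₁ e₂) (lem x y n p q)))) ,
  cancel-* n n≢0 (trans (cong (ℤ._* v) (sym e)) (trans (bot x y z w u v)
    (trans (cong₂ (λ s t → z ℤ.* s ℤ.+ w ℤ.* t) e₁ e₂) (lem z w n p q))))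
  where
  top : ∀ x y z w u v → (x ℤ.* w ℤ.- y ℤ.* z) ℤ.* u ≡
    x ℤ.* (w ℤ.* u ℤ.+ (ℤ.- y) ℤ.* v) ℤ.+ y ℤ.* ((ℤ.- z) ℤ.* u ℤ.+ x ℤ.* v)
  top = ℤSolver.solve-∀
  bot : ∀ x y z w u v → (x ℤ.* w ℤ.- y ℤ.* z) ℤ.* v ≡
    z ℤ.* (w ℤ.* u ℤ.+ (ℤ.- y) ℤ.* v) ℤ.+ w ℤ.* ((ℤ.- z) ℤ.* u ℤ.+ x ℤ.* v)
  bot = ℤSolver.solve-∀
  lem : ∀ x y n p q → x ℤ.* (p ℤ.* n) ℤ.+ y ℤ.* (q ℤ.* n) ≡ n ℤ.* (x ℤ.* p ℤ.+ y ℤ.* q)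
  lem = ℤSolver.solve-∀

-- Meant for X = adj(M) N with det M = det N = n: both factors have determinant n, so X has
-- determinant n² and X/n lies in Γ.
quotient-det : ∀ n → n ≢ 0ℤ → ∀ p q r s {x y z w} →
  x ≡ p ℤ.* n → y ≡ q ℤ.* n → z ≡ r ℤ.* n → w ≡ s ℤ.* n →
  det' x y z w ≡ n ℤ.* n → det' p q r s ≡ 1ℤ
quotient-det n n≢0 p q r s refl refl refl refl e =
  cancel-* n n≢0 (cancel-* n n≢0 (trans (lem n p q r s) (trans e (lem' n))))
  where
  lem : ∀ n p q r s → n ℤ.* (n ℤ.* (p ℤ.* s ℤ.- q ℤ.* r))
        ≡ (p ℤ.* n) ℤ.* (s ℤ.* n) ℤ.- (q ℤ.* n) ℤ.* (r ℤ.* n)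
  lem = ℤSolver.solve-∀
  lem' : ∀ n → n ℤ.* n ≡ n ℤ.* (n ℤ.* 1ℤ)
  lem' = ℤSolver.solve-∀

-- N lies in MΓ iff the entries of adj(M) N = (det M) M⁻¹ N are multiples of det M.

Divisible : ℤ → Mat → Set
Divisible n X = (n ∣ a X) × (n ∣ b X) × (n ∣ c X) × (n ∣ d X)

opaque
  unfolding _∙_ adj

  adj-∙ : ∀ M g → let n = det M ; X = adj M ∙ (M ∙ g) in
    (a X ≡ n ℤ.* a g) × (b X ≡ n ℤ.* b g) × (c X ≡ n ℤ.* c g) × (d X ≡ n ℤ.* d g)
  adj-∙ (mat x y z w _) (mat e f g h _) = p x y z w e g , p x y z w f h , q x y z w e g , q x y z w f h
    where
    p : ∀ x y z w u v → w ℤ.* (x ℤ.* u ℤ.+ y ℤ.* v) ℤ.+ (ℤ.- y) ℤ.* (z ℤ.* u ℤ.+ w ℤ.* v)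
        ≡ (x ℤ.* w ℤ.- y ℤ.* z) ℤ.* u
    p = ℤSolver.solve-∀
    q : ∀ x y z w u v → (ℤ.- z) ℤ.* (x ℤ.* u ℤ.+ y ℤ.* v) ℤ.+ x ℤ.* (z ℤ.* u ℤ.+ w ℤ.* v)
        ≡ (x ℤ.* w ℤ.- y ℤ.* z) ℤ.* v
    q = ℤSolver.solve-∀

  divisible⇒RC : ∀ M N → det N ≡ det M → Divisible (det M) (adj M ∙ N) → RC M N
  divisible⇒RC M N eq (divides q₁ e₁ , divides q₂ e₂ , divides q₃ e₃ , divides q₄ e₄) =
    coset (unit-mat q₁ q₂ q₃ q₄ qΓ) (unimodular qΓ) (up-to-sign (inj₁
      (proj₁ ag , proj₁ bh , proj₂ ag , proj₂ bh)))
    where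
    qΓ : det' q₁ q₂ q₃ q₄ ≡ 1ℤ
    qΓ = quotient-det (det M) (det≢0 M) q₁ q₂ q₃ q₄ e₁ e₂ e₃ e₄
      (trans (det-∙ (adj M) N) (cong₂ ℤ._*_ (det-adj M) eq))
    ag : (a N ≡ a M ℤ.* q₁ ℤ.+ b M ℤ.* q₃) × (c N ≡ c M ℤ.* q₁ ℤ.+ d M ℤ.* q₃)
    ag = cramer (det M) (det≢0 M) (a M) (b M) (c M) (d M) refl e₁ e₃
    bh : (b N ≡ a M ℤ.* q₂ ℤ.+ b M ℤ.* q₄) × (d N ≡ c M ℤ.* q₂ ℤ.+ d M ℤ.* q₄)
    bh = cramer (det M) (det≢0 M) (a M) (b M) (c M) (d M) refl e₂ e₄

adj-divisible : ∀ M g → Divisible (det M) (adj M ∙ (M ∙ g))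
adj-divisible M g with adj-∙ M g
... | e₁ , e₂ , e₃ , e₄ = f e₁ , f e₂ , f e₃ , f e₄
  where
  f : ∀ {n x q} → x ≡ n ℤ.* q → n ∣ x
  f {n} {q = q} e = divides q (trans e (ℤP.*-comm n q))

divisible-resp : ∀ {n X Y} → X ≃ Y → Divisible n Y → Divisible n X
divisible-resp (up-to-sign (inj₁ (e₁ , e₂ , e₃ , e₄))) (f₁ , f₂ , f₃ , f₄) =
  g e₁ f₁ , g e₂ f₂ , g e₃ f₃ , g e₄ f₄
  where
  g : ∀ {n x y} → x ≡ y → n ∣ y → n ∣ x
  g refl p = p
divisible-resp (up-to-sign (inj₂ (e₁ , e₂ , e₃ , e₄))) (f₁ , f₂ , f₃ , f₄) =
  g e₁ f₁ , g e₂ f₂ , g e₃ f₃ , g e₄ f₄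
  where
  g : ∀ {n x y} → x ≡ ℤ.- y → n ∣ y → n ∣ x
  g {n} refl (divides q refl) = divides (ℤ.- q) (ℤP.neg-distribˡ-* q n)

RC⇒divisible : ∀ {M N} → RC M N → Divisible (det M) (adj M ∙ N)
RC⇒divisible {M} (coset g _ r) = divisible-resp (∙-congˡ (adj M) r) (adj-divisible M g)

opaque
  RC? : ∀ M N → Dec (RC M N)
  RC? M N = map′ (λ (eq , div) → divisible⇒RC M N eq div) (λ r → RC-det r , RC⇒divisible r)
    (det N ℤP.≟ det M ×-dec
     det M ∣? a X ×-dec det M ∣? b X ×-dec det M ∣? c X ×-dec det M ∣? d X)
    where
    X : Mat
    X = adj M ∙ N

≃-dec : ∀ M N → Dec (M ≃ N)
≃-dec M N = map′ up-to-sign _≃_.entries (M ~±? N)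

-- Generation of Γ by S and U

Tᵏ : ℤ → Mat
Tᵏ k = unit-mat 1ℤ k 0ℤ 1ℤ (lem k)
  where
  lem : ∀ k → 1ℤ ℤ.* 1ℤ ℤ.- k ℤ.* 0ℤ ≡ 1ℤ
  lem = ℤSolver.solve-∀

Γ-Tᵏ : ∀ k → Γ∋ (Tᵏ k)
Γ-Tᵏ k = unimodular (lem k)
  where
  lem : ∀ k → 1ℤ ℤ.* 1ℤ ℤ.- k ℤ.* 0ℤ ≡ 1ℤ
  lem = ℤSolver.solve-∀

Γ-S : Γ∋ Smat
Γ-S = unimodular refl

Γ-U : Γ∋ Umat
Γ-U = unimodular refl

Γ-T : Γ∋ Tmat
Γ-T = unimodular refl

opaque
  unfolding _∙_

  Tᵏ-∙ : ∀ j k → Tᵏ j ∙ Tᵏ k ≃ Tᵏ (j ℤ.+ k)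
  Tᵏ-∙ j k = up-to-sign (inj₁ (e₁ j , e₂ j k , e₃ , e₄ k))
    where
    e₁ : ∀ j → 1ℤ ℤ.* 1ℤ ℤ.+ j ℤ.* 0ℤ ≡ 1ℤ
    e₁ = ℤSolver.solve-∀
    e₂ : ∀ j k → 1ℤ ℤ.* k ℤ.+ j ℤ.* 1ℤ ≡ j ℤ.+ k
    e₂ = ℤSolver.solve-∀
    e₃ : 0ℤ ℤ.* 1ℤ ℤ.+ 1ℤ ℤ.* 0ℤ ≡ 0ℤ
    e₃ = refl
    e₄ : ∀ k → 0ℤ ℤ.* k ℤ.+ 1ℤ ℤ.* 1ℤ ≡ 1ℤ
    e₄ = ℤSolver.solve-∀

  SS≃I : Smat ∙ Smat ≃ Imat
  SS≃I = up-to-sign (inj₂ (refl , refl , refl , refl))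

  UUU≃I : Umat ∙ (Umat ∙ Umat) ≃ Imat
  UUU≃I = up-to-sign (inj₂ (refl , refl , refl , refl))

  US≃T : Umat ∙ Smat ≃ Tmat
  US≃T = up-to-sign (inj₂ (refl , refl , refl , refl))

  SUU≃T⁻¹ : Smat ∙ (Umat ∙ Umat) ≃ Tᵏ (ℤ.- 1ℤ)
  SUU≃T⁻¹ = up-to-sign (inj₂ (refl , refl , refl , refl))

T¹≃T : Tᵏ 1ℤ ≃ Tmat
T¹≃T = up-to-sign (inj₁ (refl , refl , refl , refl))

T⁰≃I : Tᵏ 0ℤ ≃ Imat
T⁰≃I = up-to-sign (inj₁ (refl , refl , refl , refl))

SS-∙ : ∀ M → Smat ∙ (Smat ∙ M) ≃ M
SS-∙ M = ≃-trans (≃-sym (∙-assoc Smat Smat M)) (≃-trans (∙-congʳ M SS≃I) (∙-identityˡ M))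

opaque
  unfolding _∙_

  euclid-entry : ∀ q g → c (Smat ∙ (Tᵏ (ℤ.- q) ∙ g)) ≡ a g ℤ.- q ℤ.* c g
  euclid-entry q g = lem q (a g) (c g)
    where
    lem : ∀ q x z → 1ℤ ℤ.* (1ℤ ℤ.* x ℤ.+ (ℤ.- q) ℤ.* z) ℤ.+ 0ℤ ℤ.* (0ℤ ℤ.* x ℤ.+ 1ℤ ℤ.* z)
          ≡ x ℤ.- q ℤ.* z
    lem = ℤSolver.solve-∀

-- Since ad = 1, the diagonal is (1, 1) or (-1, -1); in the second case the shift is -b, the sign
-- being absorbed by `≃`.
unipotent : ∀ g → Γ∋ g → c g ≡ 0ℤ → Σ ℤ λ k → g ≃ Tᵏ k
unipotent (mat x y z w _) (unimodular det≡1) refl = diag x w (trans (sym (lem x y w)) det≡1)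
  where
  lem : ∀ x y w → x ℤ.* w ℤ.- y ℤ.* 0ℤ ≡ x ℤ.* w
  lem = ℤSolver.solve-∀
  diag : ∀ x w {p} → x ℤ.* w ≡ 1ℤ → Σ ℤ λ k → mat x y 0ℤ w p ≃ Tᵏ k
  diag x w e with ℕP.m*n≡1⇒m≡1 ∣ x ∣ ∣ w ∣ (trans (sym (ℤP.abs-* x w)) (cong ∣_∣ e))
  diag (+ 1)    w e | refl = y , up-to-sign (inj₁ (refl , refl , refl , trans (sym (ℤP.*-identityˡ w)) e))
  diag -[1+ 0 ] w e | refl = ℤ.- y , up-to-sign (inj₂ (refl , sym (ℤP.neg-involutive y) , refl ,
    trans (sym (ℤP.neg-involutive w)) (cong ℤ.-_ (trans (sym (ℤP.-1*i≡-i w)) e))))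

module Generation
  (P : Mat → Set)
  (P-resp : ∀ {g h} → g ≃ h → P h → P g)
  (P-I : P Imat)
  (P-S : ∀ {g} → P g → P (Smat ∙ g))
  (P-U : ∀ {g} → P g → P (Umat ∙ g))
  where

  private
    P-T : ∀ {g} → P g → P (Tᵏ 1ℤ ∙ g)
    P-T {g} p = P-resp
      (≃-trans (∙-congʳ g (≃-trans T¹≃T (≃-sym US≃T))) (∙-assoc Umat Smat g))
      (P-U (P-S p))

    P-T⁻¹ : ∀ {g} → P g → P (Tᵏ (ℤ.- 1ℤ) ∙ g)
    P-T⁻¹ {g} p = P-resp
      (≃-trans (∙-congʳ g (≃-sym SUU≃T⁻¹)) (≃-trans (∙-assoc Smat (Umat ∙ Umat) g)
        (∙-congˡ Smat (∙-assoc Umat Umat g))))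
      (P-S (P-U (P-U p)))

    shift : ∀ j k {l} g → j ℤ.+ k ≡ l → Tᵏ l ∙ g ≃ Tᵏ j ∙ (Tᵏ k ∙ g)
    shift j k g refl = ≃-trans (∙-congʳ g (≃-sym (Tᵏ-∙ j k))) (∙-assoc (Tᵏ j) (Tᵏ k) g)

    P-Tᵏ : ∀ k {g} → P g → P (Tᵏ k ∙ g)
    P-Tᵏ (+ zero)       {g} p = P-resp (≃-trans (∙-congʳ g T⁰≃I) (∙-identityˡ g)) p
    P-Tᵏ (+ suc n)      {g} p = P-resp (shift 1ℤ (+ n) g refl) (P-T (P-Tᵏ (+ n) p))
    P-Tᵏ -[1+ zero ]    {g} p = P-T⁻¹ p
    P-Tᵏ -[1+ suc n ]   {g} p = P-resp (shift (ℤ.- 1ℤ) -[1+ n ] g refl) (P-T⁻¹ (P-Tᵏ -[1+ n ] p))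

    -- Euclid's algorithm on the first column (a, c): with q = a / c, the matrix g' = S T^(-q) g has
    -- the remainder a - qc as lower-left entry, and g = T^q S g' up to sign. The number `n` bounds
    -- |c|.
    euclid : ∀ n g → ∣ c g ∣ ℕ.< n → Γ∋ g → P g
    euclid (suc n) g (ℕ.s≤s c≤n) gΓ with c g ℤP.≟ 0ℤ
    ... | yes c≡0 = let (k , r) = unipotent g gΓ c≡0 in
      P-resp (≃-trans r (≃-sym (∙-identityʳ (Tᵏ k)))) (P-Tᵏ k P-I)
    ... | no c≢0 = P-resp (≃-trans (≃-sym (∙-identityˡ g))
                     (≃-trans (∙-congʳ g (≃-sym T⁰≃I)) (shift q (ℤ.- q) g (ℤP.+-inverseʳ q))))
                   (P-Tᵏ q (P-resp (≃-sym (SS-∙ (Tᵏ (ℤ.- q) ∙ g))) (P-S (euclid n g' r<n g'Γ))))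
      where
      instance
        nz : ℤ.NonZero (c g)
        nz = ℤ.≢-nonZero c≢0
      q = a g ℤDM./ c g
      g' = Smat ∙ (Tᵏ (ℤ.- q) ∙ g)
      g'Γ : Γ∋ g'
      g'Γ = Γ-∙ Γ-S (Γ-∙ (Γ-Tᵏ (ℤ.- q)) gΓ)
      lem : ∀ r q z → (r ℤ.+ q ℤ.* z) ℤ.- q ℤ.* z ≡ r
      lem = ℤSolver.solve-∀
      remainder : c g' ≡ + (a g ℤDM.% c g)
      remainder = trans (euclid-entry q g)
        (trans (cong (ℤ._- q ℤ.* c g) (ℤDM.a≡a%n+[a/n]*n (a g) (c g)))
               (lem (+ (a g ℤDM.% c g)) q (c g)))
      r<n : ∣ c g' ∣ ℕ.< n
      r<n = ℕP.<-≤-trans (subst (ℕ._< ∣ c g ∣) (sym (cong ∣_∣ remainder)) (ℤDM.n%d<d (a g) (c g))) c≤n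

  -- Induction over words in S and U acting from the left; T = US and T⁻¹ = SU² up to sign, so all
  -- powers of T are such words.
  generated : ∀ {g} → Γ∋ g → P g
  generated {g} = euclid (suc ∣ c g ∣) g ℕP.≤-refl

-- The pairing on classes in 𝓡

Inv : (Mat → ℚ) → Set
Inv h = ∀ {M N} → M ≃ N → h M ≡ h N

infix 4 _≋_

-- Equality in 𝓡 in dual form: functions invariant under M ↦ -M are exactly the functions on 𝓜.
-- Proofs work with this relation; `≈` appears only where the definitions demand it.
_≋_ : R → R → Set
ξ ≋ η = ∀ h → Inv h → ev h ξ ≡ ev h η

opaque
  unfolding _∙_

  ev-∙ : ∀ h ξ η → ev h (ξ * η) ≡ ev (λ M → ev (λ N → h (M ∙ N)) η) ξ
  ev-∙ = ev-*

coeff-ev : ∀ ξ M → coeff ξ M ≡ ev (λ N → 𝟙 (≃-dec N M)) ξ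
coeff-ev []            M = refl
coeff-ev ((q , N) ∷ ξ) M = cong₂ ℚ._+_ (lem (N ≟± M)) (coeff-ev ξ M)
  where
  lem : ∀ b → (if b then q else 0ℚ) ≡ q ℚ.* (if b then 1ℚ else 0ℚ)
  lem true  = sym (ℚP.*-identityʳ q)
  lem false = sym (ℚP.*-zeroʳ q)

≋⇒≈ : ∀ {ξ η} → ξ ≋ η → ξ ≈ η
≋⇒≈ {ξ} {η} e M = trans (coeff-ev ξ M)
  (trans (e (λ N → 𝟙 (≃-dec N M)) inv) (sym (coeff-ev η M)))
  where
  inv : Inv (λ N → 𝟙 (≃-dec N M))
  inv {N} {N'} r = 𝟙-cong (≃-dec N M) (≃-dec N' M) (≃-trans (≃-sym r)) (≃-trans r)

-- The coefficients of ξ - η are its sums over the classes of ±M, and `h` kills every difference of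
-- two matrices that agree up to sign, so `collapse` applies.
≈⇒≋ : ∀ {ξ η} → ξ ≈ η → ξ ≋ η
≈⇒≋ {ξ} {η} e h inv = equal (ev h ξ) (ev h η)
  (trans (sym (ev-- h ξ η)) (collapse (ξ - η) (All.universal (λ _ → tt) (ξ - η)) λ M _ → zero-coeff M))
  where
  open ≡-Reasoning
  equal : ∀ x y → x ℚ.- y ≡ 0ℚ → x ≡ y
  equal x y e = trans (lem x y) (trans (cong (ℚ._+ y) e) (ℚP.+-identityˡ y))
    where
    lem : ∀ x y → x ≡ (x ℚ.- y) ℚ.+ y
    lem = solve-∀ ringℚ
  lem₁ : ∀ q x → q ℚ.* (1ℚ ℚ.* x ℚ.+ (((ℚ.- 1ℚ) ℚ.* 1ℚ) ℚ.* x ℚ.+ 0ℚ)) ≡ 0ℚ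
  lem₁ = solve-∀ ringℚ
  open Collapse _≃_ ≃-dec (λ _ → ≃-refl) ≃-sym ≃-trans (λ _ → ⊤) (λ ζ → ev h ζ ≡ 0ℚ)
    (λ e p → trans (sym (e h)) p) refl
    (λ {ζ} {ω} p q → trans (ev-++ h ζ ω) (cong₂ ℚ._+_ p q))
    (λ q {M} {N} _ _ r → trans (ev-⋆ h q ([ N ] - [ M ]))
      (trans (cong (λ x → q ℚ.* (1ℚ ℚ.* x ℚ.+ (((ℚ.- 1ℚ) ℚ.* 1ℚ) ℚ.* h M ℚ.+ 0ℚ))) (sym (inv r)))
             (lem₁ q (h M))))
  coeff-χ : ∀ ζ M → ev (χ M) ζ ≡ coeff ζ M
  coeff-χ ζ M = trans (ev-cong (λ N → 𝟙-cong (≃-dec M N) (≃-dec N M) ≃-sym ≃-sym) ζ)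
    (sym (coeff-ev ζ M))
  zero-coeff : ∀ M → ev (χ M) (ξ - η) ≡ 0ℚ
  zero-coeff M = begin
    ev (χ M) (ξ - η)                ≡⟨ ev-- (χ M) ξ η ⟩
    ev (χ M) ξ ℚ.- ev (χ M) η       ≡⟨ cong₂ ℚ._-_ (coeff-χ ξ M) (coeff-χ η M) ⟩
    coeff ξ M ℚ.- coeff η M         ≡⟨ cong (ℚ._- coeff η M) (e M) ⟩
    coeff η M ℚ.- coeff η M         ≡⟨ ℚP.+-inverseʳ (coeff η M) ⟩
    0ℚ                              ∎

-- Integer inequalities

0≤-+ : ∀ {x y} → 0ℤ ℤ.≤ x → 0ℤ ℤ.≤ y → 0ℤ ℤ.≤ x ℤ.+ y
0≤-+ = ℤP.+-mono-≤

0≤-* : ∀ {x y} → 0ℤ ℤ.≤ x → 0ℤ ℤ.≤ y → 0ℤ ℤ.≤ x ℤ.* y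
0≤-* {+ m} {+ n} _ _ = subst (0ℤ ℤ.≤_) (ℤP.pos-* m n) (ℤ.+≤+ ℕ.z≤n)

0≤-sq : ∀ x → 0ℤ ℤ.≤ x ℤ.* x
0≤-sq (+ n)    = 0≤-* {+ n} {+ n} (ℤ.+≤+ ℕ.z≤n) (ℤ.+≤+ ℕ.z≤n)
0≤-sq -[1+ n ] = ℤ.+≤+ ℕ.z≤n

0<-+ : ∀ {x y} → 0ℤ ℤ.< x → 0ℤ ℤ.≤ y → 0ℤ ℤ.< x ℤ.+ y
0<-+ = ℤP.+-mono-<-≤

0<-* : ∀ {x y} → 0ℤ ℤ.< x → 0ℤ ℤ.< y → 0ℤ ℤ.< x ℤ.* y
0<-* {+[1+ m ]} {+[1+ n ]} _ _ = ℤ.+<+ (ℕ.s≤s ℕ.z≤n)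
0<-* {+ zero} (ℤ.+<+ ()) _
0<-* {+[1+ m ]} {+ zero} _ (ℤ.+<+ ())

0<⇒0≤pred : ∀ {x} → 0ℤ ℤ.< x → 0ℤ ℤ.≤ x ℤ.- 1ℤ
0<⇒0≤pred p = ℤP.i≤j⇒0≤j-i (ℤP.i<j⇒suc[i]≤j p)

0≮⇒0≤neg : ∀ {x} → ¬ (0ℤ ℤ.< x) → 0ℤ ℤ.≤ ℤ.- x
0≮⇒0≤neg p = ℤP.neg-mono-≤ (ℤP.≮⇒≥ p)

0≤sum-zero : ∀ {x y} → 0ℤ ℤ.≤ x → 0ℤ ℤ.≤ y → x ℤ.+ y ≡ 0ℤ → x ≡ 0ℤ
0≤sum-zero {+ zero}    _ _ _ = refl
0≤sum-zero {+ suc m} {+ n} _ _ ()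

sq-zero : ∀ {x} → x ℤ.* x ≡ 0ℤ → x ≡ 0ℤ
sq-zero {x} e with ℤP.i*j≡0⇒i≡0∨j≡0 x e
... | inj₁ p = p
... | inj₂ p = p

twice-zero : ∀ {x} → x ℤ.+ x ≡ 0ℤ → x ≡ 0ℤ
twice-zero {+ zero} _ = refl

-- The real part of g(i), resp. g(ρ) with ρ = (1 + i√3)/2 fixed by U, is a
-- positive multiple of reS g, resp. reU g.

reS reU : Mat → ℤ
reS g = a g ℤ.* c g ℤ.+ b g ℤ.* d g
reU g = reS g ℤ.+ reS g ℤ.+ (a g ℤ.* d g ℤ.+ b g ℤ.* c g)

opaque
  reS>0? : ∀ g → Dec (0ℤ ℤ.< reS g)
  reS>0? g = 0ℤ ℤP.<? reS g

  reU>0? : ∀ g → Dec (0ℤ ℤ.< reU g)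
  reU>0? g = 0ℤ ℤP.<? reU g

reS-resp : ∀ {g h} → g ≃ h → reS g ≡ reS h
reS-resp {mat _ _ _ _ _} {mat _ _ _ _ _} (up-to-sign (inj₁ (refl , refl , refl , refl))) = refl
reS-resp {mat _ _ _ _ _} {mat x y z w _} (up-to-sign (inj₂ (refl , refl , refl , refl))) = lem x y z w
  where
  lem : ∀ x y z w → (ℤ.- x) ℤ.* (ℤ.- z) ℤ.+ (ℤ.- y) ℤ.* (ℤ.- w) ≡ x ℤ.* z ℤ.+ y ℤ.* w
  lem = ℤSolver.solve-∀

reU-resp : ∀ {g h} → g ≃ h → reU g ≡ reU h
reU-resp {mat _ _ _ _ _} {mat _ _ _ _ _} (up-to-sign (inj₁ (refl , refl , refl , refl))) = refl
reU-resp {g@(mat _ _ _ _ _)} {h@(mat x y z w _)} r@(up-to-sign (inj₂ (refl , refl , refl , refl))) =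
  cong₂ (λ s t → s ℤ.+ s ℤ.+ t) (reS-resp {g} {h} r) (lem x y z w)
  where
  lem : ∀ x y z w → (ℤ.- x) ℤ.* (ℤ.- w) ℤ.+ (ℤ.- y) ℤ.* (ℤ.- z) ≡ x ℤ.* w ℤ.+ y ℤ.* z
  lem = ℤSolver.solve-∀

opaque
  unfolding _∙_

  reS-∙S : ∀ g → reS (g ∙ Smat) ≡ reS g
  reS-∙S (mat x y z w _) = lem x y z w
    where
    lem : ∀ x y z w →
      (x ℤ.* 0ℤ ℤ.+ y ℤ.* 1ℤ) ℤ.* (z ℤ.* 0ℤ ℤ.+ w ℤ.* 1ℤ)
        ℤ.+ (x ℤ.* (ℤ.- 1ℤ) ℤ.+ y ℤ.* 0ℤ) ℤ.* (z ℤ.* (ℤ.- 1ℤ) ℤ.+ w ℤ.* 0ℤ)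
      ≡ x ℤ.* z ℤ.+ y ℤ.* w
    lem = ℤSolver.solve-∀

  reU-∙U : ∀ g → reU (g ∙ Umat) ≡ reU g
  reU-∙U (mat x y z w _) = lem x y z w
    where
    lem : ∀ x y z w →
      let x' = x ℤ.* 1ℤ ℤ.+ y ℤ.* 1ℤ ; y' = x ℤ.* (ℤ.- 1ℤ) ℤ.+ y ℤ.* 0ℤ
          z' = z ℤ.* 1ℤ ℤ.+ w ℤ.* 1ℤ ; w' = z ℤ.* (ℤ.- 1ℤ) ℤ.+ w ℤ.* 0ℤ in
      (x' ℤ.* z' ℤ.+ y' ℤ.* w') ℤ.+ (x' ℤ.* z' ℤ.+ y' ℤ.* w') ℤ.+ (x' ℤ.* w' ℤ.+ y' ℤ.* z')
      ≡ (x ℤ.* z ℤ.+ y ℤ.* w) ℤ.+ (x ℤ.* z ℤ.+ y ℤ.* w) ℤ.+ (x ℤ.* w ℤ.+ y ℤ.* z)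
    lem = ℤSolver.solve-∀

private
  -- Put o = reS = p + q, m = reU - 2 reS = 2r + 1 and D = p - q; then pq = r(1 + r) reads m² + D² =
  -- o² + 1. With v = reS - 1 - reU one has m = -(o + v + 1), and the expression is m² + D² - o² -
  -- 1.
  half-plane-pos : ∀ {o v} D → 0ℤ ℤ.< o → 0ℤ ℤ.≤ v →
    0ℤ ℤ.< ((o ℤ.+ v) ℤ.+ (o ℤ.+ v)) ℤ.+ (v ℤ.* (o ℤ.+ o ℤ.+ v) ℤ.+ D ℤ.* D)
  half-plane-pos {o} {v} D o>0 v≥0 = 0<-+ (0<-+ (0<-+ o>0 v≥0) (0≤-+ (ℤP.<⇒≤ o>0) v≥0))
    (0≤-+ (0≤-* v≥0 (0≤-+ (0≤-+ (ℤP.<⇒≤ o>0) (ℤP.<⇒≤ o>0)) v≥0)) (0≤-sq D))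

  -- The same m² + D² - o² - 1, now with o = -s and w = reU - 1, so that m = w + 2s + 1. All its
  -- summands are nonnegative, hence all vanish.
  half-plane-zero : ∀ {s w D} → 0ℤ ℤ.≤ s → 0ℤ ℤ.≤ w →
    ((w ℤ.+ (s ℤ.+ s)) ℤ.+ (w ℤ.+ (s ℤ.+ s))) ℤ.+ ((w ℤ.+ s) ℤ.* (w ℤ.+ (s ℤ.+ (s ℤ.+ s))) ℤ.+ D ℤ.* D) ≡ 0ℤ →
    (s ≡ 0ℤ) × (w ≡ 0ℤ) × (D ≡ 0ℤ)
  half-plane-zero {s} {w} {D} s≥0 w≥0 e = s≡0 , w≡0 , D≡0
    where
    2s≥0 : 0ℤ ℤ.≤ s ℤ.+ s
    2s≥0 = 0≤-+ s≥0 s≥0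
    t≥0 : 0ℤ ℤ.≤ w ℤ.+ (s ℤ.+ s)
    t≥0 = 0≤-+ w≥0 2s≥0
    prod≥0 : 0ℤ ℤ.≤ (w ℤ.+ s) ℤ.* (w ℤ.+ (s ℤ.+ (s ℤ.+ s)))
    prod≥0 = 0≤-* (0≤-+ w≥0 s≥0) (0≤-+ w≥0 (0≤-+ s≥0 2s≥0))
    t≡0 : w ℤ.+ (s ℤ.+ s) ≡ 0ℤ
    t≡0 = twice-zero (0≤sum-zero (0≤-+ t≥0 t≥0) (0≤-+ prod≥0 (0≤-sq D)) e)
    w≡0 : w ≡ 0ℤ
    w≡0 = 0≤sum-zero w≥0 2s≥0 t≡0
    s≡0 : s ≡ 0ℤ
    s≡0 = twice-zero (0≤sum-zero 2s≥0 w≥0 (trans (ℤP.+-comm (s ℤ.+ s) w) t≡0))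
    D≡0 : D ≡ 0ℤ
    D≡0 = sq-zero (0≤sum-zero (0≤-sq D) (0≤-+ (0≤-+ t≥0 t≥0) prod≥0)
      (trans (lem (D ℤ.* D) ((w ℤ.+ (s ℤ.+ s)) ℤ.+ (w ℤ.+ (s ℤ.+ s)))
                  ((w ℤ.+ s) ℤ.* (w ℤ.+ (s ℤ.+ (s ℤ.+ s))))) e))
      where
      lem : ∀ x y z → x ℤ.+ (y ℤ.+ z) ≡ y ℤ.+ (z ℤ.+ x)
      lem = ℤSolver.solve-∀

  quadruple-zero : ∀ {x y z} → x ≡ y → z ≡ ℤ.- ((x ℤ.- y) ℤ.+ (x ℤ.- y) ℤ.+ ((x ℤ.- y) ℤ.+ (x ℤ.- y))) → z ≡ 0ℤ
  quadruple-zero {x} refl e = trans e (lem x)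
    where
    lem : ∀ x → ℤ.- ((x ℤ.- x) ℤ.+ (x ℤ.- x) ℤ.+ ((x ℤ.- x) ℤ.+ (x ℤ.- x))) ≡ 0ℤ
    lem = ℤSolver.solve-∀

-- p, q, r stand for ac, bd, bc, so that pq = ad·bc = r(1 + r).  Both statements
-- come from (p + q)² − (p − q)² = 2r(2r + 2).

reS>0⇒reU>0 : ∀ p q r → p ℤ.* q ≡ r ℤ.* (1ℤ ℤ.+ r) → 0ℤ ℤ.< p ℤ.+ q →
  ¬ (0ℤ ℤ.< (p ℤ.+ q) ℤ.+ (p ℤ.+ q) ℤ.+ ((1ℤ ℤ.+ r) ℤ.+ r)) → ⊥
reS>0⇒reU>0 p q r pq S>0 U≤0 = ℤP.<-irrefl (sym (quadruple-zero pq (lem p q r)))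
  (half-plane-pos (p ℤ.- q) S>0 (0≤-+ (0<⇒0≤pred S>0) (0≮⇒0≤neg U≤0)))
  where
  lem : ∀ p q r →
    let o = p ℤ.+ q
        v = (p ℤ.+ q ℤ.- 1ℤ) ℤ.+ ℤ.- ((p ℤ.+ q) ℤ.+ (p ℤ.+ q) ℤ.+ ((1ℤ ℤ.+ r) ℤ.+ r))
        D = p ℤ.- q
        x = p ℤ.* q
        y = r ℤ.* (1ℤ ℤ.+ r) in
    ((o ℤ.+ v) ℤ.+ (o ℤ.+ v)) ℤ.+ (v ℤ.* (o ℤ.+ o ℤ.+ v) ℤ.+ D ℤ.* D)
    ≡ ℤ.- ((x ℤ.- y) ℤ.+ (x ℤ.- y) ℤ.+ ((x ℤ.- y) ℤ.+ (x ℤ.- y)))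
  lem = ℤSolver.solve-∀

separated : ∀ p q r → p ℤ.* q ≡ r ℤ.* (1ℤ ℤ.+ r) → ¬ (0ℤ ℤ.< p ℤ.+ q) →
  0ℤ ℤ.< (p ℤ.+ q) ℤ.+ (p ℤ.+ q) ℤ.+ ((1ℤ ℤ.+ r) ℤ.+ r) → (p ≡ 0ℤ) × (q ≡ 0ℤ) × (r ≡ 0ℤ)
separated p q r pq S≤0 U>0 =
  finish (half-plane-zero (0≮⇒0≤neg S≤0) (0<⇒0≤pred U>0) (quadruple-zero pq (lem p q r)))
  where
  lem : ∀ p q r →
    let s = ℤ.- (p ℤ.+ q)
        w = (p ℤ.+ q) ℤ.+ (p ℤ.+ q) ℤ.+ ((1ℤ ℤ.+ r) ℤ.+ r) ℤ.- 1ℤ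
        D = p ℤ.- q
        x = p ℤ.* q
        y = r ℤ.* (1ℤ ℤ.+ r) in
    ((w ℤ.+ (s ℤ.+ s)) ℤ.+ (w ℤ.+ (s ℤ.+ s))) ℤ.+ ((w ℤ.+ s) ℤ.* (w ℤ.+ (s ℤ.+ (s ℤ.+ s))) ℤ.+ D ℤ.* D)
    ≡ ℤ.- ((x ℤ.- y) ℤ.+ (x ℤ.- y) ℤ.+ ((x ℤ.- y) ℤ.+ (x ℤ.- y)))
  lem = ℤSolver.solve-∀
  e₁ : ∀ p q → p ℤ.+ p ≡ ℤ.- (ℤ.- (p ℤ.+ q)) ℤ.+ (p ℤ.- q)
  e₁ = ℤSolver.solve-∀
  e₂ : ∀ p q → q ℤ.+ q ≡ ℤ.- (ℤ.- (p ℤ.+ q)) ℤ.- (p ℤ.- q)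
  e₂ = ℤSolver.solve-∀
  e₃ : ∀ p q r → r ℤ.+ r ≡ ((p ℤ.+ q) ℤ.+ (p ℤ.+ q) ℤ.+ ((1ℤ ℤ.+ r) ℤ.+ r)) ℤ.- 1ℤ
      ℤ.+ (ℤ.- (p ℤ.+ q) ℤ.+ ℤ.- (p ℤ.+ q))
  e₃ = ℤSolver.solve-∀
  finish : (ℤ.- (p ℤ.+ q) ≡ 0ℤ) × ((p ℤ.+ q) ℤ.+ (p ℤ.+ q) ℤ.+ ((1ℤ ℤ.+ r) ℤ.+ r) ℤ.- 1ℤ ≡ 0ℤ) ×
    (p ℤ.- q ≡ 0ℤ) → (p ≡ 0ℤ) × (q ≡ 0ℤ) × (r ≡ 0ℤ)
  finish (s≡0 , w≡0 , D≡0) =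
    twice-zero (trans (e₁ p q) (cong₂ (λ s D → ℤ.- s ℤ.+ D) s≡0 D≡0)) ,
    twice-zero (trans (e₂ p q) (cong₂ (λ s D → ℤ.- s ℤ.- D) s≡0 D≡0)) ,
    twice-zero (trans (e₃ p q r) (cong₂ (λ w s → w ℤ.+ (s ℤ.+ s)) w≡0 s≡0))

opaque
  unfolding _∙_ adj

  adj-anti : ∀ A M → adj (A ∙ M) ≃ adj M ∙ adj A
  adj-anti (mat x y z w _) (mat e f g h _) = up-to-sign (inj₁
    (e₁ z w f h , e₂ x y f h , e₃ z w e g , e₄ x y e g))
    where
    e₁ : ∀ z w f h → z ℤ.* f ℤ.+ w ℤ.* h ≡ h ℤ.* w ℤ.+ (ℤ.- f) ℤ.* (ℤ.- z)
    e₁ = ℤSolver.solve-∀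
    e₂ : ∀ x y f h → ℤ.- (x ℤ.* f ℤ.+ y ℤ.* h) ≡ h ℤ.* (ℤ.- y) ℤ.+ (ℤ.- f) ℤ.* x
    e₂ = ℤSolver.solve-∀
    e₃ : ∀ z w e g → ℤ.- (z ℤ.* e ℤ.+ w ℤ.* g) ≡ (ℤ.- g) ℤ.* w ℤ.+ e ℤ.* (ℤ.- z)
    e₃ = ℤSolver.solve-∀
    e₄ : ∀ x y e g → x ℤ.* e ℤ.+ y ℤ.* g ≡ (ℤ.- g) ℤ.* (ℤ.- y) ℤ.+ e ℤ.* x
    e₄ = ℤSolver.solve-∀

  adj-resp : ∀ {M N} → M ≃ N → adj M ≃ adj N
  adj-resp (up-to-sign (inj₁ (p , q , r , s))) =
    up-to-sign (inj₁ (s , cong ℤ.-_ q , cong ℤ.-_ r , p))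
  adj-resp (up-to-sign (inj₂ (p , q , r , s))) =
    up-to-sign (inj₂ (s , cong ℤ.-_ q , cong ℤ.-_ r , p))

-- The relative position M⁻¹N is unchanged when both matrices are translated by A; adj(M) N is its
-- integral multiple.
adj-cancel : ∀ {A} M N → Γ∋ A → adj (A ∙ M) ∙ (A ∙ N) ≃ adj M ∙ N
adj-cancel {A} M N AΓ = ≃-trans (∙-congʳ (A ∙ N) (adj-anti A M))
  (≃-trans (∙-assoc (adj M) (adj A) (A ∙ N)) (∙-congˡ (adj M) (cancelˡ N AΓ)))

∙-cancelˡ : ∀ M {g h} → M ∙ g ≃ M ∙ h → g ≃ h
∙-cancelˡ M {g} {h} e = go (adj-∙ M g) (adj-∙ M h) (∙-congˡ (adj M) e)
  where
  n = det M
  X = adj M ∙ (M ∙ g)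
  Y = adj M ∙ (M ∙ h)
  same : ∀ {x y u v} → x ≡ n ℤ.* u → y ≡ n ℤ.* v → x ≡ y → u ≡ v
  same p q r = cancel-* n (det≢0 M) (trans (sym p) (trans r q))
  opposite : ∀ {x y u v} → x ≡ n ℤ.* u → y ≡ n ℤ.* v → x ≡ ℤ.- y → u ≡ ℤ.- v
  opposite {v = v} p q r = cancel-* n (det≢0 M)
    (trans (sym p) (trans r (trans (cong ℤ.-_ q) (ℤP.neg-distribʳ-* n v))))
  go : (a X ≡ n ℤ.* a g) × (b X ≡ n ℤ.* b g) × (c X ≡ n ℤ.* c g) × (d X ≡ n ℤ.* d g) →
       (a Y ≡ n ℤ.* a h) × (b Y ≡ n ℤ.* b h) × (c Y ≡ n ℤ.* c h) × (d Y ≡ n ℤ.* d h) →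
       X ≃ Y → g ≃ h
  go (p₁ , p₂ , p₃ , p₄) (q₁ , q₂ , q₃ , q₄) (up-to-sign (inj₁ (r₁ , r₂ , r₃ , r₄))) =
    up-to-sign (inj₁ (same p₁ q₁ r₁ , same p₂ q₂ r₂ , same p₃ q₃ r₃ , same p₄ q₄ r₄))
  go (p₁ , p₂ , p₃ , p₄) (q₁ , q₂ , q₃ , q₄) (up-to-sign (inj₂ (r₁ , r₂ , r₃ , r₄))) =
    up-to-sign (inj₂ (opposite p₁ q₁ r₁ , opposite p₂ q₂ r₂ , opposite p₃ q₃ r₃ , opposite p₄ q₄ r₄))

det>0 : ∀ M → 0ℤ ℤ.< det M
det>0 M = ℤP.positive⁻¹ (det M) {{detPos M}}

0<-cancel : ∀ {n x} → 0ℤ ℤ.< n → 0ℤ ℤ.< n ℤ.* x → 0ℤ ℤ.< x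
0<-cancel {n} {x} n>0 p = ℤP.*-cancelˡ-<-nonNeg n {{ℤ.nonNegative (ℤP.<⇒≤ n>0)}}
  (subst (ℤ._< n ℤ.* x) (sym (ℤP.*-zeroʳ n)) p)

-- adj(M)Mg is (det M) g and reS is quadratic. As the factor is positive, the side on which M⁻¹N(i)
-- lies can be read off adj(M) N without fractions.
reS-scale : ∀ M g → reS (adj M ∙ (M ∙ g)) ≡ det M ℤ.* (det M ℤ.* reS g)
reS-scale M g = go (adj-∙ M g)
  where
  n = det M
  X = adj M ∙ (M ∙ g)
  lem : ∀ n x y z w → (n ℤ.* x) ℤ.* (n ℤ.* z) ℤ.+ (n ℤ.* y) ℤ.* (n ℤ.* w)
        ≡ n ℤ.* (n ℤ.* (x ℤ.* z ℤ.+ y ℤ.* w))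
  lem = ℤSolver.solve-∀
  go : (a X ≡ n ℤ.* a g) × (b X ≡ n ℤ.* b g) × (c X ≡ n ℤ.* c g) × (d X ≡ n ℤ.* d g) →
       reS X ≡ n ℤ.* (n ℤ.* reS g)
  go (p , q , r , s) = trans
    (cong₂ ℤ._+_ (cong₂ ℤ._*_ p r) (cong₂ ℤ._*_ q s)) (lem n (a g) (b g) (c g) (d g))

reU-scale : ∀ M g → reU (adj M ∙ (M ∙ g)) ≡ det M ℤ.* (det M ℤ.* reU g)
reU-scale M g = go (adj-∙ M g)
  where
  n = det M
  X = adj M ∙ (M ∙ g)
  lem : ∀ n s x y z w → n ℤ.* (n ℤ.* s) ℤ.+ n ℤ.* (n ℤ.* s)
          ℤ.+ ((n ℤ.* x) ℤ.* (n ℤ.* w) ℤ.+ (n ℤ.* y) ℤ.* (n ℤ.* z))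
        ≡ n ℤ.* (n ℤ.* (s ℤ.+ s ℤ.+ (x ℤ.* w ℤ.+ y ℤ.* z)))
  lem = ℤSolver.solve-∀
  go : (a X ≡ n ℤ.* a g) × (b X ≡ n ℤ.* b g) × (c X ≡ n ℤ.* c g) × (d X ≡ n ℤ.* d g) →
       reU X ≡ n ℤ.* (n ℤ.* reU g)
  go (p , q , r , s) = trans
    (cong₂ ℤ._+_ (cong₂ ℤ._+_ (reS-scale M g) (reS-scale M g))
                 (cong₂ ℤ._+_ (cong₂ ℤ._*_ p s) (cong₂ ℤ._*_ q r)))
    (lem n (reS g) (a g) (b g) (c g) (d g))

-- The edge of the Farey tree from g(i) to g(ρ) crosses the imaginary axis only for g = ±1.

half-plane : ∀ {g} → Γ∋ g → 𝟙 (reU>0? g) ≡ 𝟙 (reS>0? g) ℚ.+ 𝟙 (≃-dec g Imat)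
half-plane {g} gΓ@(unimodular det≡1) = by-sign (reU>0? g) (reS>0? g)
  where
  lem₁ : ∀ x y → x ≡ (x ℤ.- y) ℤ.+ y
  lem₁ = ℤSolver.solve-∀
  ad : a g ℤ.* d g ≡ 1ℤ ℤ.+ b g ℤ.* c g
  ad = trans (lem₁ (a g ℤ.* d g) (b g ℤ.* c g)) (cong (ℤ._+ b g ℤ.* c g) det≡1)
  lem₂ : ∀ x y z w → (x ℤ.* z) ℤ.* (y ℤ.* w) ≡ (y ℤ.* z) ℤ.* (x ℤ.* w)
  lem₂ = ℤSolver.solve-∀
  pq : (a g ℤ.* c g) ℤ.* (b g ℤ.* d g) ≡ (b g ℤ.* c g) ℤ.* (1ℤ ℤ.+ b g ℤ.* c g)
  pq = trans (lem₂ (a g) (b g) (c g) (d g)) (cong (b g ℤ.* c g ℤ.*_) ad)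
  U≡ : reU g ≡ reS g ℤ.+ reS g ℤ.+ ((1ℤ ℤ.+ b g ℤ.* c g) ℤ.+ b g ℤ.* c g)
  U≡ = cong (λ x → reS g ℤ.+ reS g ℤ.+ (x ℤ.+ b g ℤ.* c g)) ad
  -- Multiplying det g = 1 by c gives c = (ac)d - (bc)c; multiplying it by b gives b = (bd)a -
  -- (bc)b.
  zero-c : ∀ x y z w → x ℤ.* z ≡ 0ℤ → y ℤ.* z ≡ 0ℤ → x ℤ.* w ℤ.- y ℤ.* z ≡ 1ℤ → z ≡ 0ℤ
  zero-c x y z w xz yz e = trans (sym (ℤP.*-identityˡ z)) (trans (cong (ℤ._* z) (sym e))
    (trans (l x y z w) (cong₂ (λ s t → s ℤ.* w ℤ.- t ℤ.* z) xz yz)))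
    where
    l : ∀ x y z w → (x ℤ.* w ℤ.- y ℤ.* z) ℤ.* z ≡ (x ℤ.* z) ℤ.* w ℤ.- (y ℤ.* z) ℤ.* z
    l = ℤSolver.solve-∀
  zero-b : ∀ x y z w → y ℤ.* w ≡ 0ℤ → y ℤ.* z ≡ 0ℤ → x ℤ.* w ℤ.- y ℤ.* z ≡ 1ℤ → y ≡ 0ℤ
  zero-b x y z w yw yz e = trans (sym (ℤP.*-identityˡ y)) (trans (cong (ℤ._* y) (sym e))
    (trans (l x y z w) (cong₂ (λ s t → s ℤ.* x ℤ.- t ℤ.* y) yw yz)))
    where
    l : ∀ x y z w → (x ℤ.* w ℤ.- y ℤ.* z) ℤ.* y ≡ (y ℤ.* w) ℤ.* x ℤ.- (y ℤ.* z) ℤ.* y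
    l = ℤSolver.solve-∀
  trivial : b g ≡ 0ℤ → (Σ ℤ λ k → g ≃ Tᵏ k) → g ≃ Imat
  trivial b≡0 (k , up-to-sign (inj₁ (e₁ , e₂ , e₃ , e₄))) =
    up-to-sign (inj₁ (e₁ , b≡0 , e₃ , e₄))
  trivial b≡0 (k , up-to-sign (inj₂ (e₁ , e₂ , e₃ , e₄))) =
    up-to-sign (inj₂ (e₁ , b≡0 , e₃ , e₄))
  by-sign : (u : Dec (0ℤ ℤ.< reU g)) (s : Dec (0ℤ ℤ.< reS g)) →
            𝟙 u ≡ 𝟙 s ℚ.+ 𝟙 (≃-dec g Imat)
  by-sign (yes _) (yes S) = sym (cong (1ℚ ℚ.+_) (𝟙-no (≃-dec g Imat)
    λ e → ℤP.<-irrefl (sym (reS-resp e)) S))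
  by-sign (no ¬U) (no _) = sym (cong (0ℚ ℚ.+_) (𝟙-no (≃-dec g Imat)
    λ e → ¬U (subst (0ℤ ℤ.<_) (sym (reU-resp e)) (ℤ.+<+ (ℕ.s≤s ℕ.z≤n)))))
  by-sign (yes U) (no ¬S) = sym (cong (0ℚ ℚ.+_) (𝟙-yes (≃-dec g Imat)
    (on-axis (separated (a g ℤ.* c g) (b g ℤ.* d g) (b g ℤ.* c g) pq ¬S (subst (0ℤ ℤ.<_) U≡ U)))))
    where
    on-axis : (a g ℤ.* c g ≡ 0ℤ) × (b g ℤ.* d g ≡ 0ℤ) × (b g ℤ.* c g ≡ 0ℤ) → g ≃ Imat
    on-axis (ac , bd , bc) = trivial (zero-b (a g) (b g) (c g) (d g) bd bc det≡1)
      (unipotent g gΓ (zero-c (a g) (b g) (c g) (d g) ac bc det≡1))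
  by-sign (no ¬U) (yes S) = ⊥-elim (reS>0⇒reU>0 (a g ℤ.* c g) (b g ℤ.* d g) (b g ℤ.* c g) pq S
    (λ U → ¬U (subst (0ℤ ℤ.<_) (sym U≡) U)))

Inv-∙ : ∀ {h} A → Inv h → Inv (h ∘ (A ∙_))
Inv-∙ A inv r = inv (∙-congˡ A r)

-- Pairings with products by πS and πU

-- Kept in the shape that `ev` produces on the list `πS`, weights and final zero included, so that
-- `ev-∙` at `πS` fits by conversion; `meanU` likewise.
meanS : ℚ → ℚ → ℚ
meanS x y = (½ ℚ.* 1ℚ) ℚ.* x ℚ.+ ((½ ℚ.* 1ℚ) ℚ.* y ℚ.+ 0ℚ)

meanU : ℚ → ℚ → ℚ → ℚ
meanU x y z = (⅓ ℚ.* 1ℚ) ℚ.* x ℚ.+ ((⅓ ℚ.* 1ℚ) ℚ.* y ℚ.+ ((⅓ ℚ.* 1ℚ) ℚ.* z ℚ.+ 0ℚ))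

meanS-const : ∀ x → meanS x x ≡ x
meanS-const = lem
  where
  lem : ∀ x → (½ ℚ.* 1ℚ) ℚ.* x ℚ.+ ((½ ℚ.* 1ℚ) ℚ.* x ℚ.+ 0ℚ) ≡ x
  lem = solve-∀ ringℚ

meanU-const : ∀ x → meanU x x x ≡ x
meanU-const = lem
  where
  lem : ∀ x → (⅓ ℚ.* 1ℚ) ℚ.* x ℚ.+ ((⅓ ℚ.* 1ℚ) ℚ.* x ℚ.+ ((⅓ ℚ.* 1ℚ) ℚ.* x ℚ.+ 0ℚ)) ≡ x
  lem = solve-∀ ringℚ

opaque
  unfolding _∙_

  UU : Umat · Umat ≃ Umat ∙ Umat
  UU = ≃-refl

ev-πSˡ : ∀ {h} → Inv h → ∀ η → ev h (πS * η) ≡ meanS (ev h η) (ev (h ∘ (Smat ∙_)) η)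
ev-πSˡ {h} inv η = trans (ev-∙ h πS η)
  (cong (λ x → meanS x (ev (h ∘ (Smat ∙_)) η)) (ev-cong (λ N → inv (∙-identityˡ N)) η))

ev-πUˡ : ∀ {h} → Inv h → ∀ η → ev h (πU * η) ≡
  meanU (ev h η) (ev (h ∘ (Umat ∙_)) η) (ev (h ∘ (Umat ∙_) ∘ (Umat ∙_)) η)
ev-πUˡ {h} inv η = trans (ev-∙ h πU η)
  (cong₂ (λ x y → meanU x (ev (h ∘ (Umat ∙_)) η) y) (ev-cong (λ N → inv (∙-identityˡ N)) η)
    (ev-cong (λ N → inv (≃-trans (∙-congʳ N UU) (∙-assoc Umat Umat N))) η))

ev-πSʳ : ∀ {h} → Inv h → ∀ ξ → ev h (ξ * πS) ≡ ev (λ M → meanS (h M) (h (M ∙ Smat))) ξ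
ev-πSʳ {h} inv ξ = trans (ev-∙ h ξ πS)
  (ev-cong (λ M → cong (λ x → meanS x (h (M ∙ Smat))) (inv (∙-identityʳ M))) ξ)

ev-πUʳ : ∀ {h} → Inv h → ∀ ξ → ev h (ξ * πU) ≡
  ev (λ M → meanU (h M) (h (M ∙ Umat)) (h ((M ∙ Umat) ∙ Umat))) ξ
ev-πUʳ {h} inv ξ = trans (ev-∙ h ξ πU)
  (ev-cong (λ M → cong₂ (λ x y → meanU x (h (M ∙ Umat)) y) (inv (∙-identityʳ M))
    (inv (≃-trans (∙-congˡ M UU) (≃-sym (∙-assoc M Umat Umat))))) ξ)

ev-πS-invariant : ∀ {h} → Inv h → ∀ η → ev (h ∘ (Smat ∙_)) (πS * η) ≡ ev h (πS * η)
ev-πS-invariant {h} inv η = trans (ev-πSˡ (Inv-∙ Smat inv) η)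
  (trans (cong (meanS (ev (h ∘ (Smat ∙_)) η)) (ev-cong (λ N → inv (SS-∙ N)) η))
  (trans (swap (ev (h ∘ (Smat ∙_)) η) (ev h η)) (sym (ev-πSˡ inv η))))
  where
  swap : ∀ x y → (½ ℚ.* 1ℚ) ℚ.* x ℚ.+ ((½ ℚ.* 1ℚ) ℚ.* y ℚ.+ 0ℚ) ≡ (½ ℚ.* 1ℚ) ℚ.* y ℚ.+ ((½ ℚ.* 1ℚ) ℚ.* x ℚ.+ 0ℚ)
  swap = solve-∀ ringℚ

UUU-∙ : ∀ M → Umat ∙ (Umat ∙ (Umat ∙ M)) ≃ M
UUU-∙ M = ≃-trans (∙-congˡ Umat (≃-sym (∙-assoc Umat Umat M)))
  (≃-trans (≃-sym (∙-assoc Umat (Umat ∙ Umat) M)) (≃-trans (∙-congʳ M UUU≃I) (∙-identityˡ M)))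

ev-πU-invariant : ∀ {h} → Inv h → ∀ η → ev (h ∘ (Umat ∙_)) (πU * η) ≡ ev h (πU * η)
ev-πU-invariant {h} inv η = trans (ev-πUˡ (Inv-∙ Umat inv) η)
  (trans (cong (meanU y z) (ev-cong (λ N → inv (UUU-∙ N)) η))
  (trans (rotate x y z) (sym (ev-πUˡ inv η))))
  where
  x y z : ℚ
  x = ev h η
  y = ev (h ∘ (Umat ∙_)) η
  z = ev (h ∘ (Umat ∙_) ∘ (Umat ∙_)) η
  rotate : ∀ x y z → (⅓ ℚ.* 1ℚ) ℚ.* y ℚ.+ ((⅓ ℚ.* 1ℚ) ℚ.* z ℚ.+ ((⅓ ℚ.* 1ℚ) ℚ.* x ℚ.+ 0ℚ))
    ≡ (⅓ ℚ.* 1ℚ) ℚ.* x ℚ.+ ((⅓ ℚ.* 1ℚ) ℚ.* y ℚ.+ ((⅓ ℚ.* 1ℚ) ℚ.* z ℚ.+ 0ℚ))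
  rotate = solve-∀ ringℚ

ev-πSʳ-invariant : ∀ {h} → Inv h → (∀ M → h (M ∙ Smat) ≡ h M) → ∀ ξ → ev h (ξ * πS) ≡ ev h ξ
ev-πSʳ-invariant {h} inv fix ξ = trans (ev-πSʳ inv ξ)
  (ev-cong (λ M → trans (cong (meanS (h M)) (fix M)) (meanS-const (h M))) ξ)

ev-πUʳ-invariant : ∀ {h} → Inv h → (∀ M → h (M ∙ Umat) ≡ h M) → ∀ ξ → ev h (ξ * πU) ≡ ev h ξ
ev-πUʳ-invariant {h} inv fix ξ = trans (ev-πUʳ inv ξ)
  (ev-cong (λ M → trans (cong₂ (meanU (h M)) (fix M) (trans (fix (M ∙ Umat)) (fix M)))
                        (meanU-const (h M))) ξ)

-- A right S-invariant `h` cannot tell ξ from ξπ_S, and ξπ_S = π_U η is fixed by left multiplication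
-- by U.
𝓑-leftU : ∀ {h} ξ → In𝓑 ξ → Inv h → (∀ M → h (M ∙ Smat) ≡ h M) →
          ev (h ∘ (Umat ∙_)) ξ ≡ ev h ξ
𝓑-leftU {h} ξ ((η , e) , _) inv fix = begin
  ev (h ∘ (Umat ∙_)) ξ          ≡⟨ sym (ev-πSʳ-invariant (Inv-∙ Umat inv)
                                     (λ M → trans (inv (≃-sym (∙-assoc Umat M Smat))) (fix (Umat ∙ M))) ξ) ⟩
  ev (h ∘ (Umat ∙_)) (ξ * πS)   ≡⟨ ≈⇒≋ {ξ * πS} {πU * η} e (h ∘ (Umat ∙_)) (Inv-∙ Umat inv) ⟩
  ev (h ∘ (Umat ∙_)) (πU * η)   ≡⟨ ev-πU-invariant inv η ⟩
  ev h (πU * η)                 ≡⟨ sym (≈⇒≋ {ξ * πS} {πU * η} e h inv) ⟩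
  ev h (ξ * πS)                 ≡⟨ ev-πSʳ-invariant inv fix ξ ⟩
  ev h ξ                        ∎
  where open ≡-Reasoning

𝓑-leftS : ∀ {h} ξ → In𝓑 ξ → Inv h → (∀ M → h (M ∙ Umat) ≡ h M) →
          ev (h ∘ (Smat ∙_)) ξ ≡ ev h ξ
𝓑-leftS {h} ξ (_ , (η , e)) inv fix = begin
  ev (h ∘ (Smat ∙_)) ξ          ≡⟨ sym (ev-πUʳ-invariant (Inv-∙ Smat inv)
                                     (λ M → trans (inv (≃-sym (∙-assoc Smat M Umat))) (fix (Smat ∙ M))) ξ) ⟩
  ev (h ∘ (Smat ∙_)) (ξ * πU)   ≡⟨ ≈⇒≋ {ξ * πU} {πS * η} e (h ∘ (Smat ∙_)) (Inv-∙ Smat inv) ⟩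
  ev (h ∘ (Smat ∙_)) (πS * η)   ≡⟨ ev-πS-invariant inv η ⟩
  ev h (πS * η)                 ≡⟨ sym (≈⇒≋ {ξ * πU} {πS * η} e h inv) ⟩
  ev h (ξ * πU)                 ≡⟨ ev-πUʳ-invariant inv fix ξ ⟩
  ev h ξ                        ∎
  where open ≡-Reasoning

-- Sums over right cosets

φ : Mat → Mat → ℚ
φ M N = 𝟙 (RC? M N)

φ-resp : ∀ {M M' N N'} → M ≃ M' → N ≃ N' → φ M N ≡ φ M' N'
φ-resp {M} {M'} {N} {N'} r s = 𝟙-cong (RC? M N) (RC? M' N') (RC-resp r s)
  (RC-resp (≃-sym r) (≃-sym s))

φ-inv : ∀ M → Inv (φ M)
φ-inv M = φ-resp ≃-refl

φ-∙ʳ : ∀ M N {g} → Γ∋ g → φ M (N ∙ g) ≡ φ M N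
φ-∙ʳ M N {g} gΓ = 𝟙-cong (RC? M (N ∙ g)) (RC? M N)
  (λ r → RC-trans r (RC-sym (RC-∙ʳ N gΓ))) (λ r → RC-trans r (RC-∙ʳ N gΓ))

φ-∙ˡ : ∀ {A} M N → Γ∋ A → φ (A ∙ M) (A ∙ N) ≡ φ M N
φ-∙ˡ {A} M N AΓ = 𝟙-cong (RC? (A ∙ M) (A ∙ N)) (RC? M N) (RC-cancelˡ AΓ) (RC-∙ˡ A)

φ-RC : ∀ {M M'} → RC M M' → ∀ N → φ M N ≡ φ M' N
φ-RC {M} {M'} r N = 𝟙-cong (RC? M N) (RC? M' N) (RC-trans (RC-sym r)) (RC-trans r)

-- A letter in front of g is removed by translating the argument: φ of SgM at SN equals φ of gM at
-- N, and the pairing with ξ does not notice the translation. The same holds for U.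
coset-sum-Γ : ∀ ξ → In𝓑 ξ → ∀ {g} → Γ∋ g → ∀ M → ev (φ (g ∙ M)) ξ ≡ ev (φ M) ξ
coset-sum-Γ ξ ξ𝓑 = Generation.generated
  (λ g → ∀ M → ev (φ (g ∙ M)) ξ ≡ ev (φ M) ξ)
  (λ r p M → trans (ev-cong (λ N → φ-resp (∙-congʳ M r) ≃-refl) ξ) (p M))
  (λ M → ev-cong (λ N → φ-resp (∙-identityˡ M) ≃-refl) ξ)
  (λ {g} p M → trans (sym (𝓑-leftS {φ ((Smat ∙ g) ∙ M)} ξ ξ𝓑 (φ-inv _) (λ N → φ-∙ʳ _ N Γ-U)))
    (trans (ev-cong (λ N → trans (φ-resp (∙-assoc Smat g M) ≃-refl) (φ-∙ˡ (g ∙ M) N Γ-S)) ξ) (p M)))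
  (λ {g} p M → trans (sym (𝓑-leftU {φ ((Umat ∙ g) ∙ M)} ξ ξ𝓑 (φ-inv _) (λ N → φ-∙ʳ _ N Γ-S)))
    (trans (ev-cong (λ N → trans (φ-resp (∙-assoc Umat g M) ≃-refl) (φ-∙ˡ (g ∙ M) N Γ-U)) ξ) (p M)))

-- For M = gδh the coset is gδΓ, so every coset sum reduces to that of δΓ.
coset-sum : ∀ {δ} ξ → In𝓑 ξ → ∀ {M} → Δ∋ δ M → ev (φ M) ξ ≡ ev (φ δ) ξ
coset-sum {δ} ξ ξ𝓑 {M} (double g h gΓ hΓ r) = trans
  (ev-cong (φ-RC (RC-sym (coset h hΓ r))) ξ) (coset-sum-Γ ξ ξ𝓑 gΓ δ)

pairing : ∀ M ξ → Pairing M ξ (ev (φ M) ξ)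
pairing M [] = nil
pairing M ((q , N) ∷ ξ) = extend (RC? M N)
  where
  extend : (p : Dec (RC M N)) → Pairing M ((q , N) ∷ ξ) (q ℚ.* 𝟙 p ℚ.+ ev (φ M) ξ)
  extend (yes r) = subst (λ x → Pairing M ((q , N) ∷ ξ) (x ℚ.+ ev (φ M) ξ))
    (sym (ℚP.*-identityʳ q)) (consIn (from-RC r) (pairing M ξ))
  extend (no ¬r) = subst (Pairing M ((q , N) ∷ ξ))
    (sym (trans (cong (ℚ._+ ev (φ M) ξ) (ℚP.*-zeroʳ q)) (ℚP.+-identityˡ _)))
    (consOut (¬r ∘ to-RC) (pairing M ξ))

-- Half-plane functions

hS hU : Mat → Mat → ℚ
hS M N = φ M N ℚ.* 𝟙 (reS>0? (adj M ∙ N))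
hU M N = φ M N ℚ.* 𝟙 (reU>0? (adj M ∙ N))

𝟙-reS : ∀ X Y → reS X ≡ reS Y → 𝟙 (reS>0? X) ≡ 𝟙 (reS>0? Y)
𝟙-reS X Y e = 𝟙-cong (reS>0? X) (reS>0? Y) (subst (0ℤ ℤ.<_) e) (subst (0ℤ ℤ.<_) (sym e))

𝟙-reU : ∀ X Y → reU X ≡ reU Y → 𝟙 (reU>0? X) ≡ 𝟙 (reU>0? Y)
𝟙-reU X Y e = 𝟙-cong (reU>0? X) (reU>0? Y) (subst (0ℤ ℤ.<_) e) (subst (0ℤ ℤ.<_) (sym e))

hS-resp : ∀ {M M' N N'} → M ≃ M' → N ≃ N' → hS M N ≡ hS M' N'
hS-resp {M} {M'} {N} {N'} r s = cong₂ ℚ._*_ (φ-resp r s)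
  (𝟙-reS (adj M ∙ N) (adj M' ∙ N') (reS-resp (≃-trans (∙-congʳ N (adj-resp r)) (∙-congˡ (adj M') s))))

hU-inv : ∀ M → Inv (hU M)
hU-inv M {N} {N'} s = cong₂ ℚ._*_ (φ-resp ≃-refl s) (𝟙-reU (adj M ∙ N) (adj M ∙ N') (reU-resp (∙-congˡ (adj M) s)))

hS-∙S : ∀ M N → hS M (N ∙ Smat) ≡ hS M N
hS-∙S M N = cong₂ ℚ._*_ (φ-∙ʳ M N Γ-S)
  (𝟙-reS (adj M ∙ (N ∙ Smat)) (adj M ∙ N) (trans (reS-resp (≃-sym (∙-assoc (adj M) N Smat))) (reS-∙S (adj M ∙ N))))

hU-∙U : ∀ M N → hU M (N ∙ Umat) ≡ hU M N
hU-∙U M N = cong₂ ℚ._*_ (φ-∙ʳ M N Γ-U)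
  (𝟙-reU (adj M ∙ (N ∙ Umat)) (adj M ∙ N) (trans (reU-resp (≃-sym (∙-assoc (adj M) N Umat))) (reU-∙U (adj M ∙ N))))

hS-∙ˡ : ∀ {A} M N → Γ∋ A → hS (A ∙ M) (A ∙ N) ≡ hS M N
hS-∙ˡ {A} M N AΓ = cong₂ ℚ._*_ (φ-∙ˡ M N AΓ)
  (𝟙-reS (adj (A ∙ M) ∙ (A ∙ N)) (adj M ∙ N) (reS-resp (adj-cancel M N AΓ)))

-- Off the coset MΓ all terms vanish. On it N = Mg, and the identity is `half-plane` for g, since N
-- = ±M exactly when g = ±1.
hU-hS : ∀ M N → hU M N ≡ hS M N ℚ.+ 𝟙 (≃-dec M N)
hU-hS M N = by-coset (RC? M N)
  where
  open ≡-Reasoning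
  s u : ℚ
  s = 𝟙 (reS>0? (adj M ∙ N))
  u = 𝟙 (reU>0? (adj M ∙ N))
  by-coset : (p : Dec (RC M N)) → 𝟙 p ℚ.* u ≡ 𝟙 p ℚ.* s ℚ.+ 𝟙 (≃-dec M N)
  by-coset (no ¬r) = sym (trans
    (cong (0ℚ ℚ.* s ℚ.+_) (𝟙-no (≃-dec M N) (λ e → ¬r (RC-resp ≃-refl e (RC-refl M)))))
    (lem s u))
    where
    lem : ∀ s u → 0ℚ ℚ.* s ℚ.+ 0ℚ ≡ 0ℚ ℚ.* u
    lem = solve-∀ ringℚ
  by-coset (yes (coset g gΓ e)) = begin
    1ℚ ℚ.* u                                        ≡⟨ ℚP.*-identityˡ u ⟩
    u                                               ≡⟨ 𝟙-cong (reU>0? X) (reU>0? g) (descend reU-X) (ascend reU-X) ⟩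
    𝟙 (reU>0? g)                                    ≡⟨ half-plane gΓ ⟩
    𝟙 (reS>0? g) ℚ.+ 𝟙 (≃-dec g Imat)               ≡⟨ cong₂ ℚ._+_ (sym (𝟙-cong (reS>0? X) (reS>0? g) (descend reS-X) (ascend reS-X)))
                                                         (𝟙-cong (≃-dec g Imat) (≃-dec M N) to from) ⟩
    s ℚ.+ 𝟙 (≃-dec M N)                             ≡⟨ cong (ℚ._+ 𝟙 (≃-dec M N)) (sym (ℚP.*-identityˡ s)) ⟩
    1ℚ ℚ.* s ℚ.+ 𝟙 (≃-dec M N)                      ∎
    where
    X = adj M ∙ N
    n = det M
    reS-X : reS X ≡ n ℤ.* (n ℤ.* reS g)
    reS-X = trans (reS-resp (∙-congˡ (adj M) e)) (reS-scale M g)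
    reU-X : reU X ≡ n ℤ.* (n ℤ.* reU g)
    reU-X = trans (reU-resp (∙-congˡ (adj M) e)) (reU-scale M g)
    descend : ∀ {x y} → x ≡ n ℤ.* (n ℤ.* y) → 0ℤ ℤ.< x → 0ℤ ℤ.< y
    descend {y = y} q p = 0<-cancel {n} {y} (det>0 M)
      (0<-cancel {n} {n ℤ.* y} (det>0 M) (subst (0ℤ ℤ.<_) q p))
    ascend : ∀ {x y} → x ≡ n ℤ.* (n ℤ.* y) → 0ℤ ℤ.< y → 0ℤ ℤ.< x
    ascend {y = y} q p = subst (0ℤ ℤ.<_) (sym q)
      (0<-* {n} {n ℤ.* y} (det>0 M) (0<-* {n} {y} (det>0 M) p))
    to : g ≃ Imat → M ≃ N
    to r = ≃-sym (≃-trans e (≃-trans (∙-congˡ M r) (∙-identityʳ M)))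
    from : M ≃ N → g ≃ Imat
    from r = ∙-cancelˡ M (≃-trans (≃-sym e) (≃-trans (≃-sym r) (≃-sym (∙-identityʳ M))))

-- Orbits of left multiplication by T

record LT (M N : Mat) : Set where
  constructor translate
  field
    shift : ℤ
    by    : N ≃ Tᵏ shift ∙ M

LT-refl : ∀ M → LT M M
LT-refl M = translate 0ℤ (≃-sym (≃-trans (∙-congʳ M T⁰≃I) (∙-identityˡ M)))

Tᵏ-∙∙ : ∀ j k M → Tᵏ j ∙ (Tᵏ k ∙ M) ≃ Tᵏ (j ℤ.+ k) ∙ M
Tᵏ-∙∙ j k M = ≃-trans (≃-sym (∙-assoc (Tᵏ j) (Tᵏ k) M)) (∙-congʳ M (Tᵏ-∙ j k))

LT-trans : ∀ {M N P} → LT M N → LT N P → LT M P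
LT-trans {M} (translate j r) (translate k s) = translate (k ℤ.+ j)
  (≃-trans s (≃-trans (∙-congˡ (Tᵏ k) r) (Tᵏ-∙∙ k j M)))

LT-sym : ∀ {M N} → LT M N → LT N M
LT-sym {M} {N} (translate k r) = translate (ℤ.- k) (≃-sym
  (≃-trans (∙-congˡ (Tᵏ (ℤ.- k)) r) (≃-trans (Tᵏ-∙∙ (ℤ.- k) k M)
    (subst (λ j → Tᵏ j ∙ M ≃ M) (sym (ℤP.+-inverseˡ k))
      (≃-trans (∙-congʳ M T⁰≃I) (∙-identityˡ M))))))

LT-resp : ∀ {M N N'} → N ≃ N' → LT M N → LT M N'
LT-resp r (translate k s) = translate k (≃-trans (≃-sym r) s)

opaque
  unfolding _∙_ adj

  -- Because (T^k M) adj(M) = det(M) T^k, the shift of a translate can be recovered from its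
  -- upper-right entry.
  Tᵏ-adj : ∀ k M → (a ((Tᵏ k ∙ M) ∙ adj M) ≡ det M) × (b ((Tᵏ k ∙ M) ∙ adj M) ≡ k ℤ.* det M)
  Tᵏ-adj k (mat x y z w _) = e₁ k x y z w , e₂ k x y z w
    where
    e₁ : ∀ k x y z w → (1ℤ ℤ.* x ℤ.+ k ℤ.* z) ℤ.* w ℤ.+ (1ℤ ℤ.* y ℤ.+ k ℤ.* w) ℤ.* (ℤ.- z)
         ≡ x ℤ.* w ℤ.- y ℤ.* z
    e₁ = ℤSolver.solve-∀
    e₂ : ∀ k x y z w → (1ℤ ℤ.* x ℤ.+ k ℤ.* z) ℤ.* (ℤ.- y) ℤ.+ (1ℤ ℤ.* y ℤ.+ k ℤ.* w) ℤ.* x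
         ≡ k ℤ.* (x ℤ.* w ℤ.- y ℤ.* z)
    e₂ = ℤSolver.solve-∀

cancel-*ʳ : ∀ n {i j} → n ≢ 0ℤ → i ℤ.* n ≡ j ℤ.* n → i ≡ j
cancel-*ʳ n {i} {j} n≢0 e = cancel-* n n≢0
  (trans (ℤP.*-comm n i) (trans e (ℤP.*-comm j n)))

-- If the two translates differed by a sign, the upper-left entries would give det M = -det M.
Tᵏ-injective : ∀ {j k} M → Tᵏ j ∙ M ≃ Tᵏ k ∙ M → j ≡ k
Tᵏ-injective {j} {k} M r = go (Tᵏ-adj j M) (Tᵏ-adj k M) (∙-congʳ (adj M) r)
  where
  X = (Tᵏ j ∙ M) ∙ adj M
  Y = (Tᵏ k ∙ M) ∙ adj M
  n = det M
  go : (a X ≡ n) × (b X ≡ j ℤ.* n) → (a Y ≡ n) × (b Y ≡ k ℤ.* n) → X ≃ Y → j ≡ k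
  go (_ , p) (_ , q) (up-to-sign (inj₁ (_ , e , _ , _))) =
    cancel-*ʳ n (det≢0 M) (trans (sym p) (trans e q))
  go (p , _) (q , _) (up-to-sign (inj₂ (e , _ , _ , _))) =
    ⊥-elim (det≢0 M (twice-zero (trans (cong (ℤ._+ n) n≡-n) (ℤP.+-inverseˡ n))))
    where
    n≡-n : n ≡ ℤ.- n
    n≡-n = trans (sym p) (trans e (cong ℤ.-_ q))

private
  -- The entry determines the shift only up to the sign of N, so two candidates remain; testing both
  -- decides `LT`.
  shift-candidate : ∀ {M N} j → b (N ∙ adj M) ≡ j ℤ.* det M → LT M N →
                    (N ≃ Tᵏ j ∙ M) ⊎ (N ≃ Tᵏ (ℤ.- j) ∙ M)
  shift-candidate {M} {N} j e (translate k r) = go (∙-congʳ (adj M) r)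
    where
    go : N ∙ adj M ≃ (Tᵏ k ∙ M) ∙ adj M → (N ≃ Tᵏ j ∙ M) ⊎ (N ≃ Tᵏ (ℤ.- j) ∙ M)
    go (up-to-sign (inj₁ (_ , f , _ , _))) = inj₁ (subst (λ i → N ≃ Tᵏ i ∙ M) k≡j r)
      where
      k≡j : k ≡ j
      k≡j = cancel-*ʳ (det M) (det≢0 M) (trans (sym (proj₂ (Tᵏ-adj k M))) (trans (sym f) e))
    go (up-to-sign (inj₂ (_ , f , _ , _))) = inj₂ (subst (λ i → N ≃ Tᵏ i ∙ M) k≡-j r)
      where
      k≡-j : k ≡ ℤ.- j
      k≡-j = cancel-*ʳ (det M) (det≢0 M) (trans (sym (proj₂ (Tᵏ-adj k M)))
        (trans (sym (ℤP.neg-involutive _)) (trans (cong ℤ.-_ (trans (sym f) e))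
          (ℤP.neg-distribˡ-* j (det M)))))

  LT-divides : ∀ {M N} → LT M N → det M ∣ b (N ∙ adj M)
  LT-divides {M} {N} (translate k r) = go (∙-congʳ (adj M) r)
    where
    go : N ∙ adj M ≃ (Tᵏ k ∙ M) ∙ adj M → det M ∣ b (N ∙ adj M)
    go (up-to-sign (inj₁ (_ , f , _ , _))) = divides k (trans f (proj₂ (Tᵏ-adj k M)))
    go (up-to-sign (inj₂ (_ , f , _ , _))) = divides (ℤ.- k)
      (trans f (trans (cong ℤ.-_ (proj₂ (Tᵏ-adj k M))) (ℤP.neg-distribˡ-* k (det M))))

opaque
  LT? : ∀ M N → Dec (LT M N)
  LT? M N with det M ∣? b (N ∙ adj M)
  ... | no ∤ = no (∤ ∘ LT-divides)
  ... | yes (divides j e) = map′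
    (λ { (inj₁ r) → translate j r ; (inj₂ r) → translate (ℤ.- j) r })
    (shift-candidate j e)
    (≃-dec N (Tᵏ j ∙ M) ⊎-dec ≃-dec N (Tᵏ (ℤ.- j) ∙ M))

-- Properties of all large K

Eventually : (ℕ → Set) → Set
Eventually P = Σ ℕ λ K₀ → ∀ K → K₀ ℕ.≤ K → P K

_and_ : ∀ {P Q} → Eventually P → Eventually Q → Eventually (λ K → P K × Q K)
(K₁ , p) and (K₂ , q) = K₁ ℕ.⊔ K₂ , λ K l →
  p K (ℕP.≤-trans (ℕP.m≤m⊔n K₁ K₂) l) , q K (ℕP.≤-trans (ℕP.m≤n⊔m K₁ K₂) l)

eventually-map : ∀ {P Q} → (∀ K → P K → Q K) → Eventually P → Eventually Q
eventually-map f (K₀ , p) = K₀ , λ K l → f K (p K l)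

-- The thresholds depend on N, but ξ lists finitely many matrices and their maximum serves for all.
eventually-ev : ∀ {f g : ℕ → Mat → ℚ} → (∀ N → Eventually (λ K → f K N ≡ g K N)) →
  ∀ ξ → Eventually (λ K → ev (f K) ξ ≡ ev (g K) ξ)
eventually-ev p []            = 0 , λ _ _ → refl
eventually-ev p ((q , N) ∷ ξ) = eventually-map
  (λ K (x , y) → cong₂ (λ u v → q ℚ.* u ℚ.+ v) x y) (p N and eventually-ev p ξ)

0≤abs+ : ∀ C → 0ℤ ℤ.≤ + ∣ C ∣ ℤ.+ C
0≤abs+ (+ n)    = ℤ.+≤+ ℕ.z≤n
0≤abs+ -[1+ n ] = ℤP.≤-reflexive (sym (ℤP.n⊖n≡0 (suc n)))

0<K+C : ∀ C K → ∣ C ∣ ℕ.< K → 0ℤ ℤ.< + K ℤ.+ C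
0<K+C C K l = subst (0ℤ ℤ.<_) e (0<-+ {+ suc j} (ℤ.+<+ (ℕ.s≤s ℕ.z≤n)) (0≤abs+ C))
  where
  j : ℕ
  j = K ℕ.∸ suc ∣ C ∣
  e : + suc j ℤ.+ (+ ∣ C ∣ ℤ.+ C) ≡ + K ℤ.+ C
  e = trans (sym (ℤP.+-assoc (+ suc j) (+ ∣ C ∣) C))
    (cong (λ n → + n ℤ.+ C) (trans (sym (ℕP.+-suc j ∣ C ∣)) (ℕP.m∸n+n≡m l)))

-- From AK + C = (K + C) + (A - 1)K. The threshold is uniform in A, which lets
-- `eventually-quadratic` take the K-dependent value AK + B as the slope.
0<AK+C : ∀ {A} C K → 0ℤ ℤ.< A → ∣ C ∣ ℕ.< K → 0ℤ ℤ.< A ℤ.* + K ℤ.+ C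
0<AK+C {A} C K A>0 l = subst (0ℤ ℤ.<_) (lem A (+ K) C)
  (0<-+ (0<K+C C K l) (0≤-* {A ℤ.- 1ℤ} {+ K} (0<⇒0≤pred A>0) (ℤ.+≤+ ℕ.z≤n)))
  where
  lem : ∀ A K C → (K ℤ.+ C) ℤ.+ (A ℤ.- 1ℤ) ℤ.* K ≡ A ℤ.* K ℤ.+ C
  lem = ℤSolver.solve-∀

eventually-linear : ∀ {A} C → 0ℤ ℤ.< A → Eventually (λ K → 0ℤ ℤ.< A ℤ.* + K ℤ.+ C)
eventually-linear C A>0 = suc ∣ C ∣ , λ K l → 0<AK+C C K A>0 l

eventually-quadratic : ∀ {A} B C → 0ℤ ℤ.< A →
  Eventually (λ K → 0ℤ ℤ.< (A ℤ.* + K ℤ.+ B) ℤ.* + K ℤ.+ C)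
eventually-quadratic B C A>0 = eventually-map
  (λ K (l , m) → 0<AK+C C K m l)
  ((suc ∣ C ∣ , λ _ l → l) and eventually-linear B A>0)

-- The behaviour of the half-plane functions along a T-orbit

opaque
  unfolding _∙_ adj

  -- Only the leading coefficient matters: it has the sign of -cd, which is the side of the cusp
  -- M⁻¹(∞) = -d/c. `B` and `C` are read off the identity `lem`.
  reS-orbit : ∀ M N → Σ ℤ λ B → Σ ℤ λ C → ∀ k →
    reS (adj (Tᵏ k ∙ M) ∙ N) ≡ (ℤ.- (c M ℤ.* d M) ℤ.* (c N ℤ.* c N ℤ.+ d N ℤ.* d N) ℤ.* k ℤ.+ B) ℤ.* k ℤ.+ C
  reS-orbit (mat x y z w _) (mat e f g h _) = _ , _ , λ k → lem x y z w e f g h k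
    where
    lem : ∀ x y z w e f g h k →
      let y' = 1ℤ ℤ.* y ℤ.+ k ℤ.* w ; x' = 1ℤ ℤ.* x ℤ.+ k ℤ.* z
          z' = 0ℤ ℤ.* x ℤ.+ 1ℤ ℤ.* z ; w' = 0ℤ ℤ.* y ℤ.+ 1ℤ ℤ.* w in
      (w' ℤ.* e ℤ.+ (ℤ.- y') ℤ.* g) ℤ.* ((ℤ.- z') ℤ.* e ℤ.+ x' ℤ.* g)
        ℤ.+ (w' ℤ.* f ℤ.+ (ℤ.- y') ℤ.* h) ℤ.* ((ℤ.- z') ℤ.* f ℤ.+ x' ℤ.* h)
      ≡ (ℤ.- (z ℤ.* w) ℤ.* (g ℤ.* g ℤ.+ h ℤ.* h) ℤ.* k
          ℤ.+ ((w ℤ.* e ℤ.- y ℤ.* g) ℤ.* (z ℤ.* g) ℤ.- (w ℤ.* g) ℤ.* (x ℤ.* g ℤ.- z ℤ.* e)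
            ℤ.+ ((w ℤ.* f ℤ.- y ℤ.* h) ℤ.* (z ℤ.* h) ℤ.- (w ℤ.* h) ℤ.* (x ℤ.* h ℤ.- z ℤ.* f)))) ℤ.* k
        ℤ.+ ((w ℤ.* e ℤ.- y ℤ.* g) ℤ.* (x ℤ.* g ℤ.- z ℤ.* e)
            ℤ.+ (w ℤ.* f ℤ.- y ℤ.* h) ℤ.* (x ℤ.* h ℤ.- z ℤ.* f))
    lem = ℤSolver.solve-∀

  -- The quadratic term is gone. M⁻¹ is affine with positive slope d/a, and the points T⁻ᵏN(i) move
  -- left as k grows, hence the negative slope.
  reS-orbit-c0 : ∀ M N → c M ≡ 0ℤ → Σ ℤ λ C → ∀ k →
    reS (adj (Tᵏ k ∙ M) ∙ N) ≡ ℤ.- (det M) ℤ.* (c N ℤ.* c N ℤ.+ d N ℤ.* d N) ℤ.* k ℤ.+ C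
  reS-orbit-c0 (mat x y z w _) (mat e f g h _) refl = _ , λ k → lem x y w e f g h k
    where
    lem : ∀ x y w e f g h k →
      let y' = 1ℤ ℤ.* y ℤ.+ k ℤ.* w ; x' = 1ℤ ℤ.* x ℤ.+ k ℤ.* 0ℤ
          z' = 0ℤ ℤ.* x ℤ.+ 1ℤ ℤ.* 0ℤ ; w' = 0ℤ ℤ.* y ℤ.+ 1ℤ ℤ.* w in
      (w' ℤ.* e ℤ.+ (ℤ.- y') ℤ.* g) ℤ.* ((ℤ.- z') ℤ.* e ℤ.+ x' ℤ.* g)
        ℤ.+ (w' ℤ.* f ℤ.+ (ℤ.- y') ℤ.* h) ℤ.* ((ℤ.- z') ℤ.* f ℤ.+ x' ℤ.* h)
      ≡ ℤ.- (x ℤ.* w ℤ.- y ℤ.* 0ℤ) ℤ.* (g ℤ.* g ℤ.+ h ℤ.* h) ℤ.* k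
        ℤ.+ ((w ℤ.* e ℤ.- y ℤ.* g) ℤ.* (x ℤ.* g) ℤ.+ (w ℤ.* f ℤ.- y ℤ.* h) ℤ.* (x ℤ.* h))
    lem = ℤSolver.solve-∀

  -- Here M⁻¹(∞) = 0, approached from the right as k → +∞ and from the left as k → -∞.
  reS-orbit-d0 : ∀ M N → d M ≡ 0ℤ → Σ ℤ λ C → ∀ k →
    reS (adj (Tᵏ k ∙ M) ∙ N) ≡ det M ℤ.* (c N ℤ.* c N ℤ.+ d N ℤ.* d N) ℤ.* k ℤ.+ C
  reS-orbit-d0 (mat x y z w _) (mat e f g h _) refl = _ , λ k → lem x y z e f g h k
    where
    lem : ∀ x y z e f g h k →
      let y' = 1ℤ ℤ.* y ℤ.+ k ℤ.* 0ℤ ; x' = 1ℤ ℤ.* x ℤ.+ k ℤ.* z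
          z' = 0ℤ ℤ.* x ℤ.+ 1ℤ ℤ.* z ; w' = 0ℤ ℤ.* y ℤ.+ 1ℤ ℤ.* 0ℤ in
      (w' ℤ.* e ℤ.+ (ℤ.- y') ℤ.* g) ℤ.* ((ℤ.- z') ℤ.* e ℤ.+ x' ℤ.* g)
        ℤ.+ (w' ℤ.* f ℤ.+ (ℤ.- y') ℤ.* h) ℤ.* ((ℤ.- z') ℤ.* f ℤ.+ x' ℤ.* h)
      ≡ (x ℤ.* 0ℤ ℤ.- y ℤ.* z) ℤ.* (g ℤ.* g ℤ.+ h ℤ.* h) ℤ.* k
        ℤ.+ ((ℤ.- (y ℤ.* g)) ℤ.* (x ℤ.* g ℤ.- z ℤ.* e) ℤ.+ (ℤ.- (y ℤ.* h)) ℤ.* (x ℤ.* h ℤ.- z ℤ.* f))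
    lem = ℤSolver.solve-∀

bottom-row≢0 : ∀ M → c M ≡ 0ℤ → d M ≡ 0ℤ → ⊥
bottom-row≢0 M c≡0 d≡0 = det≢0 M (trans
  (cong₂ (λ z w → a M ℤ.* w ℤ.- b M ℤ.* z) c≡0 d≡0) (lem (a M) (b M)))
  where
  lem : ∀ x y → x ℤ.* 0ℤ ℤ.- y ℤ.* 0ℤ ≡ 0ℤ
  lem = ℤSolver.solve-∀

normSq : Mat → ℤ
normSq N = c N ℤ.* c N ℤ.+ d N ℤ.* d N

normSq>0 : ∀ N → 0ℤ ℤ.< normSq N
normSq>0 N = ℤP.≤∧≢⇒< (0≤-+ (0≤-sq (c N)) (0≤-sq (d N))) λ e →
  bottom-row≢0 N
    (sq-zero (0≤sum-zero (0≤-sq (c N)) (0≤-sq (d N)) (sym e)))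
    (sq-zero (0≤sum-zero (0≤-sq (d N)) (0≤-sq (c N))
      (trans (ℤP.+-comm (d N ℤ.* d N) (c N ℤ.* c N)) (sym e))))

module _ (M : Mat) where

  private
    X : ℤ → Mat → Mat
    X k N = adj (Tᵏ k ∙ M) ∙ N

    above : ∀ {k N y} → reS (X k N) ≡ y → 0ℤ ℤ.< y → 𝟙 (reS>0? (X k N)) ≡ 1ℚ
    above {k} {N} e p = 𝟙-yes (reS>0? (X k N)) (subst (0ℤ ℤ.<_) (sym e) p)

    below : ∀ {k N y} → reS (X k N) ≡ y → 0ℤ ℤ.< ℤ.- y → 𝟙 (reS>0? (X k N)) ≡ 0ℚ
    below {k} {N} e p = 𝟙-no (reS>0? (X k N)) λ q →
      ℤP.<-asym (subst (0ℤ ℤ.<_) e q) (subst (ℤ._< 0ℤ) (ℤP.neg-involutive _) (ℤP.neg-mono-< p))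

    Side : ℚ → ℚ → Mat → Set
    Side σ⁻ σ⁺ N = Eventually λ K →
      (𝟙 (reS>0? (X (+ K) N)) ≡ σ⁺) × (𝟙 (reS>0? (X (ℤ.- + K) N)) ≡ σ⁻)

    pos : ∀ {x y} → x ≡ y → 0ℤ ℤ.< x → 0ℤ ℤ.< y
    pos = subst (0ℤ ℤ.<_)

  side-c0 : c M ≡ 0ℤ → ∀ N → Side 1ℚ 0ℚ N
  side-c0 c≡0 N = go (reS-orbit-c0 M N c≡0)
    where
    A>0 = 0<-* (det>0 M) (normSq>0 N)
    go : (Σ ℤ λ C → ∀ k → reS (X k N) ≡ ℤ.- (det M) ℤ.* normSq N ℤ.* k ℤ.+ C) → Side 1ℚ 0ℚ N
    go (C , f) = eventually-map
      (λ K (p , q) → below (f (+ K)) (pos (e₁ (det M) (normSq N) (+ K) C) p) ,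
                     above (f (ℤ.- + K)) (pos (e₂ (det M) (normSq N) (+ K) C) q))
      (eventually-linear (ℤ.- C) A>0 and eventually-linear C A>0)
      where
      e₁ : ∀ n m K C → (n ℤ.* m) ℤ.* K ℤ.+ ℤ.- C ≡ ℤ.- (ℤ.- n ℤ.* m ℤ.* K ℤ.+ C)
      e₁ = ℤSolver.solve-∀
      e₂ : ∀ n m K C → (n ℤ.* m) ℤ.* K ℤ.+ C ≡ ℤ.- n ℤ.* m ℤ.* (ℤ.- K) ℤ.+ C
      e₂ = ℤSolver.solve-∀

  side-d0 : d M ≡ 0ℤ → ∀ N → Side 0ℚ 1ℚ N
  side-d0 d≡0 N = go (reS-orbit-d0 M N d≡0)
    where
    A>0 = 0<-* (det>0 M) (normSq>0 N)
    go : (Σ ℤ λ C → ∀ k → reS (X k N) ≡ det M ℤ.* normSq N ℤ.* k ℤ.+ C) → Side 0ℚ 1ℚ N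
    go (C , f) = eventually-map
      (λ K (p , q) → above (f (+ K)) p ,
                     below (f (ℤ.- + K)) (pos (e₁ (det M) (normSq N) (+ K) C) q))
      (eventually-linear C A>0 and eventually-linear (ℤ.- C) A>0)
      where
      e₁ : ∀ n m K C → (n ℤ.* m) ℤ.* K ℤ.+ ℤ.- C ≡ ℤ.- (n ℤ.* m ℤ.* (ℤ.- K) ℤ.+ C)
      e₁ = ℤSolver.solve-∀

  side-neg : 0ℤ ℤ.< ℤ.- (c M ℤ.* d M) → ∀ N → Side 1ℚ 1ℚ N
  side-neg cd<0 N = go (reS-orbit M N)
    where
    A>0 = 0<-* cd<0 (normSq>0 N)
    go : (Σ ℤ λ B → Σ ℤ λ C → ∀ k → reS (X k N) ≡
           (ℤ.- (c M ℤ.* d M) ℤ.* normSq N ℤ.* k ℤ.+ B) ℤ.* k ℤ.+ C) → Side 1ℚ 1ℚ N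
    go (B , C , f) = eventually-map
      (λ K (p , q) → above (f (+ K)) p ,
                     above (f (ℤ.- + K)) (pos (e₁ (ℤ.- (c M ℤ.* d M)) (normSq N) (+ K) B C) q))
      (eventually-quadratic B C A>0 and eventually-quadratic (ℤ.- B) C A>0)
      where
      e₁ : ∀ n m K B C → ((n ℤ.* m) ℤ.* K ℤ.+ ℤ.- B) ℤ.* K ℤ.+ C
           ≡ (n ℤ.* m ℤ.* (ℤ.- K) ℤ.+ B) ℤ.* (ℤ.- K) ℤ.+ C
      e₁ = ℤSolver.solve-∀

  side-pos : 0ℤ ℤ.< c M ℤ.* d M → ∀ N → Side 0ℚ 0ℚ N
  side-pos cd>0 N = go (reS-orbit M N)
    where
    A>0 = 0<-* cd>0 (normSq>0 N)
    go : (Σ ℤ λ B → Σ ℤ λ C → ∀ k → reS (X k N) ≡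
           (ℤ.- (c M ℤ.* d M) ℤ.* normSq N ℤ.* k ℤ.+ B) ℤ.* k ℤ.+ C) → Side 0ℚ 0ℚ N
    go (B , C , f) = eventually-map
      (λ K (p , q) → below (f (+ K)) (pos (e₁ (c M ℤ.* d M) (normSq N) (+ K) B C) p) ,
                     below (f (ℤ.- + K)) (pos (e₂ (c M ℤ.* d M) (normSq N) (+ K) B C) q))
      (eventually-quadratic (ℤ.- B) (ℤ.- C) A>0 and eventually-quadratic B (ℤ.- C) A>0)
      where
      e₁ : ∀ n m K B C → ((n ℤ.* m) ℤ.* K ℤ.+ ℤ.- B) ℤ.* K ℤ.+ ℤ.- C
           ≡ ℤ.- ((ℤ.- n ℤ.* m ℤ.* K ℤ.+ B) ℤ.* K ℤ.+ C)
      e₁ = ℤSolver.solve-∀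
      e₂ : ∀ n m K B C → ((n ℤ.* m) ℤ.* K ℤ.+ B) ℤ.* K ℤ.+ ℤ.- C
           ≡ ℤ.- ((ℤ.- n ℤ.* m ℤ.* (ℤ.- K) ℤ.+ B) ℤ.* (ℤ.- K) ℤ.+ C)
      e₂ = ℤSolver.solve-∀

  -- Plays two parts: the jump σ⁻ - σ⁺ of the half-plane indicator along the orbit of M, and the
  -- orbit sum of T^∞(1 - S).
  cusp : ℚ
  cusp = 𝟙 (c M ℤP.≟ 0ℤ) ℚ.- 𝟙 (d M ℤP.≟ 0ℤ)

  -- The limits of [reS > 0] at both ends of the T-orbit of M: the i-points
  -- T⁻ᵏN(i) are carried by M⁻¹ towards the cusp M⁻¹(∞).
  sides : Σ ℚ λ σ⁻ → Σ ℚ λ σ⁺ → (σ⁻ ℚ.- σ⁺ ≡ cusp) × (∀ N → Side σ⁻ σ⁺ N)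
  sides = go (c M ℤP.≟ 0ℤ) (d M ℤP.≟ 0ℤ)
    where
    go : (z : Dec (c M ≡ 0ℤ)) (w : Dec (d M ≡ 0ℤ)) →
         Σ ℚ λ σ⁻ → Σ ℚ λ σ⁺ → (σ⁻ ℚ.- σ⁺ ≡ 𝟙 z ℚ.- 𝟙 w) × (∀ N → Side σ⁻ σ⁺ N)
    go (yes z) (yes w) = ⊥-elim (bottom-row≢0 M z w)
    go (yes z) (no _)  = 1ℚ , 0ℚ , refl , side-c0 z
    go (no _)  (yes w) = 0ℚ , 1ℚ , refl , side-d0 w
    go (no z) (no w) with ℤP.<-cmp 0ℤ (c M ℤ.* d M)
    ... | tri< p _ _ = 0ℚ , 0ℚ , refl , side-pos p
    ... | tri> _ _ p = 1ℚ , 1ℚ , refl , side-neg (ℤP.neg-mono-< p)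
    ... | tri≈ _ e _ = ⊥-elim (product≢0 (ℤP.i*j≡0⇒i≡0∨j≡0 (c M) (sym e)))
      where
      product≢0 : (c M ≡ 0ℤ) ⊎ (d M ≡ 0ℤ) → ⊥
      product≢0 (inj₁ p) = z p
      product≢0 (inj₂ p) = w p

-- Sums over -K ≤ k < K

window : ℕ → (ℤ → ℚ) → ℚ
window zero    f = 0ℚ
window (suc K) f = window K f ℚ.+ (f (+ K) ℚ.+ f -[1+ K ])

window-cong : ∀ {f g} → (∀ k → f k ≡ g k) → ∀ K → window K f ≡ window K g
window-cong e zero    = refl
window-cong e (suc K) = cong₂ ℚ._+_ (window-cong e K) (cong₂ ℚ._+_ (e (+ K)) (e -[1+ K ]))

window-telescope : ∀ (F : ℤ → ℚ) K → window K (λ k → F (1ℤ ℤ.+ k) ℚ.- F k) ≡ F (+ K) ℚ.- F (ℤ.- + K)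
window-telescope F zero    = sym (ℚP.+-inverseʳ (F 0ℤ))
window-telescope F (suc K) = trans
  (cong₂ (λ x y → x ℚ.+ ((F (+ suc K) ℚ.- F (+ K)) ℚ.+ (F y ℚ.- F -[1+ K ])))
         (window-telescope F K) (next K))
  (lem (F (+ suc K)) (F (+ K)) (F (ℤ.- + K)) (F -[1+ K ]))
  where
  next : ∀ K → 1ℤ ℤ.+ -[1+ K ] ≡ ℤ.- + K
  next zero    = refl
  next (suc K) = refl
  lem : ∀ x y z w → (y ℚ.- z) ℚ.+ ((x ℚ.- y) ℚ.+ (z ℚ.- w)) ≡ x ℚ.- w
  lem = solve-∀ ringℚ

ev-window : ∀ (f : ℤ → Mat → ℚ) K ξ → ev (λ N → window K (λ k → f k N)) ξ ≡ window K (λ k → ev (f k) ξ)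
ev-window f zero    ξ = ev-0 ξ
ev-window f (suc K) ξ = trans (ev-+h _ _ ξ)
  (cong₂ ℚ._+_ (ev-window f K ξ) (ev-+h (f (+ K)) (f -[1+ K ]) ξ))

i<1+i : ∀ i → i ℤ.< 1ℤ ℤ.+ i
i<1+i i = ℤP.suc[i]≤j⇒i<j ℤP.≤-refl

-- Writes a point mass as a difference of step functions, so that `window-telescope` sums it.
indicator-step : ∀ j k → 𝟙 (j ℤP.≟ k) ≡ 𝟙 (j ℤP.<? 1ℤ ℤ.+ k) ℚ.- 𝟙 (j ℤP.<? k)
indicator-step j k with ℤP.<-cmp j k
... | tri< l ≢ _ = trans (𝟙-no (j ℤP.≟ k) ≢)
  (sym (cong₂ ℚ._-_ (𝟙-yes (j ℤP.<? 1ℤ ℤ.+ k) (ℤP.<-trans l (i<1+i k))) (𝟙-yes (j ℤP.<? k) l)))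
... | tri≈ ≮ refl _ = trans (𝟙-yes (j ℤP.≟ k) refl)
  (sym (cong₂ ℚ._-_ (𝟙-yes (j ℤP.<? 1ℤ ℤ.+ k) (i<1+i k)) (𝟙-no (j ℤP.<? k) ≮)))
... | tri> ≮ ≢ g = trans (𝟙-no (j ℤP.≟ k) ≢)
  (sym (cong₂ ℚ._-_ (𝟙-no (j ℤP.<? 1ℤ ℤ.+ k)
    (λ l → ℤP.<-irrefl refl (ℤP.<-≤-trans l (ℤP.i<j⇒suc[i]≤j g)))) (𝟙-no (j ℤP.<? k) ≮)))

χ : Mat → Mat → ℚ
χ M N = 𝟙 (LT? M N)

-- At most one shift k carries M to N, and it lies in the window as soon as K exceeds |k|.
window-orbit : ∀ M N → Eventually (λ K → χ M N ≡ window K (λ k → 𝟙 (≃-dec (Tᵏ k ∙ M) N)))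
window-orbit M N = go (LT? M N)
  where
  go : (p : Dec (LT M N)) → Eventually (λ K → 𝟙 p ≡ window K (λ k → 𝟙 (≃-dec (Tᵏ k ∙ M) N)))
  go (no ¬p) = 0 , λ K _ → sym (trans
    (window-cong {g = λ _ → 0ℚ ℚ.- 0ℚ} (λ k → 𝟙-no (≃-dec (Tᵏ k ∙ M) N) (λ e → ¬p (translate k (≃-sym e)))) K)
    (window-telescope (λ _ → 0ℚ) K))
  go (yes (translate j r)) = suc ∣ j ∣ , λ K l → sym (trans
    (window-cong (λ k → trans
      (𝟙-cong (≃-dec (Tᵏ k ∙ M) N) (j ℤP.≟ k)
        (λ e → Tᵏ-injective M (≃-trans (≃-sym r) (≃-sym e)))
        (λ { refl → ≃-sym r }))
      (indicator-step j k)) K)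
    (trans (window-telescope (λ k → 𝟙 (j ℤP.<? k)) K)
      (cong₂ ℚ._-_ (𝟙-yes (j ℤP.<? + K) (upper K l)) (𝟙-no (j ℤP.<? ℤ.- + K) (lower K l)))))
    where
    upper : ∀ {j} K → ∣ j ∣ ℕ.< K → j ℤ.< + K
    upper {+ n}      K l = ℤ.+<+ l
    upper { -[1+ n ]} K l = ℤ.-<+
    lower : ∀ {j} K → ∣ j ∣ ℕ.< K → ¬ (j ℤ.< ℤ.- + K)
    lower {+ n}      (suc K) l         ()
    lower { -[1+ n ]} (suc K) (ℕ.s≤s l) (ℤ.-<- p) = ℕP.<-asym p l

ev-1-g : ∀ {h} g → Inv h → ∀ ξ → ev h ((one - [ g ]) * ξ) ≡ ev h ξ ℚ.- ev (h ∘ (g ∙_)) ξ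
ev-1-g {h} g inv ξ = trans (ev-∙ h (one - [ g ]) ξ)
  (trans (lem (ev (h ∘ (Imat ∙_)) ξ) (ev (h ∘ (g ∙_)) ξ))
         (cong (ℚ._- ev (h ∘ (g ∙_)) ξ) (ev-cong (λ N → inv (∙-identityˡ N)) ξ)))
  where
  lem : ∀ x y → 1ℚ ℚ.* x ℚ.+ (((ℚ.- 1ℚ) ℚ.* 1ℚ) ℚ.* y ℚ.+ 0ℚ) ≡ x ℚ.- y
  lem = solve-∀ ringℚ

ev-1-gʳ : ∀ {h} g → Inv h → ∀ ξ → ev h (ξ * (one - [ g ])) ≡ ev h ξ ℚ.- ev (λ M → h (M ∙ g)) ξ
ev-1-gʳ {h} g inv ξ = trans (ev-∙ h ξ (one - [ g ]))
  (trans (ev-cong (λ M → trans (lem (h (M ∙ Imat)) (h (M ∙ g)))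
           (cong (ℚ._+ (ℚ.- 1ℚ) ℚ.* h (M ∙ g)) (inv (∙-identityʳ M)))) ξ)
  (trans (ev-+h h (λ M → (ℚ.- 1ℚ) ℚ.* h (M ∙ g)) ξ)
         (cong (ev h ξ ℚ.+_) (trans (ev-⋆h (ℚ.- 1ℚ) (λ M → h (M ∙ g)) ξ) (lem' (ev (λ M → h (M ∙ g)) ξ))))))
  where
  lem : ∀ x y → 1ℚ ℚ.* x ℚ.+ (((ℚ.- 1ℚ) ℚ.* 1ℚ) ℚ.* y ℚ.+ 0ℚ) ≡ x ℚ.+ (ℚ.- 1ℚ) ℚ.* y
  lem = solve-∀ ringℚ
  lem' : ∀ x → (ℚ.- 1ℚ) ℚ.* x ≡ ℚ.- x
  lem' = solve-∀ ringℚ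

χ-inv : ∀ M → Inv (χ M)
χ-inv M {N} {N'} r = 𝟙-cong (LT? M N) (LT? M N') (LT-resp r) (LT-resp (≃-sym r))

T-∙Tᵏ : ∀ k M → Tmat ∙ (Tᵏ k ∙ M) ≃ Tᵏ (1ℤ ℤ.+ k) ∙ M
T-∙Tᵏ k M = ≃-trans (∙-congʳ (Tᵏ k ∙ M) (≃-sym T¹≃T)) (Tᵏ-∙∙ 1ℤ k M)

-- Sums of (1 - S)ξ over ⟨T⟩-orbits

module OrbitSums (δ : Mat) (ξ : R) (ξ𝓑 : In𝓑 ξ) where

  private
    ζ : R
    ζ = (one - [ Smat ]) * ξ

    β : ℚ
    β = ev (φ δ) ξ

  ev-hU : ∀ M → ev (hU M) ζ ≡ 0ℚ
  ev-hU M = trans (ev-1-g Smat (hU-inv M) ξ)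
    (trans (cong (λ x → ev (hU M) ξ ℚ.- x) (𝓑-leftS {hU M} ξ ξ𝓑 (hU-inv M) (hU-∙U M)))
           (ℚP.+-inverseʳ (ev (hU M) ξ)))

  -- Translation by T turns the value of hS for M_k at SN into that for M_(k+1) at TSN = UN, because
  -- T = US; right S-invariance then removes the U.
  ev-hS : ∀ k M → ev (hS (Tᵏ k ∙ M)) ζ ≡ ev (hS (Tᵏ k ∙ M)) ξ ℚ.- ev (hS (Tᵏ (1ℤ ℤ.+ k) ∙ M)) ξ
  ev-hS k M = trans (ev-1-g Smat (hS-resp ≃-refl) ξ)
    (cong (λ x → ev (hS (Tᵏ k ∙ M)) ξ ℚ.- x)
      (trans (ev-cong transport ξ)
        (𝓑-leftU {hS (Tᵏ (1ℤ ℤ.+ k) ∙ M)} ξ ξ𝓑 (hS-resp ≃-refl) (hS-∙S (Tᵏ (1ℤ ℤ.+ k) ∙ M)))))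
    where
    TS≃U : ∀ N → Tmat ∙ (Smat ∙ N) ≃ Umat ∙ N
    TS≃U N = ≃-trans (∙-congʳ (Smat ∙ N) (≃-sym US≃T))
      (≃-trans (∙-assoc Umat Smat (Smat ∙ N)) (∙-congˡ Umat (SS-∙ N)))
    transport : ∀ N → hS (Tᵏ k ∙ M) (Smat ∙ N) ≡ hS (Tᵏ (1ℤ ℤ.+ k) ∙ M) (Umat ∙ N)
    transport N = trans (sym (hS-∙ˡ (Tᵏ k ∙ M) (Smat ∙ N) Γ-T)) (hS-resp (T-∙Tᵏ k M) (TS≃U N))

  -- The point mass is hU - hS by `hU-hS`, and hU pairs to zero with (1 - S)ξ because it is right
  -- U-invariant.
  ev-point : ∀ k M → ev (λ N → 𝟙 (≃-dec (Tᵏ k ∙ M) N)) ζ ≡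
             ev (hS (Tᵏ (1ℤ ℤ.+ k) ∙ M)) ξ ℚ.- ev (hS (Tᵏ k ∙ M)) ξ
  ev-point k M = solved (ev (hS (Tᵏ k ∙ M)) ζ) p (ev (hS (Tᵏ k ∙ M)) ξ) (ev (hS (Tᵏ (1ℤ ℤ.+ k) ∙ M)) ξ)
    balance (ev-hS k M)
    where
    p : ℚ
    p = ev (λ N → 𝟙 (≃-dec (Tᵏ k ∙ M) N)) ζ
    balance : 0ℚ ≡ ev (hS (Tᵏ k ∙ M)) ζ ℚ.+ p
    balance = trans (sym (ev-hU (Tᵏ k ∙ M))) (trans (ev-cong (hU-hS (Tᵏ k ∙ M)) ζ)
      (ev-+h (hS (Tᵏ k ∙ M)) (λ N → 𝟙 (≃-dec (Tᵏ k ∙ M) N)) ζ))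
    solved : ∀ z p x y → 0ℚ ≡ z ℚ.+ p → z ≡ x ℚ.- y → p ≡ y ℚ.- x
    solved z p x y e refl = trans (lem p x y) (trans (cong (ℚ._+ (y ℚ.- x)) (sym e)) (ℚP.+-identityˡ _))
      where
      lem : ∀ p x y → p ≡ ((x ℚ.- y) ℚ.+ p) ℚ.+ (y ℚ.- x)
      lem = solve-∀ ringℚ

  -- Far out in the orbit the half-plane indicator is the constant σ on the matrices of ξ, which
  -- leaves σ times a coset sum.
  end : ∀ M k → Δ∋ δ M → ∀ σ →
        ev (hS (Tᵏ k ∙ M)) ξ ≡ ev (λ N → σ ℚ.* φ (Tᵏ k ∙ M) N) ξ → ev (hS (Tᵏ k ∙ M)) ξ ≡ σ ℚ.* β
  end M k M∈Δ σ e = trans e (trans (ev-⋆h σ (φ (Tᵏ k ∙ M)) ξ)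
    (cong (σ ℚ.*_) (coset-sum ξ ξ𝓑 (Δ-∙ˡ (Γ-Tᵏ k) M∈Δ))))

  orbit-sum : ∀ {M} → Δ∋ δ M → ev (χ M) ζ ≡ (ℚ.- β) ℚ.* cusp M
  orbit-sum {M} M∈Δ = go (sides M)
    where
    F : ℤ → ℚ
    F k = ev (hS (Tᵏ k ∙ M)) ξ
    Value : ℤ → ℚ → Set
    Value k σ = ev (hS (Tᵏ k ∙ M)) ξ ≡ ev (λ N → σ ℚ.* φ (Tᵏ k ∙ M) N) ξ
    point : ∀ σ k N → 𝟙 (reS>0? (adj (Tᵏ k ∙ M) ∙ N)) ≡ σ → hS (Tᵏ k ∙ M) N ≡ σ ℚ.* φ (Tᵏ k ∙ M) N
    point σ k N e = trans (cong (φ (Tᵏ k ∙ M) N ℚ.*_) e) (ℚP.*-comm (φ (Tᵏ k ∙ M) N) σ)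
    lem : ∀ x y b → y ℚ.* b ℚ.- x ℚ.* b ≡ (ℚ.- b) ℚ.* (x ℚ.- y)
    lem = solve-∀ ringℚ
    go : (Σ ℚ λ σ⁻ → Σ ℚ λ σ⁺ → (σ⁻ ℚ.- σ⁺ ≡ cusp M) × (∀ N → Eventually λ K →
           (𝟙 (reS>0? (adj (Tᵏ (+ K) ∙ M) ∙ N)) ≡ σ⁺) × (𝟙 (reS>0? (adj (Tᵏ (ℤ.- + K) ∙ M) ∙ N)) ≡ σ⁻))) →
         ev (χ M) ζ ≡ (ℚ.- β) ℚ.* cusp M
    go (σ⁻ , σ⁺ , σ≡ , limit) = finish
      ((eventually-ev (window-orbit M) ζ)
        and ((eventually-ev (λ N → eventually-map (λ K p → point σ⁺ (+ K) N (proj₁ p)) (limit N)) ξ)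
        and (eventually-ev (λ N → eventually-map (λ K p → point σ⁻ (ℤ.- + K) N (proj₂ p)) (limit N)) ξ)))
      where
      open ≡-Reasoning
      finish : Eventually (λ K → (ev (χ M) ζ ≡ ev (λ N → window K (λ k → 𝟙 (≃-dec (Tᵏ k ∙ M) N))) ζ)
                 × (Value (+ K) σ⁺ × Value (ℤ.- + K) σ⁻)) → ev (χ M) ζ ≡ (ℚ.- β) ℚ.* cusp M
      finish (K , p) with p K ℕP.≤-refl
      ... | total , top , bottom = begin
        ev (χ M) ζ                                              ≡⟨ total ⟩
        ev (λ N → window K (λ k → 𝟙 (≃-dec (Tᵏ k ∙ M) N))) ζ    ≡⟨ ev-window (λ k N → 𝟙 (≃-dec (Tᵏ k ∙ M) N)) K ζ ⟩
        window K (λ k → ev (λ N → 𝟙 (≃-dec (Tᵏ k ∙ M) N)) ζ)    ≡⟨ window-cong (λ k → ev-point k M) K ⟩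
        window K (λ k → F (1ℤ ℤ.+ k) ℚ.- F k)                   ≡⟨ window-telescope F K ⟩
        F (+ K) ℚ.- F (ℤ.- + K)                                 ≡⟨ cong₂ ℚ._-_ (end M (+ K) M∈Δ σ⁺ top) (end M (ℤ.- + K) M∈Δ σ⁻ bottom) ⟩
        σ⁺ ℚ.* β ℚ.- σ⁻ ℚ.* β                                   ≡⟨ lem σ⁻ σ⁺ β ⟩
        (ℚ.- β) ℚ.* (σ⁻ ℚ.- σ⁺)                                 ≡⟨ cong ((ℚ.- β) ℚ.*_) σ≡ ⟩
        (ℚ.- β) ℚ.* cusp M                                      ∎

-- T^∞

opaque
  unfolding _∙_

  c-∙ : ∀ M N → c (M ∙ N) ≡ c M ℤ.* a N ℤ.+ d M ℤ.* c N
  c-∙ M N = refl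

  c-∙S : ∀ M → c (M ∙ Smat) ≡ d M
  c-∙S M = lem (c M) (d M)
    where
    lem : ∀ z w → z ℤ.* 0ℤ ℤ.+ w ℤ.* 1ℤ ≡ w
    lem = ℤSolver.solve-∀

  c-Tᵏ∙ : ∀ k M → c (Tᵏ k ∙ M) ≡ c M
  c-Tᵏ∙ k M = lem (a M) (c M)
    where
    lem : ∀ x z → 0ℤ ℤ.* x ℤ.+ 1ℤ ℤ.* z ≡ z
    lem = ℤSolver.solve-∀

c0-resp : ∀ {M N} → M ≃ N → c N ≡ 0ℤ → c M ≡ 0ℤ
c0-resp (up-to-sign (inj₁ (_ , _ , e , _))) p = trans e p
c0-resp (up-to-sign (inj₂ (_ , _ , e , _))) p = trans e (cong ℤ.-_ p)

LT-c0 : ∀ {M N} → LT M N → c N ≡ 0ℤ → c M ≡ 0ℤ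
LT-c0 {M} (translate k r) p = trans (sym (c-Tᵏ∙ k M)) (c0-resp (≃-sym r) p)

a≢0 : ∀ M → c M ≡ 0ℤ → a M ≢ 0ℤ
a≢0 M c≡0 a≡0 = det≢0 M (trans (cong₂ (λ x z → x ℤ.* d M ℤ.- b M ℤ.* z) a≡0 c≡0) (lem (b M) (d M)))
  where
  lem : ∀ y w → 0ℤ ℤ.* w ℤ.- y ℤ.* 0ℤ ≡ 0ℤ
  lem = ℤSolver.solve-∀

-- M and N both fix ∞, hence so does g, which is therefore ±T^k.
upper-triangular : ∀ {g M N} → Γ∋ g → N ≃ g ∙ M → c M ≡ 0ℤ → c N ≡ 0ℤ → LT M N
upper-triangular {g} {M} {N} gΓ r cM cN = go (unipotent g gΓ cg≡0)
  where
  product : c g ℤ.* a M ≡ 0ℤ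
  product = trans (lem (c g) (a M) (d g)) (trans (cong (λ z → c g ℤ.* a M ℤ.+ d g ℤ.* z) (sym cM))
    (trans (sym (c-∙ g M)) (c0-resp (≃-sym r) cN)))
    where
    lem : ∀ x y w → x ℤ.* y ≡ x ℤ.* y ℤ.+ w ℤ.* 0ℤ
    lem = ℤSolver.solve-∀
  split : (c g ≡ 0ℤ) ⊎ (a M ≡ 0ℤ) → c g ≡ 0ℤ
  split (inj₁ p) = p
  split (inj₂ p) = ⊥-elim (a≢0 M cM p)
  cg≡0 : c g ≡ 0ℤ
  cg≡0 = split (ℤP.i*j≡0⇒i≡0∨j≡0 (c g) product)
  go : (Σ ℤ λ k → g ≃ Tᵏ k) → LT M N
  go (k , s) = translate k (≃-trans r (∙-congʳ M s))

opaque
  unfolding _∙_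

  to-left : ∀ {M N} → InLeftCoset M N → Σ Mat λ g → Γ∋ g × N ≃ g ∙ M
  to-left (g , p , r) = g , unimodular p , up-to-sign r

  from-left : ∀ {M N} g → Γ∋ g → N ≃ g ∙ M → InLeftCoset M N
  from-left g (unimodular p) (up-to-sign r) = g , p , r

LT-cusp : ∀ {M N} → LT M N → InLeftCoset M N
LT-cusp (translate k r) = from-left (Tᵏ k) (Γ-Tᵏ k) r

module _ {δ : Mat} where

  Tinf-none : ∀ M L → All (λ N → ¬ LT M N) L → ev (χ M) (Tinf L) ≡ 0ℚ
  Tinf-none M []      []       = refl
  Tinf-none M (N ∷ L) (p ∷ ps) = trans
    (cong₂ (λ x y → 1ℚ ℚ.* x ℚ.+ y) (𝟙-no (LT? M N) p) (Tinf-none M L ps)) refl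

  -- For matrices with c = 0, lying in one left coset and lying in one ⟨T⟩-orbit are the same, so
  -- exactly one listed representative meets the orbit of M.
  Tinf-one : ∀ {M} L → c M ≡ 0ℤ → All (λ N → InΔ δ N × c N ≡ 0ℤ) L →
    AllPairs (λ N N' → ¬ InLeftCoset N N') L → Any (λ N → InLeftCoset N M) L →
    ev (χ M) (Tinf L) ≡ 1ℚ
  Tinf-one {M} (N ∷ L) cM ((_ , cN) ∷ _) (distinct ∷ _) (here left) = go (to-left left)
    where
    go : (Σ Mat λ g → Γ∋ g × M ≃ g ∙ N) → ev (χ M) (Tinf (N ∷ L)) ≡ 1ℚ
    go (g , gΓ , r) = trans (cong₂ (λ x y → 1ℚ ℚ.* x ℚ.+ y)
      (𝟙-yes (LT? M N) (LT-sym N∼M))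
      (Tinf-none M L (All.map (λ N≁N' M∼N' → N≁N' (LT-cusp (LT-trans N∼M M∼N'))) distinct))) refl
      where
      N∼M : LT N M
      N∼M = upper-triangular gΓ r cN cM
  Tinf-one {M} (N ∷ L) cM (_ ∷ tri) (distinct ∷ pairs) (there any) = trans (cong₂ (λ x y → 1ℚ ℚ.* x ℚ.+ y)
      (𝟙-no (LT? M N) (λ M∼N → clash (LT-sym M∼N) distinct any)) (Tinf-one L cM tri pairs any)) refl
    where
    clash : LT N M → ∀ {L} → All (λ N' → ¬ InLeftCoset N N') L → Any (λ N' → InLeftCoset N' M) L → ⊥
    clash N∼M (_∷_ {x = N'} N≁N' _) (here left) = go (to-left left) N∼M
      where
      go : (Σ Mat λ g → Γ∋ g × M ≃ g ∙ N') → LT N M → ⊥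
      go (g , gΓ , r) (translate k s) = N≁N' (from-left (adj g ∙ Tᵏ k) (Γ-∙ (Γ-adj gΓ) (Γ-Tᵏ k))
        (≃-trans (≃-sym (cancelˡ N' gΓ)) (≃-trans (∙-congˡ (adj g) (≃-trans (≃-sym r) s))
          (≃-sym (∙-assoc (adj g) (Tᵏ k) N)))))
    clash N∼M (_ ∷ ds) (there any) = clash N∼M ds any

χ-∙S : ∀ M N → χ M (N ∙ Smat) ≡ χ (M ∙ Smat) N
χ-∙S M N = 𝟙-cong (LT? M (N ∙ Smat)) (LT? (M ∙ Smat) N) to from
  where
  ∙SS : ∀ X → (X ∙ Smat) ∙ Smat ≃ X
  ∙SS X = ≃-trans (∙-assoc X Smat Smat) (≃-trans (∙-congˡ X SS≃I) (∙-identityʳ X))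
  to : LT M (N ∙ Smat) → LT (M ∙ Smat) N
  to (translate k r) = translate k
    (≃-trans (≃-sym (∙SS N)) (≃-trans (∙-congʳ Smat r) (∙-assoc (Tᵏ k) M Smat)))
  from : LT (M ∙ Smat) N → LT M (N ∙ Smat)
  from (translate k r) = translate k (≃-trans (∙-congʳ Smat r)
    (≃-trans (∙-assoc (Tᵏ k) (M ∙ Smat) Smat) (∙-congˡ (Tᵏ k) (∙SS M))))

module _ {δ : Mat} {L : List Mat} (reps : IsRepsInfty δ L) where

  Tinf-orbit-sum : ∀ {M} → Δ∋ δ M → ev (χ M) (Tinf L) ≡ 𝟙 (c M ℤP.≟ 0ℤ)
  Tinf-orbit-sum {M} M∈Δ = go (c M ℤP.≟ 0ℤ) reps
    where
    go : (p : Dec (c M ≡ 0ℤ)) → IsRepsInfty δ L → ev (χ M) (Tinf L) ≡ 𝟙 p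
    go (yes cM) (tri , distinct , cover) = Tinf-one {δ} L cM tri distinct (cover M (from-Δ M∈Δ))
    go (no cM) (tri , _) = Tinf-none {δ} M L (All.map (λ (_ , cN) M∼N → cM (LT-c0 M∼N cN)) tri)

  -- Right multiplication by S commutes with left translation and brings d into the lower-left
  -- corner, so the second term counts d = 0.
  Tinf-1-S-orbit-sum : ∀ {M} → Δ∋ δ M → ev (χ M) (Tinf L * (one - [ Smat ])) ≡ cusp M
  Tinf-1-S-orbit-sum {M} M∈Δ = trans (ev-1-gʳ Smat (χ-inv M) (Tinf L))
    (cong₂ ℚ._-_ (Tinf-orbit-sum M∈Δ)
      (trans (ev-cong (χ-∙S M) (Tinf L))
        (trans (Tinf-orbit-sum (Δ-∙ʳ Γ-S M∈Δ))
          (cong (λ z → 𝟙 (z ℤP.≟ 0ℤ)) (c-∙S M)))))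

-- Supports

Supp : (Mat → Set) → R → Set
Supp P = All (P ∘ proj₂)

Supp-⋆ : ∀ {P} q ξ → Supp P ξ → Supp P (q ⋆ ξ)
Supp-⋆ q []      []       = []
Supp-⋆ q (_ ∷ ξ) (p ∷ ps) = p ∷ Supp-⋆ q ξ ps

Supp-- : ∀ {P ξ η} → Supp P ξ → Supp P η → Supp P (ξ - η)
Supp-- {η = η} ps qs = AllP.++⁺ ps (Supp-⋆ (ℚ.- 1ℚ) η qs)

opaque
  unfolding _∙_

  Supp-* : ∀ {P Q S : Mat → Set} → (∀ {M N} → P M → Q N → S (M ∙ N)) →
           ∀ ξ η → Supp P ξ → Supp Q η → Supp S (ξ * η)
  Supp-* f []            η []       qs = []
  Supp-* {P} {Q} {S} f ((r , M) ∷ ξ) η (p ∷ ps) qs =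
    AllP.++⁺ (row _ (λ _ _ → refl) η qs) (Supp-* {P} {Q} {S} f ξ η ps qs)
    where
    row : ∀ g → (∀ q N → g (q , N) ≡ (r ℚ.* q , M · N)) → ∀ η → Supp Q η → Supp S (map g η)
    row g e []            []       = []
    row g e ((q , N) ∷ η) (x ∷ xs) = subst (S ∘ proj₂) (sym (e q N)) (f p x) ∷ row g e η xs

coeff-resp : ∀ ξ {M N} → M ≃ N → coeff ξ M ≡ coeff ξ N
coeff-resp ξ {M} {N} r = trans (coeff-ev ξ M) (trans
  (ev-cong (λ X → 𝟙-cong (≃-dec X M) (≃-dec X N) (λ e → ≃-trans e r) (λ e → ≃-trans e (≃-sym r))) ξ)
  (sym (coeff-ev ξ N)))

Supp⇒In𝓡Δ : ∀ {δ} ξ → Supp (Δ∋ δ) ξ → In𝓡Δ δ ξ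
Supp⇒In𝓡Δ []            []       M nz = ⊥-elim (nz refl)
Supp⇒In𝓡Δ {δ} ((q , N) ∷ ξ) (p ∷ ps) M nz = go (≃-dec N M) refl
  where
  go : (r : Dec (N ≃ M)) → does r ≡ (N ≟± M) → InΔ δ M
  go (yes r) _ = from-Δ (Δ-resp (≃-sym r) p)
  go (no _)  e = Supp⇒In𝓡Δ ξ ps M λ z → nz (trans
    (cong (λ b → (if b then q else 0ℚ) ℚ.+ coeff ξ M) (sym e)) (trans (ℚP.+-identityˡ _) z))

-- A list for an element of 𝓡_Δ may mention matrices outside Δ whose weights cancel, whereas
-- `collapse` asks for every listed matrix to lie in Δ. Dropping the entries of total coefficient
-- zero is decidable and leaves the element unchanged.
supported : ∀ {δ} ξ → In𝓡Δ δ ξ → Σ R λ ξ' → Supp (Δ∋ δ) ξ' × ξ ≋ ξ'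
supported {δ} ξ ξΔ = filter keep? ξ ,
  All.map (λ {t} nz → to-Δ (ξΔ (proj₂ t) nz)) (AllP.all-filter keep? ξ) ,
  ≈⇒≋ {ξ} {filter keep? ξ} same
  where
  nonzero? : ∀ M → Dec (coeff ξ M ≢ 0ℚ)
  nonzero? M = ¬? (coeff ξ M ℚP.≟ 0ℚ)
  keep? : ∀ (t : ℚ × Mat) → Dec (coeff ξ (proj₂ t) ≢ 0ℚ)
  keep? t = nonzero? (proj₂ t)
  ev-filter : ∀ h ζ → ev h (filter keep? ζ) ≡ ev (λ N → 𝟙 (nonzero? N) ℚ.* h N) ζ
  ev-filter h [] = refl
  ev-filter h ((q , N) ∷ ζ) with coeff ξ N ℚP.≟ 0ℚ
  ... | no _  = cong₂ (λ x y → q ℚ.* x ℚ.+ y) (sym (ℚP.*-identityˡ (h N))) (ev-filter h ζ)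
  ... | yes _ = trans (ev-filter h ζ) (lem q (h N) _)
    where
    lem : ∀ q x y → y ≡ q ℚ.* (0ℚ ℚ.* x) ℚ.+ y
    lem = solve-∀ ringℚ
  mask : ∀ M → 𝟙 (nonzero? M) ℚ.* coeff ξ M ≡ coeff ξ M
  mask M with coeff ξ M ℚP.≟ 0ℚ
  ... | yes e = trans (ℚP.*-zeroˡ (coeff ξ M)) (sym e)
  ... | no _  = ℚP.*-identityˡ (coeff ξ M)
  at : ∀ M N → 𝟙 (nonzero? N) ℚ.* 𝟙 (≃-dec N M) ≡ 𝟙 (nonzero? M) ℚ.* 𝟙 (≃-dec N M)
  at M N = go (≃-dec N M)
    where
    go : (p : Dec (N ≃ M)) → 𝟙 (nonzero? N) ℚ.* 𝟙 p ≡ 𝟙 (nonzero? M) ℚ.* 𝟙 p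
    go (yes r) = cong (λ x → 𝟙 (¬? (x ℚP.≟ 0ℚ)) ℚ.* 1ℚ) (coeff-resp ξ r)
    go (no _)  = trans (ℚP.*-zeroʳ (𝟙 (nonzero? N))) (sym (ℚP.*-zeroʳ (𝟙 (nonzero? M))))
  same : ξ ≈ filter keep? ξ
  same M = sym (begin
    coeff (filter keep? ξ) M                              ≡⟨ coeff-ev (filter keep? ξ) M ⟩
    ev (λ N → 𝟙 (≃-dec N M)) (filter keep? ξ)             ≡⟨ ev-filter (λ N → 𝟙 (≃-dec N M)) ξ ⟩
    ev (λ N → 𝟙 (nonzero? N) ℚ.* 𝟙 (≃-dec N M)) ξ         ≡⟨ ev-cong (at M) ξ ⟩
    ev (λ N → 𝟙 (nonzero? M) ℚ.* 𝟙 (≃-dec N M)) ξ         ≡⟨ ev-⋆h (𝟙 (nonzero? M)) (λ N → 𝟙 (≃-dec N M)) ξ ⟩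
    𝟙 (nonzero? M) ℚ.* ev (λ N → 𝟙 (≃-dec N M)) ξ         ≡⟨ cong (𝟙 (nonzero? M) ℚ.*_) (sym (coeff-ev ξ M)) ⟩
    𝟙 (nonzero? M) ℚ.* coeff ξ M                          ≡⟨ mask M ⟩
    coeff ξ M                                             ∎)
    where open ≡-Reasoning

-- Orbit sums and (1 − T)𝓡_Δ

module _ (δ : Mat) where

  private
    J : R → Set
    J ω = Σ R λ η → Supp (Δ∋ δ) η × ω ≋ (one - [ Tmat ]) * η

    J-resp : ∀ ω ω' → ω ≋ ω' → J ω → J ω'
    J-resp _ _ e (η , s , f) = η , s , λ h inv → trans (sym (e h inv)) (f h inv)

    J-0 : J []
    J-0 = [] , [] , λ h inv → sym (ev-1-g Tmat inv [])

    J-+ : ∀ {ω ω'} → J ω → J ω' → J (ω + ω')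
    J-+ {ω} {ω'} (η , s , f) (η' , s' , f') = η + η' , AllP.++⁺ s s' , λ h inv → begin
      ev h (ω + ω')                                    ≡⟨ ev-++ h ω ω' ⟩
      ev h ω ℚ.+ ev h ω'                               ≡⟨ cong₂ ℚ._+_ (trans (f h inv) (ev-1-g Tmat inv η))
                                                                      (trans (f' h inv) (ev-1-g Tmat inv η')) ⟩
      (ev h η ℚ.- ev (h ∘ (Tmat ∙_)) η) ℚ.+ (ev h η' ℚ.- ev (h ∘ (Tmat ∙_)) η')
        ≡⟨ lem (ev h η) (ev (h ∘ (Tmat ∙_)) η) (ev h η') (ev (h ∘ (Tmat ∙_)) η') ⟩
      (ev h η ℚ.+ ev h η') ℚ.- (ev (h ∘ (Tmat ∙_)) η ℚ.+ ev (h ∘ (Tmat ∙_)) η')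
        ≡⟨ sym (cong₂ ℚ._-_ (ev-++ h η η') (ev-++ (h ∘ (Tmat ∙_)) η η')) ⟩
      ev h (η + η') ℚ.- ev (h ∘ (Tmat ∙_)) (η + η')    ≡⟨ sym (ev-1-g Tmat inv (η + η')) ⟩
      ev h ((one - [ Tmat ]) * (η + η'))               ∎
      where
      open ≡-Reasoning
      lem : ∀ x y z w → (x ℚ.- y) ℚ.+ (z ℚ.- w) ≡ (x ℚ.+ z) ℚ.- (y ℚ.+ w)
      lem = solve-∀ ringℚ

    ev-diff : ∀ h q M N → ev h (q ⋆ ([ N ] - [ M ])) ≡ q ℚ.* (h N ℚ.- h M)
    ev-diff h q M N = lem q (h N) (h M)
      where
      lem : ∀ q x y → (q ℚ.* 1ℚ) ℚ.* x ℚ.+ ((q ℚ.* ((ℚ.- 1ℚ) ℚ.* 1ℚ)) ℚ.* y ℚ.+ 0ℚ) ≡ q ℚ.* (x ℚ.- y)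
      lem = solve-∀ ringℚ

    J-diff : ∀ ω q M N → (∀ h → Inv h → ev h ω ≡ q ℚ.* (h N ℚ.- h M)) → J (q ⋆ ([ N ] - [ M ])) → J ω
    J-diff ω q M N e = J-resp (q ⋆ ([ N ] - [ M ])) ω (λ h inv → trans (ev-diff h q M N) (sym (e h inv)))

    -- From TM - M = (1 - T)(-M).
    J-T : ∀ q {M} → Δ∋ δ M → J (q ⋆ ([ Tmat ∙ M ] - [ M ]))
    J-T q {M} M∈Δ = (ℚ.- q) ⋆ [ M ] , M∈Δ ∷ [] , λ h inv →
      trans (ev-diff h q M (Tmat ∙ M)) (trans (lem q (h (Tmat ∙ M)) (h M)) (sym (ev-1-g Tmat inv ((ℚ.- q) ⋆ [ M ]))))
      where
      lem : ∀ q x y → q ℚ.* (x ℚ.- y) ≡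
        (((ℚ.- q) ℚ.* 1ℚ) ℚ.* y ℚ.+ 0ℚ) ℚ.- (((ℚ.- q) ℚ.* 1ℚ) ℚ.* x ℚ.+ 0ℚ)
      lem = solve-∀ ringℚ

    J-Tᵏ : ∀ q n {M} → Δ∋ δ M → J (q ⋆ ([ Tᵏ (+ n) ∙ M ] - [ M ]))
    J-Tᵏ q zero    {M} M∈Δ = J-resp [] (q ⋆ ([ Tᵏ 0ℤ ∙ M ] - [ M ])) (λ h inv → sym (trans (ev-diff h q M (Tᵏ 0ℤ ∙ M))
      (trans (cong (λ x → q ℚ.* (x ℚ.- h M)) (inv (≃-trans (∙-congʳ M T⁰≃I) (∙-identityˡ M)))) (lem q (h M))))) J-0
      where
      lem : ∀ q x → q ℚ.* (x ℚ.- x) ≡ 0ℚ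
      lem = solve-∀ ringℚ
    J-Tᵏ q (suc n) {M} M∈Δ = J-resp (q ⋆ ([ Tmat ∙ M' ] - [ M' ]) + q ⋆ ([ M' ] - [ M ])) (q ⋆ ([ Tᵏ (+ suc n) ∙ M ] - [ M ]))
      (λ h inv →
        trans (ev-++ h (q ⋆ ([ Tmat ∙ M' ] - [ M' ])) (q ⋆ ([ M' ] - [ M ])))
        (trans (cong₂ ℚ._+_ (ev-diff h q M' (Tmat ∙ M')) (ev-diff h q M M'))
        (trans (lem q (h (Tmat ∙ M')) (h M') (h M))
        (trans (cong (λ x → q ℚ.* (x ℚ.- h M)) (inv (T-∙Tᵏ (+ n) M)))
               (sym (ev-diff h q M (Tᵏ (+ suc n) ∙ M)))))))
      (J-+ {q ⋆ ([ Tmat ∙ M' ] - [ M' ])} {q ⋆ ([ M' ] - [ M ])} (J-T q (Δ-∙ˡ (Γ-Tᵏ (+ n)) M∈Δ)) (J-Tᵏ q n M∈Δ))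
      where
      M' = Tᵏ (+ n) ∙ M
      lem : ∀ q x y z → q ℚ.* (x ℚ.- y) ℚ.+ q ℚ.* (y ℚ.- z) ≡ q ℚ.* (x ℚ.- z)
      lem = solve-∀ ringℚ

    J-gen : ∀ q {M N} → Δ∋ δ M → Δ∋ δ N → LT M N → J (q ⋆ ([ N ] - [ M ]))
    J-gen q {M} {N} M∈Δ N∈Δ (translate (+ n) r) = J-diff (q ⋆ ([ N ] - [ M ])) q M (Tᵏ (+ n) ∙ M)
      (λ h inv → trans (ev-diff h q M N) (cong (λ x → q ℚ.* (x ℚ.- h M)) (inv r))) (J-Tᵏ q n M∈Δ)
    -- A negative shift is reversed: q(N - M) = -q(M - N), and M is a positive translate of N.
    J-gen q {M} {N} M∈Δ N∈Δ s@(translate -[1+ n ] r) = back (LT-sym s) refl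
      where
      lem : ∀ q x y → q ℚ.* (x ℚ.- y) ≡ (ℚ.- q) ℚ.* (y ℚ.- x)
      lem = solve-∀ ringℚ
      back : (t : LT N M) → LT.shift t ≡ + suc n → J (q ⋆ ([ N ] - [ M ]))
      back (translate _ t) refl = J-diff (q ⋆ ([ N ] - [ M ])) (ℚ.- q) N (Tᵏ (+ suc n) ∙ N)
        (λ h inv → trans (ev-diff h q M N) (trans (lem q (h N) (h M))
          (cong (λ x → (ℚ.- q) ℚ.* (x ℚ.- h N)) (inv t)))) (J-Tᵏ (ℚ.- q) (suc n) N∈Δ)

  orbit-sums-zero : ∀ ω → Supp (Δ∋ δ) ω → (∀ M → Δ∋ δ M → ev (χ M) ω ≡ 0ℚ) →
                    Σ R λ η → Supp (Δ∋ δ) η × ω ≋ (one - [ Tmat ]) * η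
  orbit-sums-zero = Collapse.collapse LT LT? LT-refl LT-sym LT-trans (Δ∋ δ) J
    (λ {ω} {ω'} e → J-resp ω ω' (λ h _ → e h)) J-0 (λ {ω} {ω'} → J-+ {ω} {ω'}) J-gen

χ-T : ∀ M N → χ M (Tmat ∙ N) ≡ χ M N
χ-T M N = 𝟙-cong (LT? M (Tmat ∙ N)) (LT? M N) (λ s → LT-trans s (LT-sym step)) (λ s → LT-trans s step)
  where
  step : LT N (Tmat ∙ N)
  step = translate 1ℤ (∙-congʳ N (≃-sym T¹≃T))

-- Existence and uniqueness of α

module Alpha (δ : Mat) (ξ : R) (ξΔ : In𝓡Δ δ ξ) (ξ𝓑 : In𝓑 ξ)
             (L : List Mat) (reps : IsRepsInfty δ L) where

  private
    β : ℚ
    β = ev (φ δ) ξ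

  difference : R → ℚ → R
  difference ξ' α = (one - [ Smat ]) * ξ' - α ⋆ (Tinf L * (one - [ Smat ]))

  ev-difference : ∀ h ξ' α → ev h (difference ξ' α) ≡
    ev h ((one - [ Smat ]) * ξ') ℚ.- α ℚ.* ev h (Tinf L * (one - [ Smat ]))
  ev-difference h ξ' α = trans (ev-- h ((one - [ Smat ]) * ξ') (α ⋆ (Tinf L * (one - [ Smat ]))))
    (cong (λ x → ev h ((one - [ Smat ]) * ξ') ℚ.- x) (ev-⋆ h α (Tinf L * (one - [ Smat ]))))

  difference-sum : ∀ α {M} → Δ∋ δ M → ev (χ M) (difference ξ α) ≡ (ℚ.- β ℚ.- α) ℚ.* cusp M
  difference-sum α {M} M∈Δ = trans (ev-difference (χ M) ξ α)
    (trans (cong₂ (λ x y → x ℚ.- α ℚ.* y) (OrbitSums.orbit-sum δ ξ ξ𝓑 M∈Δ) (Tinf-1-S-orbit-sum reps M∈Δ))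
           (lem β α (cusp M)))
    where
    lem : ∀ b a x → (ℚ.- b) ℚ.* x ℚ.- a ℚ.* x ≡ (ℚ.- b ℚ.- a) ℚ.* x
    lem = solve-∀ ringℚ

  difference-resp : ∀ ξ' α → ξ ≋ ξ' → difference ξ α ≋ difference ξ' α
  difference-resp ξ' α e h inv = trans (ev-difference h ξ α)
    (trans (cong (ℚ._- α ℚ.* ev h (Tinf L * (one - [ Smat ])))
      (trans (ev-1-g Smat inv ξ)
        (trans (cong₂ ℚ._-_ (e h inv) (e (h ∘ (Smat ∙_)) (Inv-∙ Smat inv))) (sym (ev-1-g Smat inv ξ')))))
    (sym (ev-difference h ξ' α)))

  exists : IsAlpha δ L ξ (ℚ.- β)
  exists = go (supported ξ ξΔ)
    where
    Γ1-S : Supp Γ∋ (one - [ Smat ])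
    Γ1-S = Γ-I ∷ Γ-S ∷ []
    Tinf-Δ : ∀ {L} → All (λ N → InΔ δ N × c N ≡ 0ℤ) L → Supp (Δ∋ δ) (Tinf L)
    Tinf-Δ []            = []
    Tinf-Δ ((p , _) ∷ ps) = to-Δ p ∷ Tinf-Δ ps
    go : (Σ R λ ξ' → Supp (Δ∋ δ) ξ' × ξ ≋ ξ') → IsAlpha δ L ξ (ℚ.- β)
    go (ξ' , s , e) = finish (orbit-sums-zero δ (difference ξ' (ℚ.- β))
        (Supp-- (Supp-* {Γ∋} {Δ∋ δ} {Δ∋ δ} Δ-∙ˡ (one - [ Smat ]) ξ' Γ1-S s)
          (Supp-⋆ (ℚ.- β) (Tinf L * (one - [ Smat ]))
            (Supp-* {Δ∋ δ} {Γ∋} {Δ∋ δ} (λ p q → Δ-∙ʳ q p) (Tinf L) (one - [ Smat ]) (Tinf-Δ (proj₁ reps)) Γ1-S)))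
        (λ M M∈Δ → trans (sym (difference-resp ξ' (ℚ.- β) e (χ M) (χ-inv M)))
          (trans (difference-sum (ℚ.- β) M∈Δ) (lem β (cusp M)))))
      where
      lem : ∀ b x → (ℚ.- b ℚ.- (ℚ.- b)) ℚ.* x ≡ 0ℚ
      lem = solve-∀ ringℚ
      finish : (Σ R λ η → Supp (Δ∋ δ) η × difference ξ' (ℚ.- β) ≋ (one - [ Tmat ]) * η) →
               IsAlpha δ L ξ (ℚ.- β)
      finish (η , t , f) = η , Supp⇒In𝓡Δ η t ,
        ≋⇒≈ {difference ξ (ℚ.- β)} {(one - [ Tmat ]) * η}
          (λ h inv → trans (difference-resp ξ' (ℚ.- β) e h inv) (f h inv))

  -- Elements of (1 - T)𝓡 have vanishing orbit sums. At a representative N with c = 0 the orbit sum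
  -- of the difference is -β - α, since `cusp N` is 1; such an N exists because `L` covers δ.
  unique : ∀ α → IsAlpha δ L ξ α → β ≡ ℚ.- α
  unique α (η , _ , e) = go reps
    where
    lem : ∀ b a → b ≡ ℚ.- ((ℚ.- b ℚ.- a) ℚ.* 1ℚ) ℚ.- a
    lem = solve-∀ ringℚ
    at : ∀ N → InΔ δ N × c N ≡ 0ℤ → β ≡ ℚ.- α
    at N (p , cN) = trans (lem β α) (trans (cong (λ x → ℚ.- x ℚ.- α) (begin
      (ℚ.- β ℚ.- α) ℚ.* 1ℚ                          ≡⟨ cong ((ℚ.- β ℚ.- α) ℚ.*_) (sym cusp≡1) ⟩
      (ℚ.- β ℚ.- α) ℚ.* cusp N                      ≡⟨ sym (difference-sum α (to-Δ p)) ⟩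
      ev (χ N) (difference ξ α)                     ≡⟨ ≈⇒≋ {difference ξ α} {(one - [ Tmat ]) * η} e (χ N) (χ-inv N) ⟩
      ev (χ N) ((one - [ Tmat ]) * η)               ≡⟨ ev-1-g Tmat (χ-inv N) η ⟩
      ev (χ N) η ℚ.- ev (χ N ∘ (Tmat ∙_)) η         ≡⟨ cong (λ x → ev (χ N) η ℚ.- x) (ev-cong (χ-T N) η) ⟩
      ev (χ N) η ℚ.- ev (χ N) η                     ≡⟨ ℚP.+-inverseʳ (ev (χ N) η) ⟩
      0ℚ                                            ∎)) (ℚP.+-identityˡ (ℚ.- α)))
      where
      open ≡-Reasoning
      cusp≡1 : cusp N ≡ 1ℚ
      cusp≡1 = cong₂ ℚ._-_ (𝟙-yes (c N ℤP.≟ 0ℤ) cN) (𝟙-no (d N ℤP.≟ 0ℤ) (bottom-row≢0 N cN))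
    pick : ∀ {L} M → All (λ N → InΔ δ N × c N ≡ 0ℤ) L → Any (λ N → InLeftCoset N M) L → β ≡ ℚ.- α
    pick {N ∷ _} M (p ∷ _)  (here _)    = at N p
    pick {_ ∷ _} M (_ ∷ ps) (there any) = pick M ps any
    go : IsRepsInfty δ L → β ≡ ℚ.- α
    go (tri , _ , cover) = pick δ tri (cover δ (from-Δ (Δ-self δ)))

-- Congruent matrices of the same determinant n have the same right coset, so
-- there are at most n⁴ cosets.

record Congruent (n : ℤ) (M N : Mat) : Set where
  constructor congruent
  field
    aa : n ∣ a N ℤ.- a M
    bb : n ∣ b N ℤ.- b M
    cc : n ∣ c N ℤ.- c M
    dd : n ∣ d N ℤ.- d M

private
  -- One entry of adj(M)N = adj(M)M + adj(M)(N - M): n = det M divides the first term, and the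
  -- second by congruence.
  column : ∀ n x z u v w y → n ∣ u ℤ.- x → n ∣ v ℤ.- z → ∀ m →
           w ℤ.* x ℤ.+ y ℤ.* z ≡ m ℤ.* n → n ∣ w ℤ.* u ℤ.+ y ℤ.* v
  column n x z u v w y (divides p e) (divides q f) m g = divides (m ℤ.+ (w ℤ.* p ℤ.+ y ℤ.* q)) (begin
    w ℤ.* u ℤ.+ y ℤ.* v                                                    ≡⟨ lem w u y v x z ⟩
    (w ℤ.* x ℤ.+ y ℤ.* z) ℤ.+ (w ℤ.* (u ℤ.- x) ℤ.+ y ℤ.* (v ℤ.- z))        ≡⟨ cong₂ ℤ._+_ g (cong₂ (λ s t → w ℤ.* s ℤ.+ y ℤ.* t) e f) ⟩
    m ℤ.* n ℤ.+ (w ℤ.* (p ℤ.* n) ℤ.+ y ℤ.* (q ℤ.* n))                      ≡⟨ lem' m n w p y q ⟩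
    (m ℤ.+ (w ℤ.* p ℤ.+ y ℤ.* q)) ℤ.* n                                    ∎)
    where
    open ≡-Reasoning
    lem : ∀ w u y v x z → w ℤ.* u ℤ.+ y ℤ.* v ≡
      (w ℤ.* x ℤ.+ y ℤ.* z) ℤ.+ (w ℤ.* (u ℤ.- x) ℤ.+ y ℤ.* (v ℤ.- z))
    lem = ℤSolver.solve-∀
    lem' : ∀ m n w p y q → m ℤ.* n ℤ.+ (w ℤ.* (p ℤ.* n) ℤ.+ y ℤ.* (q ℤ.* n))
      ≡ (m ℤ.+ (w ℤ.* p ℤ.+ y ℤ.* q)) ℤ.* n
    lem' = ℤSolver.solve-∀

opaque
  unfolding _∙_ adj

  congruent-divisible : ∀ M N → Congruent (det M) M N → Divisible (det M) (adj M ∙ N)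
  congruent-divisible M N (congruent p q r s) =
    column (det M) (a M) (c M) (a N) (c N) (d M) (ℤ.- b M) p r 1ℤ (e₁ (a M) (b M) (c M) (d M)) ,
    column (det M) (b M) (d M) (b N) (d N) (d M) (ℤ.- b M) q s 0ℤ (e₂ (det M) (b M) (d M)) ,
    column (det M) (a M) (c M) (a N) (c N) (ℤ.- c M) (a M) p r 0ℤ (e₃ (det M) (a M) (c M)) ,
    column (det M) (b M) (d M) (b N) (d N) (ℤ.- c M) (a M) q s 1ℤ (e₄ (a M) (b M) (c M) (d M))
    where
    e₁ : ∀ x y z w → w ℤ.* x ℤ.+ (ℤ.- y) ℤ.* z ≡ 1ℤ ℤ.* (x ℤ.* w ℤ.- y ℤ.* z)
    e₁ = ℤSolver.solve-∀
    e₂ : ∀ n y w → w ℤ.* y ℤ.+ (ℤ.- y) ℤ.* w ≡ 0ℤ ℤ.* n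
    e₂ = ℤSolver.solve-∀
    e₃ : ∀ n x z → (ℤ.- z) ℤ.* x ℤ.+ x ℤ.* z ≡ 0ℤ ℤ.* n
    e₃ = ℤSolver.solve-∀
    e₄ : ∀ x y z w → (ℤ.- z) ℤ.* y ℤ.+ x ℤ.* w ≡ 1ℤ ℤ.* (x ℤ.* w ℤ.- y ℤ.* z)
    e₄ = ℤSolver.solve-∀

congruent⇒RC : ∀ M N → det N ≡ det M → Congruent (det M) M N → RC M N
congruent⇒RC M N e p = divisible⇒RC M N e (congruent-divisible M N p)

residue : ∀ n .{{_ : ℕ.NonZero n}} → ℤ → Fin n
residue n x = fromℕ< (ℤDM.n%ℕd<d x n)

residue-∣ : ∀ n .{{_ : ℕ.NonZero n}} x y → residue n x ≡ residue n y → + n ∣ y ℤ.- x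
residue-∣ n x y e = divides (y ℤDM./ℕ n ℤ.- x ℤDM./ℕ n) (begin
  y ℤ.- x
    ≡⟨ cong₂ ℤ._-_ (ℤDM.a≡a%ℕn+[a/ℕn]*n y n) (ℤDM.a≡a%ℕn+[a/ℕn]*n x n) ⟩
  (+ (y ℤDM.%ℕ n) ℤ.+ (y ℤDM./ℕ n) ℤ.* + n) ℤ.- (+ (x ℤDM.%ℕ n) ℤ.+ (x ℤDM./ℕ n) ℤ.* + n)
    ≡⟨ cong (λ r → (+ (y ℤDM.%ℕ n) ℤ.+ (y ℤDM./ℕ n) ℤ.* + n) ℤ.- (+ r ℤ.+ (x ℤDM./ℕ n) ℤ.* + n)) same ⟩
  (+ (y ℤDM.%ℕ n) ℤ.+ (y ℤDM./ℕ n) ℤ.* + n) ℤ.- (+ (y ℤDM.%ℕ n) ℤ.+ (x ℤDM./ℕ n) ℤ.* + n)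
    ≡⟨ lem (+ (y ℤDM.%ℕ n)) (y ℤDM./ℕ n) (x ℤDM./ℕ n) (+ n) ⟩
  (y ℤDM./ℕ n ℤ.- x ℤDM./ℕ n) ℤ.* + n ∎)
  where
  open ≡-Reasoning
  lem : ∀ r p q n → (r ℤ.+ p ℤ.* n) ℤ.- (r ℤ.+ q ℤ.* n) ≡ (p ℤ.- q) ℤ.* n
  lem = ℤSolver.solve-∀
  same : x ℤDM.%ℕ n ≡ y ℤDM.%ℕ n
  same = trans (sym (FinP.toℕ-fromℕ< (ℤDM.n%ℕd<d x n))) (trans (cong toℕ e) (FinP.toℕ-fromℕ< (ℤDM.n%ℕd<d y n)))

module Cosets (δ : Mat) where

  private
    n : ℕ
    n = ∣ det δ ∣

    instance
      n≢0 : ℕ.NonZero n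
      n≢0 = ℕ.≢-nonZero (λ e → det≢0 δ (ℤP.∣i∣≡0⇒i≡0 e))

    +n : + n ≡ det δ
    +n = ℤP.0≤i⇒+∣i∣≡i (ℤP.<⇒≤ (det>0 δ))

    bound : ℕ
    bound = (n ℕ.* n) ℕ.* (n ℕ.* n)

    code : Mat → Fin bound
    code M = combine (combine (residue n (a M)) (residue n (b M)))
                     (combine (residue n (c M)) (residue n (d M)))

    Δ-det : ∀ {M} → Δ∋ δ M → det M ≡ det δ
    Δ-det (double g h (unimodular p) hΓ r) = trans (RC-det (coset h hΓ r))
      (trans (det-∙ g δ) (trans (cong (ℤ._* det δ) p) (ℤP.*-identityˡ (det δ))))

    code-RC : ∀ {M N} → Δ∋ δ M → Δ∋ δ N → code M ≡ code N → RC M N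
    code-RC {M} {N} M∈Δ N∈Δ e = go
      (FinP.combine-injective (combine (residue n (a M)) (residue n (b M))) (combine (residue n (c M)) (residue n (d M)))
                              (combine (residue n (a N)) (residue n (b N))) (combine (residue n (c N)) (residue n (d N))) e)
      where
      div : ∀ x y → residue n x ≡ residue n y → det M ∣ y ℤ.- x
      div x y p = subst (_∣ y ℤ.- x) (trans +n (sym (Δ-det M∈Δ))) (residue-∣ n x y p)
      go : (combine (residue n (a M)) (residue n (b M)) ≡ combine (residue n (a N)) (residue n (b N))) ×
           (combine (residue n (c M)) (residue n (d M)) ≡ combine (residue n (c N)) (residue n (d N))) → RC M N
      go (p , q) = finish
        (FinP.combine-injective (residue n (a M)) (residue n (b M)) (residue n (a N)) (residue n (b N)) p)
        (FinP.combine-injective (residue n (c M)) (residue n (d M)) (residue n (c N)) (residue n (d N)) q)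
        where
        finish : (residue n (a M) ≡ residue n (a N)) × (residue n (b M) ≡ residue n (b N)) →
                 (residue n (c M) ≡ residue n (c N)) × (residue n (d M) ≡ residue n (d N)) → RC M N
        finish (p , q) (r , s) = congruent⇒RC M N (trans (Δ-det N∈Δ) (sym (Δ-det M∈Δ)))
          (congruent (div (a M) (a N) p) (div (b M) (b N) q) (div (c M) (c N) r) (div (d M) (d N) s))

    Distinct : List Mat → Set
    Distinct = AllPairs (λ M N → ¬ RC M N)

    Reaches : List Mat → Mat → Set
    Reaches L M = Any (λ N → RC N M) L

    lookup-distinct : ∀ {L} → Distinct L → ∀ {i j} → i Fin.< j → ¬ RC (lookup L i) (lookup L j)
    lookup-distinct (p ∷ ps) {Fin.zero}  {Fin.suc j} _           = All.lookup p (∈-lookup j)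
    lookup-distinct (p ∷ ps) {Fin.suc i} {Fin.suc j} (ℕ.s≤s i<j) = lookup-distinct ps i<j

    bounded : ∀ L → Distinct L → All (Δ∋ δ) L → length L ℕ.≤ bound
    bounded L distinct L⊆Δ = ℕP.≮⇒≥ λ l → clash (FinP.pigeonhole l (code ∘ lookup L))
      where
      clash : (Σ (Fin (length L)) λ i → Σ (Fin (length L)) λ j →
                 i Fin.< j × code (lookup L i) ≡ code (lookup L j)) → ⊥
      clash (i , j , i<j , e) = lookup-distinct distinct i<j
        (code-RC (All.lookup L⊆Δ (∈-lookup i)) (All.lookup L⊆Δ (∈-lookup j)) e)

    Closed : List Mat → Set
    Closed L = All (λ N → Reaches L (Smat ∙ N) × Reaches L (Umat ∙ N)) L

  record Representatives : Set where
    field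
      reps     : List Mat
      distinct : AllPairs (λ M N → ¬ RC M N) reps
      inΔ      : All (Δ∋ δ) reps
      start    : Any (λ N → RC N δ) reps
      closed   : All (λ N → Any (λ P → RC P (Smat ∙ N)) reps × Any (λ P → RC P (Umat ∙ N)) reps) reps

  private
    -- Starting from δ, a missing coset of SN or UN is added until none is missing, so membership in
    -- Δ holds by construction. Each addition spends one unit of fuel, and a list longer than
    -- `bound` contradicts the pigeonhole principle.
    close : ∀ fuel L → Distinct L → All (Δ∋ δ) L → Reaches L δ →
            bound ℕ.< length L ℕ.+ fuel → Representatives
    close zero L distinct L⊆Δ start l = ⊥-elim (ℕP.<-irrefl refl
      (ℕP.<-≤-trans (subst (bound ℕ.<_) (ℕP.+-identityʳ (length L)) l) (bounded L distinct L⊆Δ)))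
    close (suc fuel) L distinct L⊆Δ start l = go (All.all? closed-at? L)
      where
      reaches? : ∀ M → Dec (Reaches L M)
      reaches? M = any? (λ N → RC? N M) L
      closed-at? : ∀ N → Dec (Reaches L (Smat ∙ N) × Reaches L (Umat ∙ N))
      closed-at? N = reaches? (Smat ∙ N) ×-dec reaches? (Umat ∙ N)
      extend : ∀ M → Δ∋ δ M → ¬ Reaches L M → Representatives
      extend M M∈Δ new = close fuel (M ∷ L)
        (AllP.¬Any⇒All¬ L (λ r → new (Any.map RC-sym r)) ∷ distinct) (M∈Δ ∷ L⊆Δ) (there start)
        (subst (bound ℕ.<_) (ℕP.+-suc (length L) fuel) l)
      grow : ∀ N → Δ∋ δ N → ¬ (Reaches L (Smat ∙ N) × Reaches L (Umat ∙ N)) → Representatives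
      grow N N∈Δ open-at with reaches? (Smat ∙ N) | reaches? (Umat ∙ N)
      ... | no new | _      = extend (Smat ∙ N) (Δ-∙ˡ Γ-S N∈Δ) new
      ... | yes _  | no new = extend (Umat ∙ N) (Δ-∙ˡ Γ-U N∈Δ) new
      ... | yes s  | yes u  = ⊥-elim (open-at (s , u))
      go : Dec (Closed L) → Representatives
      go (yes closed) = record
        { reps = L ; distinct = distinct ; inΔ = L⊆Δ ; start = start ; closed = closed }
      go (no ¬closed) = witness (AllP.¬All⇒Any¬ closed-at? L ¬closed)
        where
        witness : Any (λ N → ¬ (Reaches L (Smat ∙ N) × Reaches L (Umat ∙ N))) L → Representatives
        witness w = let (N∈Δ , open-at) = All.lookupAny L⊆Δ w in grow (Any.lookup w) N∈Δ open-at

  representatives : Representatives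
  representatives = close bound (δ ∷ []) ([] ∷ []) (Δ-self δ ∷ []) (here (RC-refl δ)) ℕP.≤-refl

  open Representatives representatives public

  -- For M = gδh, closure under S and U carries the coset of δ along a word for g to gδΓ = MΓ.
  covers : ∀ {M} → Δ∋ δ M → Any (λ N → RC N M) reps
  covers (double g h gΓ hΓ r) = Any.map (λ s → RC-trans s (coset h hΓ r)) (reach gΓ)
    where
    transfer : ∀ {G g} → All (λ N → Any (λ P → RC P (G ∙ N)) reps) reps →
               Any (λ N → RC N (g ∙ δ)) reps → Any (λ N → RC N ((G ∙ g) ∙ δ)) reps
    transfer {G} {g} step any = let (next , s) = All.lookupAny step any in
      Any.map (λ t → RC-trans t (RC-resp ≃-refl (≃-sym (∙-assoc G g δ)) (RC-∙ˡ G s))) next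
    reach : ∀ {g} → Γ∋ g → Any (λ N → RC N (g ∙ δ)) reps
    reach = Generation.generated (λ g → Any (λ N → RC N (g ∙ δ)) reps)
      (λ e → Any.map (RC-resp ≃-refl (∙-congʳ δ (≃-sym e))))
      (Any.map (RC-resp ≃-refl (≃-sym (∙-identityˡ δ))) start)
      (transfer (All.map proj₁ closed)) (transfer (All.map proj₂ closed))

  module _ (q : ℚ) where

    uniform : R
    uniform = map (q ,_) reps

    private
      sum-none : ∀ M L → All (λ N → ¬ RC M N) L → ev (φ M) (map (q ,_) L) ≡ 0ℚ
      sum-none M []      []       = refl
      sum-none M (N ∷ L) (p ∷ ps) = trans
        (cong₂ (λ x y → q ℚ.* x ℚ.+ y) (𝟙-no (RC? M N) p) (sum-none M L ps)) (lem q)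
        where
        lem : ∀ q → q ℚ.* 0ℚ ℚ.+ 0ℚ ≡ 0ℚ
        lem = solve-∀ ringℚ

      sum-one : ∀ M L → Distinct L → Any (λ N → RC N M) L → ev (φ M) (map (q ,_) L) ≡ q
      sum-one M (N ∷ L) (p ∷ ps) (here r) = trans
        (cong₂ (λ x y → q ℚ.* x ℚ.+ y) (𝟙-yes (RC? M N) (RC-sym r))
          (sum-none M L (All.map (λ N≁P M∼P → N≁P (RC-trans r M∼P)) p))) (lem q)
        where
        lem : ∀ q → q ℚ.* 1ℚ ℚ.+ 0ℚ ≡ q
        lem = solve-∀ ringℚ
      sum-one M (N ∷ L) (p ∷ ps) (there any) = trans
        (cong₂ (λ x y → q ℚ.* x ℚ.+ y)
          (𝟙-no (RC? M N) (λ M∼N → let (N≁P , r) = All.lookupAny p any in N≁P (RC-sym (RC-trans r M∼N))))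
          (sum-one M L ps any)) (lem q)
        where
        lem : ∀ q → q ℚ.* 0ℚ ℚ.+ q ≡ q
        lem = solve-∀ ringℚ

    uniform-sum : ∀ {M} → Δ∋ δ M → ev (φ M) uniform ≡ q
    uniform-sum {M} M∈Δ = sum-one M reps distinct (covers M∈Δ)

    uniform-Δ : Supp (Δ∋ δ) uniform
    uniform-Δ = AllP.map⁺ inΔ

-- Right multiplication by πS and πU, on functions

mS mU : (Mat → ℚ) → Mat → ℚ
mS h M = meanS (h M) (h (M ∙ Smat))
mU h M = meanU (h M) (h (M ∙ Umat)) (h ((M ∙ Umat) ∙ Umat))

-- What the lifting argument uses of a right factor π: compatibility with signs, and (AM)π = A(Mπ).
record Mean (m : (Mat → ℚ) → Mat → ℚ) : Set where
  field
    inv   : ∀ {h} → Inv h → Inv (m h)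
    shift : ∀ {h} A → Inv h → ∀ M → m h (A ∙ M) ≡ m (h ∘ (A ∙_)) M

Mean-S : Mean mS
Mean-S = record
  { inv = λ inv r → cong₂ meanS (inv r) (inv (∙-congʳ Smat r))
  ; shift = λ {h} A inv M → cong (meanS (h (A ∙ M))) (inv (∙-assoc A M Smat)) }

Mean-U : Mean mU
Mean-U = record
  { inv = λ inv r → cong₃ (inv r) (inv (∙-congʳ Umat r)) (inv (∙-congʳ Umat (∙-congʳ Umat r)))
  ; shift = λ {h} A inv M → cong₂ (meanU (h (A ∙ M))) (inv (∙-assoc A M Umat))
      (inv (≃-trans (∙-congʳ Umat (∙-assoc A M Umat)) (∙-assoc A (M ∙ Umat) Umat))) }
  where
  cong₃ : ∀ {x x' y y' z z'} → x ≡ x' → y ≡ y' → z ≡ z' → meanU x y z ≡ meanU x' y' z'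
  cong₃ refl refl refl = refl

-- The identity Sπ_S = π_S, read through pairings.
fixS : ∀ {h} → Inv h → mS h Smat ≡ mS h Imat
fixS {h} inv = trans (cong₂ meanS (inv (≃-sym (∙-identityˡ Smat))) (inv SS≃I))
  (lem (h (Imat ∙ Smat)) (h Imat))
  where
  lem : ∀ x y → (½ ℚ.* 1ℚ) ℚ.* x ℚ.+ ((½ ℚ.* 1ℚ) ℚ.* y ℚ.+ 0ℚ)
        ≡ (½ ℚ.* 1ℚ) ℚ.* y ℚ.+ ((½ ℚ.* 1ℚ) ℚ.* x ℚ.+ 0ℚ)
  lem = solve-∀ ringℚ

fixU : ∀ {h} → Inv h → mU h Umat ≡ mU h Imat
fixU {h} inv = trans
  (trans (cong₂ (λ x y → meanU x y (h ((Umat ∙ Umat) ∙ Umat))) (inv (≃-sym (∙-identityˡ Umat)))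
           (inv (∙-congʳ Umat (≃-sym (∙-identityˡ Umat)))))
         (cong (meanU (h (Imat ∙ Umat)) (h ((Imat ∙ Umat) ∙ Umat)))
           (inv (≃-trans (∙-assoc Umat Umat Umat) UUU≃I))))
  (lem (h (Imat ∙ Umat)) (h ((Imat ∙ Umat) ∙ Umat)) (h Imat))
  where
  lem : ∀ x y z → (⅓ ℚ.* 1ℚ) ℚ.* x ℚ.+ ((⅓ ℚ.* 1ℚ) ℚ.* y ℚ.+ ((⅓ ℚ.* 1ℚ) ℚ.* z ℚ.+ 0ℚ))
        ≡ (⅓ ℚ.* 1ℚ) ℚ.* z ℚ.+ ((⅓ ℚ.* 1ℚ) ℚ.* x ℚ.+ ((⅓ ℚ.* 1ℚ) ℚ.* y ℚ.+ 0ℚ))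
  lem = solve-∀ ringℚ

-- If m and m' are right multiplication by π and π', then Lift g asks for
-- x ∈ ℚ[Γ] with xπ = (g − 1)π and xπ' = 0.  A generator fixing π
-- contributes 0, and a generator g fixing π' contributes g − 1.
module Lifting
  (m m' : (Mat → ℚ) → Mat → ℚ) (mean : Mean m) (mean' : Mean m')
  where

  module M  = Mean mean
  module M' = Mean mean'

  record Lift (g : Mat) : Set where
    constructor lift
    field
      x     : R
      supp  : Supp Γ∋ x
      onto  : ∀ {h} → Inv h → ev (m h) x ≡ m h g ℚ.- m h Imat
      kills : ∀ {h} → Inv h → ev (m' h) x ≡ 0ℚ

  ev-shift : ∀ {h} A → Inv h → ∀ x → ev (m h) ([ A ] * x) ≡ ev (m (h ∘ (A ∙_))) x
  ev-shift {h} A inv x = trans (ev-∙ (m h) [ A ] x)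
    (trans (ev-[] (λ B → ev (λ N → m h (B ∙ N)) x) A) (ev-cong (M.shift A inv) x))

  ev-shift' : ∀ {h} A → Inv h → ∀ x → ev (m' h) ([ A ] * x) ≡ ev (m' (h ∘ (A ∙_))) x
  ev-shift' {h} A inv x = trans (ev-∙ (m' h) [ A ] x)
    (trans (ev-[] (λ B → ev (λ N → m' h (B ∙ N)) x) A) (ev-cong (M'.shift A inv) x))

  at-I : ∀ {h} A → Inv h → m (h ∘ (A ∙_)) Imat ≡ m h A
  at-I A inv = trans (sym (M.shift A inv Imat)) (M.inv inv (∙-identityʳ A))

  Lift-resp : ∀ {g g'} → g ≃ g' → Lift g' → Lift g
  Lift-resp r (lift x s p p') = lift x s
    (λ {h} inv → trans (p inv) (cong (ℚ._- m h Imat) (M.inv inv (≃-sym r)))) p'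

  Lift-I : Lift Imat
  Lift-I = lift [] [] (λ {h} inv → sym (ℚP.+-inverseʳ (m h Imat))) (λ _ → refl)

  Supp-shift : ∀ {A} → Γ∋ A → ∀ x → Supp Γ∋ x → Supp Γ∋ ([ A ] * x)
  Supp-shift {A} AΓ x s = Supp-* {Γ∋} {Γ∋} {Γ∋} Γ-∙ [ A ] x (AΓ ∷ []) s

  -- With Gπ = π, the element Gx works: Gxπ = Ggπ - Gπ = (Gg - 1)π.
  Lift-fix : ∀ {G} → Γ∋ G → (∀ {h} → Inv h → m h G ≡ m h Imat) → ∀ {g} → Lift g → Lift (G ∙ g)
  Lift-fix {G} GΓ fix {g} (lift x s p p') = lift ([ G ] * x) (Supp-shift GΓ x s)
    (λ {h} inv → trans (ev-shift G inv x) (trans (p (Inv-∙ G inv))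
      (cong₂ ℚ._-_ (sym (M.shift G inv g)) (trans (at-I G inv) (fix inv)))))
    (λ inv → trans (ev-shift' G inv x) (p' (Inv-∙ G inv)))

  -- The cocycle identity Gg - 1 = G(g - 1) + (G - 1) suggests Gx + (G - 1), which π' kills because
  -- Gπ' = π'.
  Lift-move : ∀ {G} → Γ∋ G → (∀ {h} → Inv h → m' h G ≡ m' h Imat) → ∀ {g} → Lift g → Lift (G ∙ g)
  Lift-move {G} GΓ fix' {g} (lift x s p p') = lift ([ G ] * x + ([ G ] - one))
    (AllP.++⁺ (Supp-shift GΓ x s) (GΓ ∷ Γ-I ∷ []))
    (λ {h} inv → trans (ev-++ (m h) ([ G ] * x) ([ G ] - one))
      (trans (cong (ℚ._+ ev (m h) ([ G ] - one))
        (trans (ev-shift G inv x) (trans (p (Inv-∙ G inv))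
          (cong₂ ℚ._-_ (sym (M.shift G inv g)) (at-I G inv)))))
        (lem (m h (G ∙ g)) (m h G) (m h Imat))))
    (λ {h} inv → trans (ev-++ (m' h) ([ G ] * x) ([ G ] - one))
      (trans (cong₂ (λ u v → u ℚ.+ (1ℚ ℚ.* v ℚ.+ (((ℚ.- 1ℚ) ℚ.* 1ℚ) ℚ.* m' h Imat ℚ.+ 0ℚ)))
        (trans (ev-shift' G inv x) (p' (Inv-∙ G inv))) (fix' inv))
        (lem' (m' h Imat))))
    where
    lem : ∀ x y z → (x ℚ.- y) ℚ.+ (1ℚ ℚ.* y ℚ.+ (((ℚ.- 1ℚ) ℚ.* 1ℚ) ℚ.* z ℚ.+ 0ℚ)) ≡ x ℚ.- z
    lem = solve-∀ ringℚ
    lem' : ∀ z → 0ℚ ℚ.+ (1ℚ ℚ.* z ℚ.+ (((ℚ.- 1ℚ) ℚ.* 1ℚ) ℚ.* z ℚ.+ 0ℚ)) ≡ 0ℚ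
    lem' = solve-∀ ringℚ

  module Correction (lifts : ∀ {g} → Γ∋ g → Lift g) (δ : Mat) where

    Corrects : R → R → Set
    Corrects ω x = Supp (Δ∋ δ) x ×
      ((∀ {h} → Inv h → ev (m h) x ≡ ev (m h) ω) × (∀ {h} → Inv h → ev (m' h) x ≡ 0ℚ))

    private
      J : R → Set
      J ω = Σ R (Corrects ω)

      J-resp : ∀ {ω ω'} → (∀ h → ev h ω ≡ ev h ω') → J ω → J ω'
      J-resp e (x , s , p , p') = x , s , (λ {h} inv → trans (p inv) (e (m h))) , p'

      J-0 : J []
      J-0 = [] , [] , (λ _ → refl) , (λ _ → refl)

      J-+ : ∀ {ω ω'} → J ω → J ω' → J (ω + ω')
      J-+ {ω} {ω'} (x , s , p , p') (y , t , r , r') = x + y , AllP.++⁺ s t ,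
        (λ {h} inv → trans (ev-++ (m h) x y) (trans (cong₂ ℚ._+_ (p inv) (r inv)) (sym (ev-++ (m h) ω ω')))) ,
        (λ {h} inv → trans (ev-++ (m' h) x y) (cong₂ ℚ._+_ (p' inv) (r' inv)))

      J-gen : ∀ q {M N} → Δ∋ δ M → Δ∋ δ N → RC M N → J (q ⋆ ([ N ] - [ M ]))
      J-gen q {M} {N} M∈Δ N∈Δ (coset g gΓ e) = go (lifts gΓ)
        where
        go : Lift g → J (q ⋆ ([ N ] - [ M ]))
        go (lift x s p p') = q ⋆ ([ M ] * x) ,
          Supp-⋆ q ([ M ] * x) (Supp-* {Δ∋ δ} {Γ∋} {Δ∋ δ} (λ d γ → Δ-∙ʳ γ d) [ M ] x (M∈Δ ∷ []) s) ,
          (λ {h} inv → trans (ev-⋆ (m h) q ([ M ] * x))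
            (trans (cong (q ℚ.*_) (trans (ev-shift M inv x) (trans (p (Inv-∙ M inv))
              (cong₂ ℚ._-_ (trans (sym (M.shift M inv g)) (M.inv inv (≃-sym e))) (at-I M inv)))))
            (lem q (m h N) (m h M)))) ,
          (λ {h} inv → trans (ev-⋆ (m' h) q ([ M ] * x))
            (trans (cong (q ℚ.*_) (trans (ev-shift' M inv x) (p' (Inv-∙ M inv)))) (ℚP.*-zeroʳ q)))
          where
          lem : ∀ q x y → q ℚ.* (x ℚ.- y) ≡ (q ℚ.* 1ℚ) ℚ.* x ℚ.+ ((q ℚ.* ((ℚ.- 1ℚ) ℚ.* 1ℚ)) ℚ.* y ℚ.+ 0ℚ)
          lem = solve-∀ ringℚ

    -- With zero coset sums, ω is a combination of terms M(g - 1) with g ∈ Γ; replacing g - 1 by its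
    -- lift x gives Mx, with the same product by π and with product 0 by π'.
    correction : ∀ ω → Supp (Δ∋ δ) ω → (∀ M → Δ∋ δ M → ev (φ M) ω ≡ 0ℚ) → Σ R (Corrects ω)
    correction = Collapse.collapse RC RC? RC-refl RC-sym RC-trans (Δ∋ δ) J
      (λ {ω} {ω'} → J-resp {ω} {ω'}) J-0 (λ {ω} {ω'} → J-+ {ω} {ω'}) J-gen

module LiftS = Lifting mS mU Mean-S Mean-U
module LiftU = Lifting mU mS Mean-U Mean-S

liftsS : ∀ {g} → Γ∋ g → LiftS.Lift g
liftsS = Generation.generated LiftS.Lift LiftS.Lift-resp LiftS.Lift-I
  (LiftS.Lift-fix Γ-S fixS) (LiftS.Lift-move Γ-U fixU)

liftsU : ∀ {g} → Γ∋ g → LiftU.Lift g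
liftsU = Generation.generated LiftU.Lift LiftU.Lift-resp LiftU.Lift-I
  (LiftU.Lift-move Γ-S fixS) (LiftU.Lift-fix Γ-U fixU)

-- Surjectivity of β

*-assoc : ∀ ξ η ζ → (ξ * η) * ζ ≋ ξ * (η * ζ)
*-assoc ξ η ζ h inv = begin
  ev h ((ξ * η) * ζ)
    ≡⟨ ev-∙ h (ξ * η) ζ ⟩
  ev (λ P → ev (λ C → h (P ∙ C)) ζ) (ξ * η)
    ≡⟨ ev-∙ (λ P → ev (λ C → h (P ∙ C)) ζ) ξ η ⟩
  ev (λ A → ev (λ B → ev (λ C → h ((A ∙ B) ∙ C)) ζ) η) ξ
    ≡⟨ ev-cong (λ A → trans (ev-cong (λ B → ev-cong (λ C → inv (∙-assoc A B C)) ζ) η)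
                            (sym (ev-∙ (λ P → h (A ∙ P)) η ζ))) ξ ⟩
  ev (λ A → ev (λ P → h (A ∙ P)) (η * ζ)) ξ
    ≡⟨ sym (ev-∙ h ξ (η * ζ)) ⟩
  ev h (ξ * (η * ζ)) ∎
  where open ≡-Reasoning

module Surjective (δ : Mat) (q : ℚ) where

  private
    Y : R
    Y = Cosets.uniform δ q

    -- Left multiplication by G permutes the right cosets in Δ, and Y has the same sum on each.
    -- Hence π_U Y - Y and π_S Y - Y have zero coset sums and can be corrected.
    sum-left : ∀ {M G} → Γ∋ G → Δ∋ δ M → ev (φ M ∘ (G ∙_)) Y ≡ q
    sum-left {M} {G} GΓ M∈Δ = trans (ev-cong move Y) (Cosets.uniform-sum δ q (Δ-∙ˡ (Γ-adj GΓ) M∈Δ))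
      where
      move : ∀ N → φ M (G ∙ N) ≡ φ (adj G ∙ M) N
      move N = trans
        (φ-resp (≃-sym (≃-trans (≃-sym (∙-assoc G (adj G) M))
          (≃-trans (∙-congʳ M (adj-inverseʳ GΓ)) (∙-identityˡ M)))) ≃-refl)
        (φ-∙ˡ (adj G ∙ M) N GΓ)

    sum-πU : ∀ {M} → Δ∋ δ M → ev (φ M) (πU * Y) ≡ q
    sum-πU {M} M∈Δ = trans (ev-πUˡ (φ-inv M) Y)
      (trans (cong₂ (λ x y → meanU x y (ev (φ M ∘ (Umat ∙_) ∘ (Umat ∙_)) Y))
                (Cosets.uniform-sum δ q M∈Δ) (sum-left Γ-U M∈Δ))
      (trans (cong (meanU q q) (trans (ev-cong (λ N → φ-resp ≃-refl (≃-sym (∙-assoc Umat Umat N))) Y)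
                (sum-left (Γ-∙ Γ-U Γ-U) M∈Δ)))
             (meanU-const q)))

    sum-πS : ∀ {M} → Δ∋ δ M → ev (φ M) (πS * Y) ≡ q
    sum-πS {M} M∈Δ = trans (ev-πSˡ (φ-inv M) Y)
      (trans (cong₂ meanS (Cosets.uniform-sum δ q M∈Δ) (sum-left Γ-S M∈Δ)) (meanS-const q))

    difference-zero : ∀ π M → Δ∋ δ M → ev (φ M) (π * Y) ≡ q → ev (φ M) (π * Y - Y) ≡ 0ℚ
    difference-zero π M M∈Δ e = trans (ev-- (φ M) (π * Y) Y)
      (trans (cong₂ ℚ._-_ e (Cosets.uniform-sum δ q M∈Δ)) (ℚP.+-inverseʳ q))

    supp : ∀ π → Supp Γ∋ π → Supp (Δ∋ δ) (π * Y - Y)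
    supp π πΓ = Supp-- (Supp-* {Γ∋} {Δ∋ δ} {Δ∋ δ} Δ-∙ˡ π Y πΓ (Cosets.uniform-Δ δ q)) (Cosets.uniform-Δ δ q)

    Γ-UU : Γ∋ (Umat · Umat)
    Γ-UU = unimodular refl

    corrS : Σ R (LiftS.Correction.Corrects liftsS δ (πU * Y - Y))
    corrS = LiftS.Correction.correction liftsS δ (πU * Y - Y) (supp πU (Γ-I ∷ Γ-U ∷ Γ-UU ∷ []))
      (λ M M∈Δ → difference-zero πU M M∈Δ (sum-πU M∈Δ))

    corrU : Σ R (LiftU.Correction.Corrects liftsU δ (πS * Y - Y))
    corrU = LiftU.Correction.correction liftsU δ (πS * Y - Y) (supp πS (Γ-I ∷ Γ-S ∷ []))
      (λ M M∈Δ → difference-zero πS M M∈Δ (sum-πS M∈Δ))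

    assemble : (x y : R) → LiftS.Correction.Corrects liftsS δ (πU * Y - Y) x →
      LiftU.Correction.Corrects liftsU δ (πS * Y - Y) y →
      Σ R λ ξ → In𝓡Δ δ ξ × In𝓑 ξ × ((M : Mat) → InΔ δ M → Pairing M ξ q)
    assemble x y (sx , xS , xU) (sy , yU , yS) =
      ξ , Supp⇒In𝓡Δ ξ (AllP.++⁺ (AllP.++⁺ (Cosets.uniform-Δ δ q) sx) sy) ,
      ((Y * πS , ≋⇒≈ {ξ * πS} {πU * (Y * πS)} left) , (Y * πU , ≋⇒≈ {ξ * πU} {πS * (Y * πU)} right)) ,
      λ M M∈Δ → subst (Pairing M ξ) (value M (to-Δ M∈Δ)) (pairing M ξ)
      where
      open ≡-Reasoning
      ξ : R
      -- Since yπ_S = 0, ξπ_S = Yπ_S + (π_U Y - Y)π_S = π_U Y π_S; since xπ_U = 0, likewise ξπ_U =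
      -- π_S Y π_U. Each correction affects only one of the two products.
      ξ = Y + x + y
      ev-ξ : ∀ h → ev h ξ ≡ (ev h Y ℚ.+ ev h x) ℚ.+ ev h y
      ev-ξ h = trans (ev-++ h (Y + x) y) (cong (ℚ._+ ev h y) (ev-++ h Y x))
      lem₁ : ∀ u v → (u ℚ.+ (v ℚ.- u)) ℚ.+ 0ℚ ≡ v
      lem₁ = solve-∀ ringℚ
      lem₂ : ∀ u v → (u ℚ.+ 0ℚ) ℚ.+ (v ℚ.- u) ≡ v
      lem₂ = solve-∀ ringℚ
      ev-mS : ∀ {h} → Inv h → ev (mS h) ξ ≡ ev (mS h) (πU * Y)
      ev-mS {h} inv = trans (ev-ξ (mS h))
        (trans (cong₂ (λ u v → (ev (mS h) Y ℚ.+ u) ℚ.+ v) (trans (xS inv) (ev-- (mS h) (πU * Y) Y)) (yS inv))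
               (lem₁ (ev (mS h) Y) (ev (mS h) (πU * Y))))
      ev-mU : ∀ {h} → Inv h → ev (mU h) ξ ≡ ev (mU h) (πS * Y)
      ev-mU {h} inv = trans (ev-ξ (mU h))
        (trans (cong₂ (λ u v → (ev (mU h) Y ℚ.+ u) ℚ.+ v) (xU inv) (trans (yU inv) (ev-- (mU h) (πS * Y) Y)))
               (lem₂ (ev (mU h) Y) (ev (mU h) (πS * Y))))
      left : ξ * πS ≋ πU * (Y * πS)
      left h inv = begin
        ev h (ξ * πS)            ≡⟨ ev-πSʳ inv ξ ⟩
        ev (mS h) ξ              ≡⟨ ev-mS inv ⟩
        ev (mS h) (πU * Y)       ≡⟨ sym (ev-πSʳ inv (πU * Y)) ⟩
        ev h ((πU * Y) * πS)     ≡⟨ *-assoc πU Y πS h inv ⟩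
        ev h (πU * (Y * πS))     ∎
      right : ξ * πU ≋ πS * (Y * πU)
      right h inv = begin
        ev h (ξ * πU)            ≡⟨ ev-πUʳ inv ξ ⟩
        ev (mU h) ξ              ≡⟨ ev-mU inv ⟩
        ev (mU h) (πS * Y)       ≡⟨ sym (ev-πUʳ inv (πS * Y)) ⟩
        ev h ((πS * Y) * πU)     ≡⟨ *-assoc πS Y πU h inv ⟩
        ev h (πS * (Y * πU))     ∎
      value : ∀ M → Δ∋ δ M → ev (φ M) ξ ≡ q
      value M M∈Δ = begin
        ev (φ M) ξ               ≡⟨ sym (ev-cong constant ξ) ⟩
        ev (mS (φ M)) ξ          ≡⟨ ev-mS (φ-inv M) ⟩
        ev (mS (φ M)) (πU * Y)   ≡⟨ ev-cong constant (πU * Y) ⟩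
        ev (φ M) (πU * Y)        ≡⟨ sum-πU M∈Δ ⟩
        q                        ∎
        where
        constant : ∀ N → mS (φ M) N ≡ φ M N
        constant N = trans (cong (meanS (φ M N)) (φ-∙ʳ M N Γ-S)) (meanS-const (φ M N))

  surjective : Σ R λ ξ → In𝓡Δ δ ξ × In𝓑 ξ × ((M : Mat) → InΔ δ M → Pairing M ξ q)
  surjective = assemble (proj₁ corrS) (proj₁ corrU) (proj₂ corrS) (proj₂ corrU)

𝓑⊆𝓐 : ∀ ξ → In𝓑 ξ → In𝓐 ξ
-- `πS * []` reduces to `[]`, so `e` fits as it stands; in the second component the empty summand is
-- on the right of `++` and needs an argument.
𝓑⊆𝓐 ξ ((η , e) , (η' , e')) = ([] , η , e) ,
  (η' , [] , ≋⇒≈ {ξ * πU} {πS * η' + πU * []} λ h inv → trans (≈⇒≋ {ξ * πU} {πS * η'} e' h inv)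
    (trans (sym (ℚP.+-identityʳ _)) (sym (ev-++ h (πS * η') (πU * [])))))

theorem3 : (δ : Mat) →
    ((ξ : R) → In𝓡Δ δ ξ → In𝓑 ξ → In𝓐 ξ)
    × ((ξ : R) → In𝓡Δ δ ξ → In𝓑 ξ →
    Σ ℚ λ β →
    ((M : Mat) → InΔ δ M → Pairing M ξ β)
    × ((L : List Mat) → IsRepsInfty δ L → IsAlpha δ L ξ (- β))
    × ((L : List Mat) (α : ℚ) → IsRepsInfty δ L → IsAlpha δ L ξ α →
    β ≡ - α))
    × ((q : ℚ) → Σ R λ ξ → In𝓡Δ δ ξ × In𝓑 ξ
    × ((M : Mat) → InΔ δ M → Pairing M ξ q))
theorem3 δ =
  (λ ξ _ → 𝓑⊆𝓐 ξ) ,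
  (λ ξ ξΔ ξ𝓑 → ev (φ δ) ξ ,
    (λ M M∈Δ → subst (Pairing M ξ) (coset-sum ξ ξ𝓑 (to-Δ M∈Δ)) (pairing M ξ)) ,
    -- α(ξ) is given only by its defining property, so (b) is proved as two facts: -β has the
    -- property, and any α that has it satisfies β = -α.
    (λ L reps → Alpha.exists δ ξ ξΔ ξ𝓑 L reps) ,
    (λ L α reps → Alpha.unique δ ξ ξΔ ξ𝓑 L reps α)) ,
  Surjective.surjective δ
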